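{- There is an adaptive distribution tester for the property of being the uniform distribution over $[n]$ (that is, for the property $\{U_n\}$, where $U_n(i)=1/n$ for all $i\in[n]$) whose conditional sample complexity is $\mathrm{poly}(\epsilon^{ -1},\log(\delta^{ -1}))$, independently of $n$. That is, there is a polynomial $p$ such that for all $\epsilon,\delta\in(0,1)$ and all $n$ the tester makes at most $p(\epsilon^{ -1},\log(\delta^{ -1}))$ conditional samples.
   Context: $[n]=\{1,\ldots,n\}$. A conditional sampling oracle for a distribution $\mu$ over $[n]$ takes a nonempty set $A\subseteq[n]$ and returns $j\in A$ with probability $\mu(j)/\mu(A)$ if $\mu(A)>0$, and a uniformly random member of $A$ if $\mu(A)=0$, independently of all previous samples. The variation distance is $d(\mu,\mu')=\frac12\sum_{i=1}^n|\mu(i)-\mu'(i)|$. A property $\mathcal P$ is a set of distributions over $[n]$; $\mu$ is $\epsilon$-far from $\mathcal P$ if $d(\mu,\mu')\ge\epsilon$ for every $\mu'\in\mathcal P$. An adaptive distribution tester for $\mathcal P$ with conditional sample complexity $t(\epsilon,\delta,n)$ is a randomized algorithm that receives $\epsilon,\delta>0$, $n\in\mathbb N$ and a conditional sampling oracle for an unknown distribution $\mu$ over $[n]$. In phase $i=1,\ldots,t(\epsilon,\delta,n)$ it generates a set $A_i\subseteq[n]$ based on the previously received samples $j_1,\ldots,j_{i-1}$ and its internal coin tosses, and receives a sample $j_i$ from the oracle on $A_i$. At the end it accepts or rejects based on $j_1,\ldots,j_t$ and its coin tosses. If $\mu\in\mathcal P$ it must accept with probability at least $1-\delta$; if $\mu$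 is $\epsilon$-far from $\mathcal P$ it must reject with probability at least $1-\delta$. $f=\mathrm{poly}(g_1,\ldots,g_k)$ means that there is a polynomial $p$ with $f\le p(g_1,\ldots,g_k)$ for all values of the arguments in their domains. -}

module Defs where

open import Level using (0ℓ)
open import Algebra.Bundles using (RawRing)
import Algebra.Definitions.RawSemiring as RawSemiringDefinitions
open import Data.Bool.Base using (Bool; true; false; if_then_else_)
import Data.Bool.Properties as Bool
open import Data.Fin.Base using (Fin)
open import Data.Fin.Subset using (Subset; _∈_; _∉_; Nonempty) renaming (∣_∣ to card)
open import Data.Fin.Subset.Properties using (_∈?_; x∈p⇒∣p-x∣<∣p∣)
import Data.Integer.Base as ℤ
import Data.Integer.Properties as ℤ
open import Data.List.Base using (List; foldr)
open import Data.Nat.Base as ℕ using (ℕ; zero; suc; z≤n; s≤s)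
import Data.Nat.Properties as ℕ
open import Data.Product.Base using (∃; _×_; _,_)
open import Data.Rational.Base as ℚ using (ℚ; 0ℚ; 1ℚ; ½)
import Data.Rational.Properties as ℚ
import Data.Rational.Solver as ℚSolver
import Data.Rational.Unnormalised.Base as ℚᵘ
import Data.Rational.Unnormalised.Properties as ℚᵘ
open import Data.Sum.Base using (inj₁; inj₂)
open import Data.Vec.Base as Vec using (Vec; []; _∷_)
open import Relation.Binary.PropositionalEquality
open import Relation.Nullary.Decidable.Core using (does)

open ℚSolver.+-*-Solver using (solve; con; _:=_; _:+_; _:*_; _:-_; :-_)
open RawSemiringDefinitions ℚ.+-*-rawSemiring using () renaming (_^_ to _^ℚ_)

abstract
  0<1 : 0ℚ ℚ.< 1ℚ
  0<1 = ℚ.positive⁻¹ 1ℚ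

eq≤ : ∀ {p q} → p ≡ q → p ℚ.≤ q
eq≤ = ℚ.≤-reflexive

*-mono : ∀ {a b c d} → 0ℚ ℚ.≤ b → 0ℚ ℚ.≤ c → a ℚ.≤ b → c ℚ.≤ d →
         a ℚ.* c ℚ.≤ b ℚ.* d
*-mono {a} {b} {c} {d} 0≤b 0≤c a≤b c≤d = ℚ.≤-trans
  (ℚ.*-monoʳ-≤-nonNeg c {{ℚ.nonNegative 0≤c}} a≤b)
  (ℚ.*-monoˡ-≤-nonNeg b {{ℚ.nonNegative 0≤b}} c≤d)

*-nonNeg : ∀ {a b} → 0ℚ ℚ.≤ a → 0ℚ ℚ.≤ b → 0ℚ ℚ.≤ a ℚ.* b
*-nonNeg {a} 0≤a 0≤b = ℚ.≤-trans (eq≤ (sym (ℚ.*-zeroʳ a)))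
  (ℚ.*-monoˡ-≤-nonNeg a {{ℚ.nonNegative 0≤a}} 0≤b)

*-pos : ∀ {a b} → 0ℚ ℚ.< a → 0ℚ ℚ.< b → 0ℚ ℚ.< a ℚ.* b
*-pos {a} {b} 0<a 0<b = ℚ.positive⁻¹ _
  {{ℚ.pos*pos⇒pos a {{ℚ.positive 0<a}} b {{ℚ.positive 0<b}}}}

inv : (p : ℚ) → 0ℚ ℚ.< p → ℚ
inv p 0<p = (ℚ.1/ p) {{ℚ.>-nonZero 0<p}}

inv-pos : ∀ {p} (0<p : 0ℚ ℚ.< p) → 0ℚ ℚ.< inv p 0<p
inv-pos {p} 0<p = ℚ.positive⁻¹ _ {{ℚ.1/pos⇒pos p {{ℚ.positive 0<p}}}}

inv-*ˡ : ∀ {p} (0<p : 0ℚ ℚ.< p) → inv p 0<p ℚ.* p ≡ 1ℚ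
inv-*ˡ {p} 0<p = ℚ.*-inverseˡ p {{ℚ.>-nonZero 0<p}}

inv-anti : ∀ {p q} (0<p : 0ℚ ℚ.< p) (0<q : 0ℚ ℚ.< q) → p ℚ.≤ q →
           inv q 0<q ℚ.≤ inv p 0<p
inv-anti {p} {q} 0<p 0<q p≤q = begin
  q′                   ≡⟨ ℚ.*-identityʳ q′ ⟨
  q′ ℚ.* 1ℚ            ≡⟨ cong (q′ ℚ.*_) (inv-*ˡ 0<p) ⟨
  q′ ℚ.* (p′ ℚ.* p)    ≤⟨ *-mono (ℚ.<⇒≤ (inv-pos 0<q))
                            (*-nonNeg (ℚ.<⇒≤ (inv-pos 0<p)) (ℚ.<⇒≤ 0<p)) ℚ.≤-refl
                            (*-mono (ℚ.<⇒≤ (inv-pos 0<p)) (ℚ.<⇒≤ 0<p) ℚ.≤-refl p≤q) ⟩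
  q′ ℚ.* (p′ ℚ.* q)    ≡⟨ solve 3 (λ x y z → x :* (y :* z) := y :* (x :* z)) refl q′ p′ q ⟩
  p′ ℚ.* (q′ ℚ.* q)    ≡⟨ cong (p′ ℚ.*_) (inv-*ˡ 0<q) ⟩
  p′ ℚ.* 1ℚ            ≡⟨ ℚ.*-identityʳ p′ ⟩
  p′                   ∎
  where
  open ℚ.≤-Reasoning
  p′ = inv p 0<p
  q′ = inv q 0<q

p≤∣p∣ : ∀ p → p ℚ.≤ ℚ.∣ p ∣
p≤∣p∣ p with ℚ.≤-total 0ℚ p
... | inj₁ 0≤p = eq≤ (sym (ℚ.0≤p⇒∣p∣≡p 0≤p))
... | inj₂ p≤0 = ℚ.≤-trans p≤0 (ℚ.0≤∣p∣ p)

-p≤∣p∣ : ∀ p → ℚ.- p ℚ.≤ ℚ.∣ p ∣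
-p≤∣p∣ p = ℚ.≤-trans (p≤∣p∣ (ℚ.- p)) (eq≤ (ℚ.∣-p∣≡∣p∣ p))

∣∣-lub : ∀ {p q} → p ℚ.≤ q → ℚ.- p ℚ.≤ q → ℚ.∣ p ∣ ℚ.≤ q
∣∣-lub {p} p≤q -p≤q with ℚ.∣p∣≡p∨∣p∣≡-p p
... | inj₁ eq = ℚ.≤-trans (eq≤ eq) p≤q
... | inj₂ eq = ℚ.≤-trans (eq≤ eq) -p≤q

∣-∣-sym : ∀ p q → ℚ.∣ p ℚ.- q ∣ ≡ ℚ.∣ q ℚ.- p ∣
∣-∣-sym p q = trans
  (cong ℚ.∣_∣ (solve 2 (λ x y → x :- y := :- (y :- x)) refl p q))
  (ℚ.∣-p∣≡∣p∣ (q ℚ.- p))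

∣∣-via : ∀ p q → ℚ.∣ p ∣ ℚ.≤ ℚ.∣ q ∣ ℚ.+ ℚ.∣ p ℚ.- q ∣
∣∣-via p q = ℚ.≤-trans
  (eq≤ (cong ℚ.∣_∣ (solve 2 (λ x y → x := y :+ (x :- y)) refl p q)))
  (ℚ.∣p+q∣≤∣p∣+∣q∣ q (p ℚ.- q))

reverse-triangle : ∀ p q → ℚ.∣ ℚ.∣ p ∣ ℚ.- ℚ.∣ q ∣ ∣ ℚ.≤ ℚ.∣ p ℚ.- q ∣
reverse-triangle p q = ∣∣-lub (half p q)
  (ℚ.≤-trans (eq≤ (solve 2 (λ x y → :- (x :- y) := y :- x) refl ℚ.∣ p ∣ ℚ.∣ q ∣))
    (ℚ.≤-trans (half q p) (eq≤ (∣-∣-sym q p))))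
  where
  half : ∀ a b → ℚ.∣ a ∣ ℚ.- ℚ.∣ b ∣ ℚ.≤ ℚ.∣ a ℚ.- b ∣
  half a b = ℚ.≤-trans (ℚ.+-monoˡ-≤ (ℚ.- ℚ.∣ b ∣) (∣∣-via a b))
    (eq≤ (solve 2 (λ x y → (x :+ y) :- x := y) refl ℚ.∣ b ∣ ℚ.∣ a ℚ.- b ∣))

product-estimate : ∀ a b c d {A B e} → 0ℚ ℚ.< A → 0ℚ ℚ.< B →
  ℚ.∣ a ∣ ℚ.≤ A → ℚ.∣ d ∣ ℚ.≤ B → ℚ.∣ a ℚ.- c ∣ ℚ.≤ e → ℚ.∣ b ℚ.- d ∣ ℚ.≤ e →
  ℚ.∣ a ℚ.* b ℚ.- c ℚ.* d ∣ ℚ.≤ (A ℚ.+ B) ℚ.* e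
product-estimate a b c d {A} {B} {e} 0<A 0<B ∣a∣≤A ∣d∣≤B ac bd = begin
  ℚ.∣ a ℚ.* b ℚ.- c ℚ.* d ∣
    ≡⟨ cong ℚ.∣_∣ (product-difference a b c d) ⟩
  ℚ.∣ a ℚ.* (b ℚ.- d) ℚ.+ d ℚ.* (a ℚ.- c) ∣
    ≤⟨ ℚ.∣p+q∣≤∣p∣+∣q∣ (a ℚ.* (b ℚ.- d)) (d ℚ.* (a ℚ.- c)) ⟩
  ℚ.∣ a ℚ.* (b ℚ.- d) ∣ ℚ.+ ℚ.∣ d ℚ.* (a ℚ.- c) ∣
    ≡⟨ cong₂ ℚ._+_ (ℚ.∣p*q∣≡∣p∣*∣q∣ a (b ℚ.- d)) (ℚ.∣p*q∣≡∣p∣*∣q∣ d (a ℚ.- c)) ⟩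
  ℚ.∣ a ∣ ℚ.* ℚ.∣ b ℚ.- d ∣ ℚ.+ ℚ.∣ d ∣ ℚ.* ℚ.∣ a ℚ.- c ∣
    ≤⟨ ℚ.+-mono-≤ (*-mono (ℚ.<⇒≤ 0<A) (ℚ.0≤∣p∣ (b ℚ.- d)) ∣a∣≤A bd)
                  (*-mono (ℚ.<⇒≤ 0<B) (ℚ.0≤∣p∣ (a ℚ.- c)) ∣d∣≤B ac) ⟩
  A ℚ.* e ℚ.+ B ℚ.* e
    ≡⟨ ℚ.*-distribʳ-+ e A B ⟨
  (A ℚ.+ B) ℚ.* e ∎
  where
  open ℚ.≤-Reasoning
  product-difference : ∀ a b c d →
    a ℚ.* b ℚ.- c ℚ.* d ≡ a ℚ.* (b ℚ.- d) ℚ.+ d ℚ.* (a ℚ.- c)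
  product-difference = solve 4
    (λ a b c d → a :* b :- c :* d := a :* (b :- d) :+ d :* (a :- c)) refl

-- The real numbers: Cauchy sequences of rationals carrying a modulus of
-- convergence, compared by the setoid equality _≃_

Cauchy : (ℕ → ℚ) → Set
Cauchy s = ∀ e → 0ℚ ℚ.< e → ∃ λ N → ∀ m n → N ℕ.≤ m → N ℕ.≤ n → ℚ.∣ s m ℚ.- s n ∣ ℚ.≤ e

record ℝ : Set where
  constructor mkℝ
  field
    seq    : ℕ → ℚ
    cauchy : Cauchy seq

open ℝ public

infix 4 _≃_ _≤_ _<_

_≃_ : ℝ → ℝ → Set
x ≃ y = ∀ e → 0ℚ ℚ.< e → ∃ λ N → ∀ n → N ℕ.≤ n → ℚ.∣ seq x n ℚ.- seq y n ∣ ℚ.≤ e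

_≤_ : ℝ → ℝ → Set
x ≤ y = ∀ e → 0ℚ ℚ.< e → ∃ λ N → ∀ n → N ℕ.≤ n → seq x n ℚ.≤ seq y n ℚ.+ e

_<_ : ℝ → ℝ → Set
x < y = ∃ λ e → 0ℚ ℚ.< e × ∃ λ N → ∀ n → N ℕ.≤ n → seq x n ℚ.+ e ℚ.≤ seq y n

abstract
  const-cauchy : ∀ q → Cauchy (λ _ → q)
  const-cauchy q e 0<e = 0 , λ _ _ _ _ →
    ℚ.≤-trans (eq≤ (cong ℚ.∣_∣ (ℚ.+-inverseʳ q))) (ℚ.<⇒≤ 0<e)

fromℚ : ℚ → ℝ
fromℚ q = mkℝ (λ _ → q) (const-cauchy q)

fromℕ : ℕ → ℝ
fromℕ n = fromℚ (ℤ.+ n ℚ./ 1)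

0ℝ 1ℝ : ℝ
0ℝ = fromℚ 0ℚ
1ℝ = fromℚ 1ℚ

-- It is enough to bound the oscillation by a fixed multiple of e.
cauchy-scaled : ∀ s C → 0ℚ ℚ.< C →
  (∀ e → 0ℚ ℚ.< e → ∃ λ N → ∀ m n → N ℕ.≤ m → N ℕ.≤ n → ℚ.∣ s m ℚ.- s n ∣ ℚ.≤ C ℚ.* e) →
  Cauchy s
cauchy-scaled s C 0<C h e 0<e with h (inv C 0<C ℚ.* e) (*-pos (inv-pos 0<C) 0<e)
... | N , p = N , λ m n N≤m N≤n → ℚ.≤-trans (p m n N≤m N≤n) (eq≤ (begin
  C ℚ.* (inv C 0<C ℚ.* e)  ≡⟨ solve 3 (λ x y z → x :* (y :* z) := (y :* x) :* z) refl C (inv C 0<C) e ⟩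
  (inv C 0<C ℚ.* C) ℚ.* e  ≡⟨ cong (ℚ._* e) (inv-*ˡ 0<C) ⟩
  1ℚ ℚ.* e                 ≡⟨ ℚ.*-identityˡ e ⟩
  e                        ∎))
  where open ≡-Reasoning

Bounded : (ℕ → ℚ) → Set
Bounded s = ∃ λ B → 0ℚ ℚ.< B × ∃ λ N → ∀ n → N ℕ.≤ n → ℚ.∣ s n ∣ ℚ.≤ B

bounded : ∀ x → Bounded (seq x)
bounded x with cauchy x 1ℚ (ℚ.positive⁻¹ 1ℚ)
... | N , p = ℚ.∣ seq x N ∣ ℚ.+ 1ℚ
            , ℚ.+-mono-≤-< (ℚ.0≤∣p∣ (seq x N)) (ℚ.positive⁻¹ 1ℚ)
            , N , λ n N≤n → ℚ.≤-trans (∣∣-via (seq x n) (seq x N))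
                (ℚ.+-monoʳ-≤ ℚ.∣ seq x N ∣ (p n N N≤n ℕ.≤-refl))

⊔ˡ : ∀ {a b c} → a ℕ.⊔ b ℕ.≤ c → a ℕ.≤ c
⊔ˡ {a} {b} = ℕ.m⊔n≤o⇒m≤o a b

⊔ʳ : ∀ {a b c} → a ℕ.⊔ b ℕ.≤ c → b ℕ.≤ c
⊔ʳ {a} {b} = ℕ.m⊔n≤o⇒n≤o a b

abstract
  +-cauchy : ∀ x y → Cauchy (λ n → seq x n ℚ.+ seq y n)
  +-cauchy x y =
    cauchy-scaled (λ n → seq x n ℚ.+ seq y n) (1ℚ ℚ.+ 1ℚ) (ℚ.positive⁻¹ (1ℚ ℚ.+ 1ℚ)) λ e 0<e →
      let M , p = cauchy x e 0<e
          N , q = cauchy y e 0<e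
      in M ℕ.⊔ N , λ m n ≤m ≤n → begin
        ℚ.∣ (seq x m ℚ.+ seq y m) ℚ.- (seq x n ℚ.+ seq y n) ∣
          ≡⟨ cong ℚ.∣_∣ (solve 4 (λ a b c d → (a :+ b) :- (c :+ d) := (a :- c) :+ (b :- d)) refl
               (seq x m) (seq y m) (seq x n) (seq y n)) ⟩
        ℚ.∣ (seq x m ℚ.- seq x n) ℚ.+ (seq y m ℚ.- seq y n) ∣
          ≤⟨ ℚ.∣p+q∣≤∣p∣+∣q∣ (seq x m ℚ.- seq x n) (seq y m ℚ.- seq y n) ⟩
        ℚ.∣ seq x m ℚ.- seq x n ∣ ℚ.+ ℚ.∣ seq y m ℚ.- seq y n ∣
          ≤⟨ ℚ.+-mono-≤ (p m n (⊔ˡ ≤m) (⊔ˡ ≤n)) (q m n (⊔ʳ {M} ≤m) (⊔ʳ {M} ≤n)) ⟩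
        e ℚ.+ e
          ≡⟨ solve 1 (λ z → z :+ z := (con 1ℚ :+ con 1ℚ) :* z) refl e ⟩
        (1ℚ ℚ.+ 1ℚ) ℚ.* e ∎
    where open ℚ.≤-Reasoning

  *-cauchy : ∀ x y → Cauchy (λ n → seq x n ℚ.* seq y n)
  *-cauchy x y = product-cauchy (bounded x) (bounded y)
    where
    product-cauchy : Bounded (seq x) → Bounded (seq y) → Cauchy (λ n → seq x n ℚ.* seq y n)
    product-cauchy (A , 0<A , Nx , bx) (B , 0<B , Ny , by) =
      cauchy-scaled (λ n → seq x n ℚ.* seq y n) (A ℚ.+ B) (ℚ.+-mono-< 0<A 0<B) λ e 0<e →
        let M , p = cauchy x e 0<e
            N , q = cauchy y e 0<e
        in (Nx ℕ.⊔ Ny) ℕ.⊔ (M ℕ.⊔ N) , λ m n ≤m ≤n →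
          product-estimate (seq x m) (seq y m) (seq x n) (seq y n) 0<A 0<B
            (bx m (⊔ˡ (⊔ˡ ≤m)))
            (by n (⊔ʳ {Nx} (⊔ˡ ≤n)))
            (p m n (⊔ˡ (⊔ʳ {Nx ℕ.⊔ Ny} ≤m)) (⊔ˡ (⊔ʳ {Nx ℕ.⊔ Ny} ≤n)))
            (q m n (⊔ʳ {M} (⊔ʳ {Nx ℕ.⊔ Ny} ≤m)) (⊔ʳ {M} (⊔ʳ {Nx ℕ.⊔ Ny} ≤n)))

  neg-cauchy : ∀ x → Cauchy (λ n → ℚ.- seq x n)
  neg-cauchy x e 0<e =
    let N , p = cauchy x e 0<e
    in N , λ m n N≤m N≤n → ℚ.≤-trans
         (eq≤ (cong ℚ.∣_∣ (solve 2 (λ a b → :- a :- (:- b) := b :- a) refl (seq x m) (seq x n))))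
         (p n m N≤n N≤m)

  abs-cauchy : ∀ x → Cauchy (λ n → ℚ.∣ seq x n ∣)
  abs-cauchy x e 0<e =
    let N , p = cauchy x e 0<e
    in N , λ m n N≤m N≤n → ℚ.≤-trans (reverse-triangle (seq x m) (seq x n)) (p m n N≤m N≤n)

infix  8 -_
infixl 7 _*_
infixl 6 _+_ _-_

_+_ : ℝ → ℝ → ℝ
x + y = mkℝ (λ n → seq x n ℚ.+ seq y n) (+-cauchy x y)

_*_ : ℝ → ℝ → ℝ
x * y = mkℝ (λ n → seq x n ℚ.* seq y n) (*-cauchy x y)

-_ : ℝ → ℝ
- x = mkℝ (λ n → ℚ.- seq x n) (neg-cauchy x)

_-_ : ℝ → ℝ → ℝ
x - y = x + - y

∣_∣ : ℝ → ℝ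
∣ x ∣ = mkℝ (λ n → ℚ.∣ seq x n ∣) (abs-cauchy x)

rawRing : RawRing 0ℓ 0ℓ
rawRing = record
  { Carrier = ℝ ; _≈_ = _≃_ ; _+_ = _+_ ; _*_ = _*_ ; -_ = -_ ; 0# = 0ℝ ; 1# = 1ℝ }

open RawSemiringDefinitions (RawRing.rawSemiring rawRing) public using (sum; _^_)

record ℝ⁺ : Set where
  constructor mkℝ⁺
  field
    value    : ℝ
    positive : 0ℝ < value

open ℝ⁺ public

inv-lipschitz : ∀ p q p′ q′ c → p′ ℚ.* p ≡ 1ℚ → q′ ℚ.* q ≡ 1ℚ →
  0ℚ ℚ.≤ p′ → 0ℚ ℚ.≤ q′ → p′ ℚ.≤ c → q′ ℚ.≤ c →
  ℚ.∣ p′ ℚ.- q′ ∣ ℚ.≤ (c ℚ.* c) ℚ.* ℚ.∣ p ℚ.- q ∣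
inv-lipschitz p q p′ q′ c p′p≡1 q′q≡1 0≤p′ 0≤q′ p′≤c q′≤c = begin
  ℚ.∣ p′ ℚ.- q′ ∣
    ≡⟨ cong ℚ.∣_∣ eq ⟩
  ℚ.∣ (p′ ℚ.* q′) ℚ.* (q ℚ.- p) ∣
    ≡⟨ ℚ.∣p*q∣≡∣p∣*∣q∣ (p′ ℚ.* q′) (q ℚ.- p) ⟩
  ℚ.∣ p′ ℚ.* q′ ∣ ℚ.* ℚ.∣ q ℚ.- p ∣
    ≡⟨ cong₂ ℚ._*_ (ℚ.0≤p⇒∣p∣≡p (*-nonNeg 0≤p′ 0≤q′)) (∣-∣-sym q p) ⟩
  (p′ ℚ.* q′) ℚ.* ℚ.∣ p ℚ.- q ∣
    ≤⟨ *-mono (*-nonNeg 0≤c 0≤c) (ℚ.0≤∣p∣ (p ℚ.- q))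
         (*-mono 0≤c 0≤q′ p′≤c q′≤c) ℚ.≤-refl ⟩
  (c ℚ.* c) ℚ.* ℚ.∣ p ℚ.- q ∣ ∎
  where
  open ℚ.≤-Reasoning
  0≤c = ℚ.≤-trans 0≤p′ p′≤c
  factor : ∀ a b c d →
    a ℚ.* (b ℚ.* d) ℚ.- b ℚ.* (a ℚ.* c) ≡ (a ℚ.* b) ℚ.* (d ℚ.- c)
  factor = solve 4
    (λ a b c d → a :* (b :* d) :- b :* (a :* c) := (a :* b) :* (d :- c)) refl
  eq : p′ ℚ.- q′ ≡ (p′ ℚ.* q′) ℚ.* (q ℚ.- p)
  eq = begin-equality
    p′ ℚ.- q′
      ≡⟨ cong₂ ℚ._-_ (ℚ.*-identityʳ p′) (ℚ.*-identityʳ q′) ⟨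
    p′ ℚ.* 1ℚ ℚ.- q′ ℚ.* 1ℚ
      ≡⟨ cong₂ (λ a b → p′ ℚ.* a ℚ.- q′ ℚ.* b) q′q≡1 p′p≡1 ⟨
    p′ ℚ.* (q′ ℚ.* q) ℚ.- q′ ℚ.* (p′ ℚ.* p)
      ≡⟨ factor p′ q′ p q ⟩
    (p′ ℚ.* q′) ℚ.* (q ℚ.- p) ∎

clamp>0 : ∀ {e} p → 0ℚ ℚ.< e → 0ℚ ℚ.< p ℚ.⊔ e
clamp>0 {e} p 0<e = ℚ.<-≤-trans 0<e (ℚ.p≤q⊔p p e)

inv-clamp : ∀ {e} → 0ℚ ℚ.< e → ℚ → ℚ
inv-clamp {e} 0<e p = inv (p ℚ.⊔ e) (clamp>0 p 0<e)

inv-clamp-* : ∀ {e} (0<e : 0ℚ ℚ.< e) p → e ℚ.≤ p → inv-clamp 0<e p ℚ.* p ≡ 1ℚ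
inv-clamp-* 0<e p e≤p = subst (λ z → inv-clamp 0<e p ℚ.* z ≡ 1ℚ) (ℚ.p≥q⇒p⊔q≡p e≤p)
  (inv-*ˡ (clamp>0 p 0<e))

inv-clamp-lipschitz : ∀ {e} (0<e : 0ℚ ℚ.< e) p q → e ℚ.≤ p → e ℚ.≤ q →
  ℚ.∣ inv-clamp 0<e p ℚ.- inv-clamp 0<e q ∣ ℚ.≤ (inv e 0<e ℚ.* inv e 0<e) ℚ.* ℚ.∣ p ℚ.- q ∣
inv-clamp-lipschitz {e} 0<e p q e≤p e≤q = inv-lipschitz p q (inv-clamp 0<e p) (inv-clamp 0<e q)
  (inv e 0<e) (inv-clamp-* 0<e p e≤p) (inv-clamp-* 0<e q e≤q)
  (ℚ.<⇒≤ (inv-pos (clamp>0 p 0<e))) (ℚ.<⇒≤ (inv-pos (clamp>0 q 0<e)))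
  (inv-anti 0<e (clamp>0 p 0<e) (ℚ.p≤q⊔p p e)) (inv-anti 0<e (clamp>0 q 0<e) (ℚ.p≤q⊔p q e))

inv-clamp-lower : ∀ {e B} (0<e : 0ℚ ℚ.< e) (0<B : 0ℚ ℚ.< B) p → e ℚ.≤ p → p ℚ.≤ B →
  inv B 0<B ℚ.≤ inv-clamp 0<e p
inv-clamp-lower 0<e 0<B p e≤p p≤B =
  inv-anti (clamp>0 p 0<e) 0<B (ℚ.≤-trans (eq≤ (ℚ.p≥q⇒p⊔q≡p e≤p)) p≤B)

abstract
  inv-clamp-cauchy : ∀ {x e} → Cauchy x → (0<e : 0ℚ ℚ.< e) →
    (∃ λ N → ∀ n → N ℕ.≤ n → 0ℚ ℚ.+ e ℚ.≤ x n) → Cauchy (λ n → inv-clamp 0<e (x n))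
  inv-clamp-cauchy {x} {e} c 0<e (N , e≤x) =
    cauchy-scaled (λ n → inv-clamp 0<e (x n)) C (*-pos (inv-pos 0<e) (inv-pos 0<e)) λ d 0<d →
      let M , p = c d 0<d
      in N ℕ.⊔ M , λ m n ≤m ≤n → ℚ.≤-trans
           (inv-clamp-lipschitz 0<e (x m) (x n) (below m (⊔ˡ ≤m)) (below n (⊔ˡ ≤n)))
           (*-mono 0≤C (ℚ.0≤∣p∣ (x m ℚ.- x n)) ℚ.≤-refl (p m n (⊔ʳ {N} ≤m) (⊔ʳ {N} ≤n)))
    where
    C : ℚ
    C = inv e 0<e ℚ.* inv e 0<e
    0≤C : 0ℚ ℚ.≤ C
    0≤C = ℚ.<⇒≤ (*-pos (inv-pos 0<e) (inv-pos 0<e))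
    below : ∀ n → N ℕ.≤ n → e ℚ.≤ x n
    below n N≤n = ℚ.≤-trans (eq≤ (sym (ℚ.+-identityˡ e))) (e≤x n N≤n)

  inv-clamp-positive : ∀ x {e} (0<e : 0ℚ ℚ.< e) →
    (∃ λ N → ∀ n → N ℕ.≤ n → 0ℚ ℚ.+ e ℚ.≤ seq x n) →
    (c : Cauchy (λ n → inv-clamp 0<e (seq x n))) → 0ℝ < mkℝ (λ n → inv-clamp 0<e (seq x n)) c
  inv-clamp-positive x {e} 0<e (N , e≤x) _ = from-bound (bounded x)
    where
    from-bound : Bounded (seq x) → ∃ λ d → 0ℚ ℚ.< d × ∃ λ N →
      ∀ n → N ℕ.≤ n → 0ℚ ℚ.+ d ℚ.≤ inv-clamp 0<e (seq x n)
    from-bound (B , 0<B , M , b) = inv B 0<B , inv-pos 0<B , N ℕ.⊔ M , λ n ≤n →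
      ℚ.≤-trans (eq≤ (ℚ.+-identityˡ (inv B 0<B)))
        (inv-clamp-lower 0<e 0<B (seq x n)
          (ℚ.≤-trans (eq≤ (sym (ℚ.+-identityˡ e))) (e≤x n (⊔ˡ ≤n)))
          (ℚ.≤-trans (p≤∣p∣ (seq x n)) (b n (⊔ʳ {N} ≤n))))

infix 9 _⁻¹

-- Clamping by the positive lower bound e of x changes only finitely many terms.
_⁻¹ : ℝ⁺ → ℝ⁺
mkℝ⁺ x (e , 0<e , e≤x) ⁻¹ = mkℝ⁺
  (mkℝ (λ n → inv-clamp 0<e (seq x n)) (inv-clamp-cauchy (cauchy x) 0<e e≤x))
  (inv-clamp-positive x 0<e e≤x (inv-clamp-cauchy (cauchy x) 0<e e≤x))

nat : ℕ → ℚ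
nat n = ℤ.+ n ℚ./ 1

unit : ℕ → ℚ
unit n = ℤ.+ 1 ℚ./ suc n

-- The partial sum ∑_{k<m} z^(2k+1)/(2k+1) of the power series of artanh z.
artanhSum : ℕ → ℚ → ℚ
artanhSum zero    z = 0ℚ
artanhSum (suc m) z = artanhSum m z ℚ.+ z ^ℚ suc (2 ℕ.* m) ℚ.* unit (2 ℕ.* m)

geometricSum : ℕ → ℚ → ℚ
geometricSum zero    ρ = 0ℚ
geometricSum (suc m) ρ = geometricSum m ρ ℚ.+ ρ ^ℚ m

nat-suc : ∀ n → nat (suc n) ≡ 1ℚ ℚ.+ nat n
nat-suc n = ℚ.toℚᵘ-injective (begin
  ℚ.toℚᵘ (nat (suc n))                 ≈⟨ ℚ.toℚᵘ-fromℚᵘ (ℚᵘ.mkℚᵘ (ℤ.+ suc n) 0) ⟩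
  ℚᵘ.mkℚᵘ (ℤ.+ suc n) 0                ≈⟨ ℚᵘ.*≡* (cong (λ z → (ℤ.+ 1 ℤ.+ z) ℤ.* ℤ.+ 1) (sym (ℤ.*-identityʳ (ℤ.+ n)))) ⟩
  ℚᵘ.1ℚᵘ ℚᵘ.+ ℚᵘ.mkℚᵘ (ℤ.+ n) 0        ≈⟨ ℚᵘ.+-congʳ ℚᵘ.1ℚᵘ (ℚ.toℚᵘ-fromℚᵘ (ℚᵘ.mkℚᵘ (ℤ.+ n) 0)) ⟨
  ℚ.toℚᵘ 1ℚ ℚᵘ.+ ℚ.toℚᵘ (nat n)        ≈⟨ ℚ.toℚᵘ-homo-+ 1ℚ (nat n) ⟨
  ℚ.toℚᵘ (1ℚ ℚ.+ nat n)                ∎)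
  where open ℚᵘ.≃-Reasoning

unit*nat-suc : ∀ n → unit n ℚ.* nat (suc n) ≡ 1ℚ
unit*nat-suc n = ℚ.toℚᵘ-injective (begin
  ℚ.toℚᵘ (unit n ℚ.* nat (suc n))              ≈⟨ ℚ.toℚᵘ-homo-* (unit n) (nat (suc n)) ⟩
  ℚ.toℚᵘ (unit n) ℚᵘ.* ℚ.toℚᵘ (nat (suc n))    ≈⟨ ℚᵘ.*-cong (ℚ.toℚᵘ-fromℚᵘ (ℚᵘ.mkℚᵘ (ℤ.+ 1) n))
                                                            (ℚ.toℚᵘ-fromℚᵘ (ℚᵘ.mkℚᵘ (ℤ.+ suc n) 0)) ⟩
  ℚᵘ.mkℚᵘ (ℤ.+ 1) n ℚᵘ.* ℚᵘ.mkℚᵘ (ℤ.+ suc n) 0 ≈⟨ ℚᵘ.*-inverseˡ (ℚᵘ.mkℚᵘ (ℤ.+ suc n) 0) ⟩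
  ℚᵘ.1ℚᵘ                                       ∎)
  where open ℚᵘ.≃-Reasoning

nat-suc>0 : ∀ n → 0ℚ ℚ.< nat (suc n)
nat-suc>0 n = ℚ.positive⁻¹ _ {{ℚ.normalize-pos (suc n) 1}}

unit>0 : ∀ n → 0ℚ ℚ.< unit n
unit>0 n = ℚ.positive⁻¹ _ {{ℚ.normalize-pos 1 (suc n)}}

nat-mono : ∀ {m n} → m ℕ.≤ n → nat m ℚ.≤ nat n
nat-mono {n = n} z≤n = ℚ.nonNegative⁻¹ _ {{ℚ.normalize-nonNeg n 1}}
nat-mono (s≤s {m} {n} m≤n) = subst₂ ℚ._≤_ (sym (nat-suc m)) (sym (nat-suc n))
  (ℚ.+-monoʳ-≤ 1ℚ (nat-mono m≤n))

unit≡inv : ∀ n → unit n ≡ inv (nat (suc n)) (nat-suc>0 n)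
unit≡inv n = begin
  u                  ≡⟨ ℚ.*-identityʳ u ⟨
  u ℚ.* 1ℚ           ≡⟨ cong (u ℚ.*_) (inv-*ˡ (nat-suc>0 n)) ⟨
  u ℚ.* (i ℚ.* k)    ≡⟨ rearrange u i k ⟩
  i ℚ.* (u ℚ.* k)    ≡⟨ cong (i ℚ.*_) (unit*nat-suc n) ⟩
  i ℚ.* 1ℚ           ≡⟨ ℚ.*-identityʳ i ⟩
  i                  ∎
  where
  open ≡-Reasoning
  u = unit n
  k = nat (suc n)
  i = inv k (nat-suc>0 n)
  rearrange : ∀ a b c → a ℚ.* (b ℚ.* c) ≡ b ℚ.* (a ℚ.* c)
  rearrange = solve 3 (λ a b c → a :* (b :* c) := b :* (a :* c)) refl

unit-anti : ∀ {m n} → m ℕ.≤ n → unit n ℚ.≤ unit m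
unit-anti {m} {n} m≤n = subst₂ ℚ._≤_ (sym (unit≡inv n)) (sym (unit≡inv m))
  (inv-anti (nat-suc>0 m) (nat-suc>0 n) (nat-mono (s≤s m≤n)))

unit≤ : ∀ e → 0ℚ ℚ.< e → ∃ λ N → unit N ℚ.≤ e
unit≤ e@(ℚ.mkℚ ℤ.+[1+ a ] d _) _ = d , ℚ.toℚᵘ-cancel-≤ (begin
  ℚ.toℚᵘ (unit d)          ≃⟨ ℚ.toℚᵘ-fromℚᵘ (ℚᵘ.mkℚᵘ (ℤ.+ 1) d) ⟩
  ℚᵘ.mkℚᵘ (ℤ.+ 1) d        ≤⟨ ℚᵘ.*≤* (ℤ.*-monoʳ-≤-nonNeg (ℤ.+ suc d) {ℤ.+ 1} {ℤ.+[1+ a ]} (ℤ.+≤+ (s≤s z≤n))) ⟩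
  ℚᵘ.mkℚᵘ ℤ.+[1+ a ] d     ∎)
  where open ℚᵘ.≤-Reasoning
unit≤ (ℚ.mkℚ (ℤ.+ 0) d _) (ℚ.*<* 0<0) with () ← ℤ.<-irrefl refl 0<0
unit≤ (ℚ.mkℚ ℤ.-[1+ a ] d _) (ℚ.*<* ())

^-nonNeg : ∀ {ρ} → 0ℚ ℚ.≤ ρ → ∀ n → 0ℚ ℚ.≤ ρ ^ℚ n
^-nonNeg 0≤ρ zero    = ℚ.<⇒≤ (ℚ.positive⁻¹ 1ℚ)
^-nonNeg 0≤ρ (suc n) = *-nonNeg 0≤ρ (^-nonNeg 0≤ρ n)

^-anti : ∀ {ρ} → 0ℚ ℚ.≤ ρ → ρ ℚ.≤ 1ℚ → ∀ {m n} → m ℕ.≤ n → ρ ^ℚ n ℚ.≤ ρ ^ℚ m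
^-anti 0≤ρ ρ≤1 {n = zero}  z≤n = ℚ.≤-refl
^-anti {ρ} 0≤ρ ρ≤1 {n = suc n} z≤n = ℚ.≤-trans
  (*-mono (ℚ.<⇒≤ (ℚ.positive⁻¹ 1ℚ)) (^-nonNeg 0≤ρ n) ρ≤1 (^-anti 0≤ρ ρ≤1 {n = n} z≤n))
  (eq≤ (ℚ.*-identityˡ 1ℚ))
^-anti {ρ} 0≤ρ ρ≤1 (s≤s m≤n) =
  ℚ.*-monoˡ-≤-nonNeg ρ {{ℚ.nonNegative 0≤ρ}} (^-anti 0≤ρ ρ≤1 m≤n)

∣^∣≤ : ∀ {z ρ} → ℚ.∣ z ∣ ℚ.≤ ρ → ∀ n → ℚ.∣ z ^ℚ n ∣ ℚ.≤ ρ ^ℚ n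
∣^∣≤ ∣z∣≤ρ zero = ℚ.≤-refl
∣^∣≤ {z} ∣z∣≤ρ (suc n) = ℚ.≤-trans (eq≤ (ℚ.∣p*q∣≡∣p∣*∣q∣ z (z ^ℚ n)))
  (*-mono (ℚ.≤-trans (ℚ.0≤∣p∣ z) ∣z∣≤ρ) (ℚ.0≤∣p∣ (z ^ℚ n)) ∣z∣≤ρ (∣^∣≤ ∣z∣≤ρ n))

^-lipschitz : ∀ u v ρ → ℚ.∣ u ∣ ℚ.≤ ρ → ℚ.∣ v ∣ ℚ.≤ ρ → ∀ n →
  ℚ.∣ u ^ℚ suc n ℚ.- v ^ℚ suc n ∣ ℚ.≤ nat (suc n) ℚ.* (ρ ^ℚ n ℚ.* ℚ.∣ u ℚ.- v ∣)
^-lipschitz u v ρ ∣u∣≤ρ ∣v∣≤ρ zero = eq≤ (trans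
  (cong ℚ.∣_∣ (cong₂ ℚ._-_ (ℚ.*-identityʳ u) (ℚ.*-identityʳ v)))
  (sym (trans (ℚ.*-identityˡ _) (ℚ.*-identityˡ _))))
^-lipschitz u v ρ ∣u∣≤ρ ∣v∣≤ρ (suc n) = begin
  ℚ.∣ u ℚ.* u′ ℚ.- v ℚ.* v′ ∣
    ≡⟨ cong ℚ.∣_∣ (split u u′ v v′) ⟩
  ℚ.∣ u ℚ.* (u′ ℚ.- v′) ℚ.+ v′ ℚ.* (u ℚ.- v) ∣
    ≤⟨ ℚ.∣p+q∣≤∣p∣+∣q∣ (u ℚ.* (u′ ℚ.- v′)) (v′ ℚ.* (u ℚ.- v)) ⟩
  ℚ.∣ u ℚ.* (u′ ℚ.- v′) ∣ ℚ.+ ℚ.∣ v′ ℚ.* (u ℚ.- v) ∣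
    ≡⟨ cong₂ ℚ._+_ (ℚ.∣p*q∣≡∣p∣*∣q∣ u (u′ ℚ.- v′)) (ℚ.∣p*q∣≡∣p∣*∣q∣ v′ (u ℚ.- v)) ⟩
  ℚ.∣ u ∣ ℚ.* ℚ.∣ u′ ℚ.- v′ ∣ ℚ.+ ℚ.∣ v′ ∣ ℚ.* D
    ≤⟨ ℚ.+-mono-≤
         (*-mono 0≤ρ (ℚ.0≤∣p∣ (u′ ℚ.- v′)) ∣u∣≤ρ (^-lipschitz u v ρ ∣u∣≤ρ ∣v∣≤ρ n))
         (*-mono (^-nonNeg 0≤ρ (suc n)) (ℚ.0≤∣p∣ (u ℚ.- v)) (∣^∣≤ ∣v∣≤ρ (suc n)) ℚ.≤-refl) ⟩
  ρ ℚ.* (nat (suc n) ℚ.* (ρ ^ℚ n ℚ.* D)) ℚ.+ (ρ ℚ.* ρ ^ℚ n) ℚ.* D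
    ≡⟨ collect ρ (nat (suc n)) (ρ ^ℚ n) D ⟩
  (1ℚ ℚ.+ nat (suc n)) ℚ.* ((ρ ℚ.* ρ ^ℚ n) ℚ.* D)
    ≡⟨ cong (ℚ._* ((ρ ℚ.* ρ ^ℚ n) ℚ.* D)) (nat-suc (suc n)) ⟨
  nat (suc (suc n)) ℚ.* ((ρ ℚ.* ρ ^ℚ n) ℚ.* D) ∎
  where
  open ℚ.≤-Reasoning
  u′ = u ^ℚ suc n
  v′ = v ^ℚ suc n
  D  = ℚ.∣ u ℚ.- v ∣
  0≤ρ = ℚ.≤-trans (ℚ.0≤∣p∣ u) ∣u∣≤ρ
  split : ∀ a b c d → a ℚ.* b ℚ.- c ℚ.* d ≡ a ℚ.* (b ℚ.- d) ℚ.+ d ℚ.* (a ℚ.- c)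
  split = solve 4 (λ a b c d → a :* b :- c :* d := a :* (b :- d) :+ d :* (a :- c)) refl
  collect : ∀ a b c d →
    a ℚ.* (b ℚ.* (c ℚ.* d)) ℚ.+ (a ℚ.* c) ℚ.* d ≡ (1ℚ ℚ.+ b) ℚ.* ((a ℚ.* c) ℚ.* d)
  collect = solve 4 (λ a b c d →
    a :* (b :* (c :* d)) :+ (a :* c) :* d := (con 1ℚ :+ b) :* ((a :* c) :* d)) refl

n≤2n : ∀ n → n ℕ.≤ 2 ℕ.* n
n≤2n n = ℕ.m≤m+n n (n ℕ.+ 0)

module _ {ρ} (0≤ρ : 0ℚ ℚ.≤ ρ) (ρ<1 : ρ ℚ.< 1ℚ) where

  private
    r = 1ℚ ℚ.- ρ

  1-ρ>0 : 0ℚ ℚ.< r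
  1-ρ>0 = ℚ.≤-<-trans (eq≤ (sym (ℚ.+-inverseʳ ρ))) (ℚ.+-monoˡ-< (ℚ.- ρ) ρ<1)

  private
    R = inv r 1-ρ>0

  geometricSum-closed : ∀ m → r ℚ.* geometricSum m ρ ℚ.+ ρ ^ℚ m ≡ 1ℚ
  geometricSum-closed zero = trans (cong (ℚ._+ 1ℚ) (ℚ.*-zeroʳ r)) (ℚ.+-identityˡ 1ℚ)
  geometricSum-closed (suc m) = trans
    (telescope ρ (geometricSum m ρ) (ρ ^ℚ m)) (geometricSum-closed m)
    where
    telescope : ∀ a b c → (1ℚ ℚ.- a) ℚ.* (b ℚ.+ c) ℚ.+ a ℚ.* c ≡ (1ℚ ℚ.- a) ℚ.* b ℚ.+ c
    telescope = solve 3 (λ a b c →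
      (con 1ℚ :- a) :* (b :+ c) :+ a :* c := (con 1ℚ :- a) :* b :+ c) refl

  geometricSum≤ : ∀ m → geometricSum m ρ ℚ.≤ R
  geometricSum≤ m = begin
    G                          ≡⟨ ℚ.*-identityˡ G ⟨
    1ℚ ℚ.* G                   ≡⟨ cong (ℚ._* G) (inv-*ˡ 1-ρ>0) ⟨
    (R ℚ.* r) ℚ.* G            ≡⟨ ℚ.*-assoc R r G ⟩
    R ℚ.* (r ℚ.* G)            ≤⟨ *-mono′ (ℚ.≤-trans (eq≤ (sym (ℚ.+-identityʳ (r ℚ.* G))))
                                    (ℚ.≤-trans (ℚ.+-monoʳ-≤ (r ℚ.* G) (^-nonNeg 0≤ρ m))
                                      (eq≤ (geometricSum-closed m)))) ⟩
    R ℚ.* 1ℚ                   ≡⟨ ℚ.*-identityʳ R ⟩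
    R                          ∎
    where
    open ℚ.≤-Reasoning
    G = geometricSum m ρ
    *-mono′ : ∀ {a b} → a ℚ.≤ b → R ℚ.* a ℚ.≤ R ℚ.* b
    *-mono′ = ℚ.*-monoˡ-≤-nonNeg R {{ℚ.nonNegative (ℚ.<⇒≤ (inv-pos 1-ρ>0))}}

  geometricSum-nonNeg : ∀ m → 0ℚ ℚ.≤ geometricSum m ρ
  geometricSum-nonNeg zero    = ℚ.≤-refl
  geometricSum-nonNeg (suc m) = ℚ.≤-trans (eq≤ (sym (ℚ.+-identityˡ 0ℚ)))
    (ℚ.+-mono-≤ (geometricSum-nonNeg m) (^-nonNeg 0≤ρ m))

  artanhSum-lipschitz : ∀ u v → ℚ.∣ u ∣ ℚ.≤ ρ → ℚ.∣ v ∣ ℚ.≤ ρ → ∀ m →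
    ℚ.∣ artanhSum m u ℚ.- artanhSum m v ∣ ℚ.≤ geometricSum m ρ ℚ.* ℚ.∣ u ℚ.- v ∣
  artanhSum-lipschitz u v ∣u∣≤ρ ∣v∣≤ρ zero =
    eq≤ (sym (ℚ.*-zeroˡ ℚ.∣ u ℚ.- v ∣))
  artanhSum-lipschitz u v ∣u∣≤ρ ∣v∣≤ρ (suc m) = begin
    ℚ.∣ (S ℚ.+ u′ ℚ.* c) ℚ.- (T ℚ.+ v′ ℚ.* c) ∣
      ≡⟨ cong ℚ.∣_∣ (regroup S T u′ v′ c) ⟩
    ℚ.∣ (S ℚ.- T) ℚ.+ c ℚ.* (u′ ℚ.- v′) ∣
      ≤⟨ ℚ.∣p+q∣≤∣p∣+∣q∣ (S ℚ.- T) (c ℚ.* (u′ ℚ.- v′)) ⟩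
    ℚ.∣ S ℚ.- T ∣ ℚ.+ ℚ.∣ c ℚ.* (u′ ℚ.- v′) ∣
      ≤⟨ ℚ.+-mono-≤ (artanhSum-lipschitz u v ∣u∣≤ρ ∣v∣≤ρ m) term ⟩
    geometricSum m ρ ℚ.* D ℚ.+ ρ ^ℚ m ℚ.* D
      ≡⟨ ℚ.*-distribʳ-+ D (geometricSum m ρ) (ρ ^ℚ m) ⟨
    geometricSum (suc m) ρ ℚ.* D ∎
    where
    open ℚ.≤-Reasoning
    k = 2 ℕ.* m
    c = unit k
    S = artanhSum m u
    T = artanhSum m v
    u′ = u ^ℚ suc k
    v′ = v ^ℚ suc k
    D = ℚ.∣ u ℚ.- v ∣
    regroup : ∀ S T a b c →
      (S ℚ.+ a ℚ.* c) ℚ.- (T ℚ.+ b ℚ.* c) ≡ (S ℚ.- T) ℚ.+ c ℚ.* (a ℚ.- b)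
    regroup = solve 5 (λ S T a b c →
      (S :+ a :* c) :- (T :+ b :* c) := (S :- T) :+ c :* (a :- b)) refl
    0≤c = ℚ.<⇒≤ (unit>0 k)
    term : ℚ.∣ c ℚ.* (u′ ℚ.- v′) ∣ ℚ.≤ ρ ^ℚ m ℚ.* D
    term = begin
      ℚ.∣ c ℚ.* (u′ ℚ.- v′) ∣
        ≡⟨ ℚ.∣p*q∣≡∣p∣*∣q∣ c (u′ ℚ.- v′) ⟩
      ℚ.∣ c ∣ ℚ.* ℚ.∣ u′ ℚ.- v′ ∣
        ≤⟨ *-mono 0≤c (ℚ.0≤∣p∣ (u′ ℚ.- v′)) (eq≤ (ℚ.0≤p⇒∣p∣≡p 0≤c))
             (^-lipschitz u v ρ ∣u∣≤ρ ∣v∣≤ρ k) ⟩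
      c ℚ.* (nat (suc k) ℚ.* (ρ ^ℚ k ℚ.* D))
        ≡⟨ ℚ.*-assoc c (nat (suc k)) (ρ ^ℚ k ℚ.* D) ⟨
      (c ℚ.* nat (suc k)) ℚ.* (ρ ^ℚ k ℚ.* D)
        ≡⟨ cong (ℚ._* (ρ ^ℚ k ℚ.* D)) (unit*nat-suc k) ⟩
      1ℚ ℚ.* (ρ ^ℚ k ℚ.* D)
        ≡⟨ ℚ.*-identityˡ (ρ ^ℚ k ℚ.* D) ⟩
      ρ ^ℚ k ℚ.* D
        ≤⟨ *-mono (^-nonNeg 0≤ρ m) (ℚ.0≤∣p∣ (u ℚ.- v))
             (^-anti 0≤ρ (ℚ.<⇒≤ ρ<1) (n≤2n m)) ℚ.≤-refl ⟩
      ρ ^ℚ m ℚ.* D ∎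

  artanhSum-tail : ∀ v → ℚ.∣ v ∣ ℚ.≤ ρ → ∀ m d →
    ℚ.∣ artanhSum (d ℕ.+ m) v ℚ.- artanhSum m v ∣ ℚ.≤
    unit m ℚ.* (geometricSum (d ℕ.+ m) ρ ℚ.- geometricSum m ρ)
  artanhSum-tail v ∣v∣≤ρ m zero = eq≤ (trans
    (cong ℚ.∣_∣ (ℚ.+-inverseʳ (artanhSum m v)))
    (sym (trans (cong (unit m ℚ.*_) (ℚ.+-inverseʳ (geometricSum m ρ))) (ℚ.*-zeroʳ (unit m)))))
  artanhSum-tail v ∣v∣≤ρ m (suc d) = begin
    ℚ.∣ (S ℚ.+ v′ ℚ.* c) ℚ.- T ∣
      ≡⟨ cong ℚ.∣_∣ (swap S (v′ ℚ.* c) T) ⟩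
    ℚ.∣ (S ℚ.- T) ℚ.+ v′ ℚ.* c ∣
      ≤⟨ ℚ.∣p+q∣≤∣p∣+∣q∣ (S ℚ.- T) (v′ ℚ.* c) ⟩
    ℚ.∣ S ℚ.- T ∣ ℚ.+ ℚ.∣ v′ ℚ.* c ∣
      ≤⟨ ℚ.+-mono-≤ (artanhSum-tail v ∣v∣≤ρ m d) term ⟩
    unit m ℚ.* (G ℚ.- H) ℚ.+ ρ ^ℚ n ℚ.* unit m
      ≡⟨ collect (unit m) G H (ρ ^ℚ n) ⟩
    unit m ℚ.* ((G ℚ.+ ρ ^ℚ n) ℚ.- H) ∎
    where
    open ℚ.≤-Reasoning
    n = d ℕ.+ m
    k = 2 ℕ.* n
    c = unit k
    S = artanhSum n v
    T = artanhSum m v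
    G = geometricSum n ρ
    H = geometricSum m ρ
    v′ = v ^ℚ suc k
    0≤c = ℚ.<⇒≤ (unit>0 k)
    swap : ∀ a b c → (a ℚ.+ b) ℚ.- c ≡ (a ℚ.- c) ℚ.+ b
    swap = solve 3 (λ a b c → (a :+ b) :- c := (a :- c) :+ b) refl
    collect : ∀ a b c d → a ℚ.* (b ℚ.- c) ℚ.+ d ℚ.* a ≡ a ℚ.* ((b ℚ.+ d) ℚ.- c)
    collect = solve 4 (λ a b c d → a :* (b :- c) :+ d :* a := a :* ((b :+ d) :- c)) refl
    term : ℚ.∣ v′ ℚ.* c ∣ ℚ.≤ ρ ^ℚ n ℚ.* unit m
    term = begin
      ℚ.∣ v′ ℚ.* c ∣
        ≡⟨ ℚ.∣p*q∣≡∣p∣*∣q∣ v′ c ⟩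
      ℚ.∣ v′ ∣ ℚ.* ℚ.∣ c ∣
        ≡⟨ cong (ℚ.∣ v′ ∣ ℚ.*_) (ℚ.0≤p⇒∣p∣≡p 0≤c) ⟩
      ℚ.∣ v′ ∣ ℚ.* c
        ≤⟨ *-mono (^-nonNeg 0≤ρ n) 0≤c
             (ℚ.≤-trans (∣^∣≤ ∣v∣≤ρ (suc k))
               (^-anti 0≤ρ (ℚ.<⇒≤ ρ<1) (ℕ.≤-trans (n≤2n n) (ℕ.n≤1+n k))))
             (unit-anti (ℕ.≤-trans (ℕ.m≤n+m m d) (n≤2n n))) ⟩
      ρ ^ℚ n ℚ.* unit m ∎

  artanhSum-close : ∀ z w m n e → ℚ.∣ z ∣ ℚ.≤ ρ → ℚ.∣ w ∣ ℚ.≤ ρ → ℚ.∣ z ℚ.- w ∣ ℚ.≤ e →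
    unit m ℚ.≤ e → m ℕ.≤ n →
    ℚ.∣ artanhSum m z ℚ.- artanhSum n w ∣ ℚ.≤ (R ℚ.+ R) ℚ.* e
  artanhSum-close z w m n e ∣z∣≤ρ ∣w∣≤ρ zw≤e unit≤e m≤n = begin
    ℚ.∣ A ℚ.- C ∣
      ≡⟨ cong ℚ.∣_∣ (insert A B C) ⟩
    ℚ.∣ (A ℚ.- B) ℚ.- (C ℚ.- B) ∣
      ≤⟨ ℚ.∣p-q∣≤∣p∣+∣q∣ (A ℚ.- B) (C ℚ.- B) ⟩
    ℚ.∣ A ℚ.- B ∣ ℚ.+ ℚ.∣ C ℚ.- B ∣
      ≤⟨ ℚ.+-mono-≤ left right ⟩
    R ℚ.* e ℚ.+ R ℚ.* e
      ≡⟨ ℚ.*-distribʳ-+ e R R ⟨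
    (R ℚ.+ R) ℚ.* e ∎
    where
    open ℚ.≤-Reasoning
    A = artanhSum m z
    B = artanhSum m w
    C = artanhSum n w
    0≤R = ℚ.<⇒≤ (inv-pos 1-ρ>0)
    insert : ∀ a b c → a ℚ.- c ≡ (a ℚ.- b) ℚ.- (c ℚ.- b)
    insert = solve 3 (λ a b c → a :- c := (a :- b) :- (c :- b)) refl
    left : ℚ.∣ A ℚ.- B ∣ ℚ.≤ R ℚ.* e
    left = ℚ.≤-trans (artanhSum-lipschitz z w ∣z∣≤ρ ∣w∣≤ρ m)
      (*-mono 0≤R (ℚ.0≤∣p∣ (z ℚ.- w)) (geometricSum≤ m) zw≤e)
    gap : geometricSum n ρ ℚ.- geometricSum m ρ ℚ.≤ R
    gap = ℚ.≤-trans (ℚ.+-mono-≤ (geometricSum≤ n) (ℚ.neg-antimono-≤ (geometricSum-nonNeg m)))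
      (eq≤ (ℚ.+-identityʳ R))
    right : ℚ.∣ C ℚ.- B ∣ ℚ.≤ R ℚ.* e
    right = begin
      ℚ.∣ C ℚ.- B ∣
        ≤⟨ subst (λ k → ℚ.∣ artanhSum k w ℚ.- B ∣ ℚ.≤ unit m ℚ.* (geometricSum k ρ ℚ.- geometricSum m ρ))
             (ℕ.m∸n+n≡m m≤n) (artanhSum-tail w ∣w∣≤ρ m (n ℕ.∸ m)) ⟩
      unit m ℚ.* (geometricSum n ρ ℚ.- geometricSum m ρ)
        ≤⟨ ℚ.*-monoˡ-≤-nonNeg (unit m) {{ℚ.nonNegative (ℚ.<⇒≤ (unit>0 m))}} gap ⟩
      unit m ℚ.* R
        ≤⟨ ℚ.*-monoʳ-≤-nonNeg R {{ℚ.nonNegative 0≤R}} unit≤e ⟩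
      e ℚ.* R
        ≡⟨ ℚ.*-comm e R ⟩
      R ℚ.* e ∎

artanhSum-cauchy : ∀ {z ρ} → Cauchy z → ρ ℚ.< 1ℚ →
  (∃ λ N → ∀ n → N ℕ.≤ n → ℚ.∣ z n ∣ ℚ.≤ ρ) → Cauchy (λ n → artanhSum n (z n))
artanhSum-cauchy {z} {ρ} c ρ<1 (K , b) =
  cauchy-scaled (λ n → artanhSum n (z n)) (R ℚ.+ R) (ℚ.+-mono-< R>0 R>0) λ e 0<e →
    let M , p = c e 0<e
        N , q = unit≤ e 0<e
        close : ∀ m n → K ℕ.⊔ (M ℕ.⊔ N) ℕ.≤ m → K ℕ.⊔ (M ℕ.⊔ N) ℕ.≤ n → m ℕ.≤ n →
                ℚ.∣ artanhSum m (z m) ℚ.- artanhSum n (z n) ∣ ℚ.≤ (R ℚ.+ R) ℚ.* e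
        close m n ≤m ≤n m≤n = artanhSum-close 0≤ρ ρ<1 (z m) (z n) m n e
          (b m (⊔ˡ ≤m)) (b n (⊔ˡ ≤n))
          (p m n (⊔ˡ (⊔ʳ {K} ≤m)) (⊔ˡ (⊔ʳ {K} ≤n)))
          (ℚ.≤-trans (unit-anti (⊔ʳ {M} (⊔ʳ {K} ≤m))) q) m≤n
    in K ℕ.⊔ (M ℕ.⊔ N) , λ m n ≤m ≤n → case-≤ m n (close m n ≤m ≤n)
         (λ n≤m → ℚ.≤-trans (eq≤ (∣-∣-sym (artanhSum m (z m)) (artanhSum n (z n))))
                    (close n m ≤n ≤m n≤m))
  where
  0≤ρ : 0ℚ ℚ.≤ ρ
  0≤ρ = ℚ.≤-trans (ℚ.0≤∣p∣ (z K)) (b K ℕ.≤-refl)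
  R>0 = inv-pos (1-ρ>0 0≤ρ ρ<1)
  R = inv (1ℚ ℚ.- ρ) (1-ρ>0 0≤ρ ρ<1)
  case-≤ : ∀ {A : Set} m n → (m ℕ.≤ n → A) → (n ℕ.≤ m → A) → A
  case-≤ m n f g with ℕ.≤-total m n
  ... | inj₁ m≤n = f m≤n
  ... | inj₂ n≤m = g n≤m

abstract
  artanh-cauchy : ∀ z → ∣ z ∣ < 1ℝ → Cauchy (λ n → artanhSum n (seq z n))
  artanh-cauchy z (e , 0<e , N , b) =
    artanhSum-cauchy (cauchy z) 1-e<1 (N , λ n N≤n → bound (seq z n) (b n N≤n))
    where
    1-e<1 : 1ℚ ℚ.- e ℚ.< 1ℚ
    1-e<1 = ℚ.<-≤-trans (ℚ.+-monoʳ-< 1ℚ (ℚ.neg-antimono-< 0<e)) (eq≤ (ℚ.+-identityʳ 1ℚ))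
    cancel : ∀ a c → a ≡ (a ℚ.+ c) ℚ.- c
    cancel = solve 2 (λ a c → a := (a :+ c) :- c) refl
    bound : ∀ p → ℚ.∣ p ∣ ℚ.+ e ℚ.≤ 1ℚ → ℚ.∣ p ∣ ℚ.≤ 1ℚ ℚ.- e
    bound p h = ℚ.≤-trans (eq≤ (cancel ℚ.∣ p ∣ e)) (ℚ.+-monoˡ-≤ (ℚ.- e) h)

artanh : (z : ℝ) → ∣ z ∣ < 1ℝ → ℝ
artanh z ∣z∣<1 = mkℝ (λ n → artanhSum n (seq z n)) (artanh-cauchy z ∣z∣<1)

mobius-bound : ∀ {e B} p (0<e : 0ℚ ℚ.< e) (0<B+1 : 0ℚ ℚ.< B ℚ.+ 1ℚ) → e ℚ.≤ p → p ℚ.≤ B →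
  ℚ.∣ (p ℚ.- 1ℚ) ℚ.* inv-clamp 0<1 (p ℚ.+ 1ℚ) ∣
    ℚ.+ (e ℚ.⊓ 1ℚ) ℚ.* inv (B ℚ.+ 1ℚ) 0<B+1 ℚ.≤ 1ℚ
mobius-bound {e} {B} p 0<e 0<B+1 e≤p p≤B = begin
  ℚ.∣ (p ℚ.- 1ℚ) ℚ.* y ∣ ℚ.+ c ℚ.* b
    ≡⟨ cong (ℚ._+ c ℚ.* b) (trans (ℚ.∣p*q∣≡∣p∣*∣q∣ (p ℚ.- 1ℚ) y)
         (cong (ℚ.∣ p ℚ.- 1ℚ ∣ ℚ.*_) (ℚ.0≤p⇒∣p∣≡p 0≤y))) ⟩
  ℚ.∣ p ℚ.- 1ℚ ∣ ℚ.* y ℚ.+ c ℚ.* b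
    ≤⟨ ℚ.+-mono-≤
         (ℚ.*-monoʳ-≤-nonNeg y {{ℚ.nonNegative 0≤y}} (∣∣-lub upper lower))
         (ℚ.*-monoˡ-≤-nonNeg c {{ℚ.nonNegative 0≤c}} (inv-clamp-lower 0<1 0<B+1 (p ℚ.+ 1ℚ) 1≤p+1
           (ℚ.+-monoˡ-≤ 1ℚ p≤B))) ⟩
  ((p ℚ.+ 1ℚ) ℚ.- c) ℚ.* y ℚ.+ c ℚ.* y
    ≡⟨ recombine (p ℚ.+ 1ℚ) c y ⟩
  y ℚ.* (p ℚ.+ 1ℚ)
    ≡⟨ inv-clamp-* 0<1 (p ℚ.+ 1ℚ) 1≤p+1 ⟩
  1ℚ ∎
  where
  open ℚ.≤-Reasoning
  y = inv-clamp 0<1 (p ℚ.+ 1ℚ)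
  c = e ℚ.⊓ 1ℚ
  b = inv (B ℚ.+ 1ℚ) 0<B+1
  0≤y = ℚ.<⇒≤ (inv-pos (clamp>0 (p ℚ.+ 1ℚ) 0<1))
  0≤p = ℚ.≤-trans (ℚ.<⇒≤ 0<e) e≤p
  0≤c : 0ℚ ℚ.≤ c
  0≤c = ℚ.⊓-glb (ℚ.<⇒≤ 0<e) (ℚ.<⇒≤ 0<1)
  1≤p+1 : 1ℚ ℚ.≤ p ℚ.+ 1ℚ
  1≤p+1 = ℚ.≤-trans (eq≤ (sym (ℚ.+-identityˡ 1ℚ))) (ℚ.+-monoˡ-≤ 1ℚ 0≤p)
  c≤1 : c ℚ.≤ 1ℚ
  c≤1 = ℚ.p⊓q≤q e 1ℚ
  c≤p : c ℚ.≤ p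
  c≤p = ℚ.≤-trans (ℚ.p⊓q≤p e 1ℚ) e≤p
  recombine : ∀ a c y → (a ℚ.- c) ℚ.* y ℚ.+ c ℚ.* y ≡ y ℚ.* a
  recombine = solve 3 (λ a c y → (a :- c) :* y :+ c :* y := y :* a) refl
  upper : p ℚ.- 1ℚ ℚ.≤ (p ℚ.+ 1ℚ) ℚ.- c
  upper = ℚ.≤-trans (ℚ.+-monoʳ-≤ p (ℚ.≤-trans (ℚ.neg-antimono-≤ c≤1)
    (ℚ.≤-trans (eq≤ (sym (ℚ.+-identityˡ (ℚ.- c)))) (ℚ.+-monoˡ-≤ (ℚ.- c) (ℚ.<⇒≤ 0<1)))))
    (eq≤ (sym (ℚ.+-assoc p 1ℚ (ℚ.- c))))
  flip : ∀ p → ℚ.- (p ℚ.- 1ℚ) ≡ (0ℚ ℚ.+ 1ℚ) ℚ.- p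
  flip = solve 1 (λ p → :- (p :- con 1ℚ) := (con 0ℚ :+ con 1ℚ) :- p) refl
  lower : ℚ.- (p ℚ.- 1ℚ) ℚ.≤ (p ℚ.+ 1ℚ) ℚ.- c
  lower = ℚ.≤-trans (eq≤ (flip p))
    (ℚ.+-mono-≤ (ℚ.+-monoˡ-≤ 1ℚ 0≤p) (ℚ.neg-antimono-≤ c≤p))

abstract
  0≤⇒1≤+1 : ∀ {e} x → 0ℚ ℚ.< e → ∀ n → 0ℚ ℚ.+ e ℚ.≤ seq x n → 0ℚ ℚ.+ 1ℚ ℚ.≤ seq x n ℚ.+ 1ℚ
  0≤⇒1≤+1 {e} x 0<e n e≤x = ℚ.+-monoˡ-≤ 1ℚ
    (ℚ.≤-trans (ℚ.<⇒≤ 0<e) (ℚ.≤-trans (eq≤ (sym (ℚ.+-identityˡ e))) e≤x))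

-- (x - 1) / (x + 1)
mobius : ℝ⁺ → ℝ
mobius (mkℝ⁺ x (e , 0<e , N , e≤x)) = (x - 1ℝ) * value (mkℝ⁺ (x + 1ℝ) x+1>0 ⁻¹)
  where
  x+1>0 : 0ℝ < x + 1ℝ
  x+1>0 = 1ℚ , 0<1 , N , λ n N≤n → 0≤⇒1≤+1 x 0<e n (e≤x n N≤n)

abstract
  ∣mobius∣<1 : ∀ x → ∣ mobius x ∣ < 1ℝ
  ∣mobius∣<1 (mkℝ⁺ x (e , 0<e , N , e≤x)) = from-bound (bounded x)
    where
    from-bound : Bounded (seq x) → ∣ mobius (mkℝ⁺ x (e , 0<e , N , e≤x)) ∣ < 1ℝ
    from-bound (B , 0<B , M , b) =
      (e ℚ.⊓ 1ℚ) ℚ.* inv (B ℚ.+ 1ℚ) 0<B+1 , *-pos 0<c (inv-pos 0<B+1) , N ℕ.⊔ M , λ n ≤n →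
        mobius-bound (seq x n) 0<e 0<B+1
          (ℚ.≤-trans (eq≤ (sym (ℚ.+-identityˡ e))) (e≤x n (⊔ˡ ≤n)))
          (ℚ.≤-trans (p≤∣p∣ (seq x n)) (b n (⊔ʳ {N} ≤n)))
      where
      0<B+1 : 0ℚ ℚ.< B ℚ.+ 1ℚ
      0<B+1 = ℚ.+-mono-< 0<B (ℚ.positive⁻¹ 1ℚ)
      0<c : 0ℚ ℚ.< e ℚ.⊓ 1ℚ
      0<c with ℚ.⊓-sel e 1ℚ
      ... | inj₁ eq = subst (0ℚ ℚ.<_) (sym eq) 0<e
      ... | inj₂ eq = subst (0ℚ ℚ.<_) (sym eq) (ℚ.positive⁻¹ 1ℚ)

-- The natural logarithm, as log x = 2 artanh ((x - 1) / (x + 1)) for every x > 0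
log : ℝ⁺ → ℝ
log x = fromℕ 2 * artanh (mobius x) (∣mobius∣<1 x)

-- A list of monomials: coefficient and exponent of each variable.
Polynomial : ℕ → Set
Polynomial k = List (ℝ × Vec ℕ k)

evaluate : ∀ {k} → Polynomial k → Vec ℝ k → ℝ
evaluate p xs =
  foldr (λ (c , es) acc → c * Vec.foldr′ _*_ 1ℝ (Vec.zipWith _^_ xs es) + acc) 0ℝ p

record Distribution (n : ℕ) : Set where
  field
    prob   : Fin n → ℝ
    nonNeg : ∀ i → 0ℝ ≤ prob i
    total  : sum prob ≃ 1ℝ

open Distribution public

mass : ∀ {n} → Distribution n → Subset n → ℝ
mass μ A = sum λ i → if does (i ∈? A) then prob μ i else 0ℝ

distance : ∀ {n} → Distribution n → Distribution n → ℝ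
distance μ μ′ = fromℚ ½ * sum λ i → ∣ prob μ i - prob μ′ i ∣

-- There are no distributions over the empty set, so n is positive throughout.
Property : Set₁
Property = (n : ℕ) .{{_ : ℕ.NonZero n}} → Distribution n → Set

Uniform : Property
Uniform n μ = ∀ i → prob μ i ≃ fromℚ (ℤ.+ 1 ℚ./ n)

Far : Property → (ε : ℝ) (n : ℕ) .{{_ : ℕ.NonZero n}} → Distribution n → Set
Far P ε n μ = ∀ μ′ → P n μ′ → ε ≤ distance μ μ′

1/card : ∀ {n} (A : Subset n) → Nonempty A → ℝ
1/card A (_ , i∈A) = fromℚ ((ℤ.+ 1 ℚ./ card A) {{ℕ.>-nonZero (ℕ.m<n⇒0<n (x∈p⇒∣p-x∣<∣p∣ i∈A))}})

-- The distribution of the answer to each query. It is specified up to _≃_ by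
-- the fields below rather than defined from μ, because whether μ(A) is positive
-- or zero is undecidable. Successive answers are independent: see strategyPr.
record ConditionalOracle {n : ℕ} (μ : Distribution n) : Set where
  field
    answer     : (A : Subset n) → Nonempty A → Distribution n
    outside    : ∀ A A≠∅ j → j ∉ A → prob (answer A A≠∅) j ≃ 0ℝ
    normalised : ∀ A A≠∅ j → j ∈ A → (μA>0 : 0ℝ < mass μ A) →
                 prob (answer A A≠∅) j ≃ prob μ j * value (mkℝ⁺ (mass μ A) μA>0 ⁻¹)
    degenerate : ∀ A A≠∅ j → j ∈ A → mass μ A ≃ 0ℝ →
                 prob (answer A A≠∅) j ≃ 1/card A A≠∅

open ConditionalOracle public

-- A tester with its coin tosses fixed: a decision tree making exactly t queries
-- and branching on each sample received. The verdict true means accept.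
data Strategy (n : ℕ) : ℕ → Set where
  verdict : Bool → Strategy n 0
  query   : ∀ {t} (A : Subset n) → Nonempty A → (Fin n → Strategy n t) → Strategy n (suc t)

-- The coins are fair and finite in number; their number is not bounded.
record Algorithm (n t : ℕ) : Set where
  field
    coins    : ℕ
    strategy : Vec Bool coins → Strategy n t

open Algorithm public

strategyPr : ∀ {n t} {μ : Distribution n} → ConditionalOracle μ → Strategy n t → Bool → ℝ
strategyPr O (verdict v)        b = if does (v Bool.≟ b) then 1ℝ else 0ℝ
strategyPr O (query A A≠∅ next) b =
  sum λ j → prob (answer O A A≠∅) j * strategyPr O (next j) b

coinAverage : ∀ r → (Vec Bool r → ℝ) → ℝ
coinAverage zero    f = f []
coinAverage (suc r) f =
  fromℚ ½ * (coinAverage r (λ ω → f (true ∷ ω)) + coinAverage r (λ ω → f (false ∷ ω)))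

Pr : ∀ {n t} {μ : Distribution n} → ConditionalOracle μ → Algorithm n t → Bool → ℝ
Pr O 𝒜 b = coinAverage (coins 𝒜) λ ω → strategyPr O (strategy 𝒜 ω) b

record AdaptiveTester (P : Property) : Set where
  field
    samples   : (ε δ : ℝ⁺) (n : ℕ) .{{_ : ℕ.NonZero n}} → ℕ
    algorithm : (ε δ : ℝ⁺) (n : ℕ) .{{_ : ℕ.NonZero n}} → Algorithm n (samples ε δ n)
    accepts   : ∀ ε δ n .{{_ : ℕ.NonZero n}} (μ : Distribution n) (O : ConditionalOracle μ) →
                P n μ → 1ℝ - value δ ≤ Pr O (algorithm ε δ n) true
    rejects   : ∀ ε δ n .{{_ : ℕ.NonZero n}} (μ : Distribution n) (O : ConditionalOracle μ) →
                Far P (value ε) n μ → 1ℝ - value δ ≤ Pr O (algorithm ε δ n) false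

open AdaptiveTester public

{-# OPTIONS --safe #-}
module Submission where

-- In each round the tester draws a sample i from the unknown distribution μ and,
-- with fair coins, an opponent j uniform in [n], and queries the set {i , j}. The
-- round scores +1 if i is returned, -1 if j is returned, and 0 if i = j. With D the
-- mean score given i and j,
--     (μ(i) + μ(j)) D = μ(i) - μ(j),
-- which also holds if both masses vanish. If μ is uniform the mean score is 0. In
-- general the antisymmetric part of
--     μ(i) D = (μ(i) - μ(j))/2 + (μ(i) + μ(j)) D²/2
-- cancels in the sum over all pairs, and with
--     (μ(i) + μ(j)) D² ≥ 2t |μ(i) - μ(j)| - t² (μ(i) + μ(j))
-- and |n μ(j) - 1| ≤ ∑ᵢ |μ(i) - μ(j)| one finds that the sum of all μ(i) D is at
-- least n t² when μ has distance at least t from the uniform distribution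
-- (sum-bias). So the mean score is 0 in one case and of the order of t² in the
-- other, independently of n. Fair coins cannot draw from [n] exactly; r of them,
-- with n ≤ 2^r ≤ 2n, give every element of [n] probability 2^-r and otherwise make
-- the round void, which at most halves the mean score: it is at least t²/2
-- (meanScore-far).
--
-- The scores are accumulated by betting. Starting with the wealth 2^-k, the tester
-- stakes the fraction η = t²/8 of its wealth on each round and rejects if it ends
-- with wealth at least 1. Under the uniform distribution the wealth is a martingale,
-- so this has probability at most 2^-k (accept-fair). If μ is far from uniform, the
-- mean score is at least 4η and an upper bound for the inverse wealth decreases in
-- the mean by the factor 1 - 2η² per round; after 2k/(2η²) rounds its mean is at
-- most 2^-k, which bounds the probability of acceptance (reject-biased).
--
-- With t = 2^-l ≤ ε and 2^-k ≤ δ chosen within a factor 8 (dyadic), the number of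
-- samples is a multiple of t⁻⁴ k. It remains to bound k by log δ⁻¹: for x ≥ 2^(j+3)
-- the argument z = (x - 1)/(x + 1) is so close to 1 that each of the first j dyadic
-- blocks of the series of artanh z contributes at least 1/16 (artanhSum-dyadic).
--
-- Probabilities are Cauchy reals, for which the sign of a mass is undecidable. The
-- assertions to be proved are inequalities ≤ between reals; these are stable under
-- double negation, so that a mass may be assumed to be positive or zero (by-sign).

open import Defs
open import Algebra.Bundles using (CommutativeRing)
import Algebra.Properties.CommutativeSemiring.Exp as Exp
import Algebra.Properties.Semiring.Sum as SemiringSum
open import Algebra.Structures using (IsCommutativeRing)
open import Data.Bool.Base using (Bool; true; false; if_then_else_)
open import Data.Fin.Base using (Fin; zero; suc; _↑ˡ_; _↑ʳ_; splitAt)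
import Data.Fin.Properties as Fin
open import Data.Fin.Subset using (Subset; Nonempty; ⊤; ⁅_⁆; _∪_; _∈_)
open import Data.Fin.Subset.Properties
  using (p⊆p∪q; q⊆p∪q; x∈⁅x⁆; x∈⁅y⁆⇒x≡y; x∈p∪q⁻; _∈?_; ∈⊤)
import Data.Integer.Base as ℤ
open import Data.List.Base using ([]; _∷_)
open import Data.Maybe.Base using (Maybe; just; nothing; fromMaybe)
open import Data.Nat.Base as ℕ using (ℕ; zero; suc; NonZero)
import Data.Nat.Properties as ℕ
open import Data.Product.Base using (Σ; Σ-syntax; ∃; ∃₂; _×_; _,_; proj₁; proj₂)
open import Data.Rational.Base as ℚ using (ℚ; 0ℚ; 1ℚ; ½)
import Data.Rational.Properties as ℚ
import Data.Rational.Solver as ℚSolver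
open import Data.Sum.Base using (_⊎_; inj₁; inj₂; [_,_]′)
open import Data.Vec.Base using (Vec; []; _∷_)
open import Function.Base using (_∘_; const)
open import Level using (0ℓ)
open import Relation.Binary.Bundles using (Poset)
open import Relation.Binary.PropositionalEquality
import Relation.Binary.Reasoning.PartialOrder as PartialOrderReasoning
open import Relation.Nullary using (¬_; Dec; yes; no; does; contradiction)

open Exp (CommutativeRing.commutativeSemiring ℚ.+-*-commutativeRing)
  using (^-homo-*; ^-distrib-*) renaming (_^_ to _^ℚ_)
open ℚSolver.+-*-Solver using (solve; con; _:=_; _:+_; _:*_; _:-_; :-_)

-- Rational inequalities

0≤1 : 0ℚ ℚ.≤ 1ℚ
0≤1 = ℚ.<⇒≤ 0<1

p≤q⇒0≤q-p : ∀ {p q} → p ℚ.≤ q → 0ℚ ℚ.≤ q ℚ.- p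
p≤q⇒0≤q-p {p} p≤q = ℚ.≤-trans (eq≤ (sym (ℚ.+-inverseʳ p))) (ℚ.+-monoˡ-≤ (ℚ.- p) p≤q)

-- p ≤ q, given a nonnegative expression d for the difference.
≤-by : ∀ {p q} d → q ≡ p ℚ.+ d → 0ℚ ℚ.≤ d → p ℚ.≤ q
≤-by {p} d eq 0≤d = ℚ.≤-trans (eq≤ (sym (ℚ.+-identityʳ p)))
  (ℚ.≤-trans (ℚ.+-monoʳ-≤ p 0≤d) (eq≤ (sym eq)))

+-nonNeg : ∀ {p q} → 0ℚ ℚ.≤ p → 0ℚ ℚ.≤ q → 0ℚ ℚ.≤ p ℚ.+ q
+-nonNeg = ℚ.+-mono-≤

0≤½ : 0ℚ ℚ.≤ ½
0≤½ = ℚ.<⇒≤ (ℚ.positive⁻¹ ½)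

½≤1 : ½ ℚ.≤ 1ℚ
½≤1 = ≤-by ½ refl 0≤½

half-pos : ∀ {e} → 0ℚ ℚ.< e → 0ℚ ℚ.< ½ ℚ.* e
half-pos = *-pos (ℚ.positive⁻¹ ½)

halves : ∀ e → ½ ℚ.* e ℚ.+ ½ ℚ.* e ≡ e
halves e = trans (sym (ℚ.*-distribʳ-+ e ½ ½)) (ℚ.*-identityˡ e)

-- a ≤ b, given ca ≤ cb for a positive c with inverse h.
cancel-≤ : ∀ h c a b → 0ℚ ℚ.≤ h → h ℚ.* c ≡ 1ℚ → c ℚ.* a ℚ.≤ c ℚ.* b → a ℚ.≤ b
cancel-≤ h c a b 0≤h hc≡1 ca≤cb = begin
  a                  ≡⟨ undo a ⟨
  h ℚ.* (c ℚ.* a)    ≤⟨ ℚ.*-monoˡ-≤-nonNeg h {{ℚ.nonNegative 0≤h}} ca≤cb ⟩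
  h ℚ.* (c ℚ.* b)    ≡⟨ undo b ⟩
  b                  ∎
  where
  open ℚ.≤-Reasoning
  undo : ∀ x → h ℚ.* (c ℚ.* x) ≡ x
  undo x = trans (sym (ℚ.*-assoc h c x)) (trans (cong (ℚ._* x) hc≡1) (ℚ.*-identityˡ x))

square-nonNegℚ : ∀ p → 0ℚ ℚ.≤ p ℚ.* p
square-nonNegℚ p with ℚ.≤-total 0ℚ p
... | inj₁ 0≤p = *-nonNeg 0≤p 0≤p
... | inj₂ p≤0 = ℚ.≤-trans (*-nonNeg (ℚ.neg-antimono-≤ p≤0) (ℚ.neg-antimono-≤ p≤0))
  (eq≤ (solve 1 (λ p → (:- p) :* (:- p) := p :* p) refl p))

-- Natural numbers and powers of two as rationals

nat-+ : ∀ m n → nat (m ℕ.+ n) ≡ nat m ℚ.+ nat n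
nat-+ zero    n = sym (ℚ.+-identityˡ (nat n))
nat-+ (suc m) n = trans (nat-suc (m ℕ.+ n)) (trans (cong (1ℚ ℚ.+_) (nat-+ m n))
  (trans (sym (ℚ.+-assoc 1ℚ (nat m) (nat n))) (cong (ℚ._+ nat n) (sym (nat-suc m)))))

nat-nonNeg : ∀ n → 0ℚ ℚ.≤ nat n
nat-nonNeg n = nat-mono {0} {n} ℕ.z≤n

nat-* : ∀ m n → nat (m ℕ.* n) ≡ nat m ℚ.* nat n
nat-* zero    n = sym (ℚ.*-zeroˡ (nat n))
nat-* (suc m) n = begin
  nat (n ℕ.+ m ℕ.* n)            ≡⟨ nat-+ n (m ℕ.* n) ⟩
  nat n ℚ.+ nat (m ℕ.* n)        ≡⟨ cong (nat n ℚ.+_) (nat-* m n) ⟩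
  nat n ℚ.+ nat m ℚ.* nat n      ≡⟨ solve 2 (λ m n → n :+ m :* n := (con 1ℚ :+ m) :* n) refl (nat m) (nat n) ⟩
  (1ℚ ℚ.+ nat m) ℚ.* nat n       ≡⟨ cong (ℚ._* nat n) (nat-suc m) ⟨
  nat (suc m) ℚ.* nat n          ∎
  where open ≡-Reasoning

½^*2^ : ∀ r → ½ ^ℚ r ℚ.* nat (2 ℕ.^ r) ≡ 1ℚ
½^*2^ zero    = refl
½^*2^ (suc r) = begin
  ½ ℚ.* ½ ^ℚ r ℚ.* nat (2 ℕ.* 2 ℕ.^ r)            ≡⟨ cong (½ ℚ.* ½ ^ℚ r ℚ.*_) (nat-* 2 (2 ℕ.^ r)) ⟩
  ½ ℚ.* ½ ^ℚ r ℚ.* (nat 2 ℚ.* nat (2 ℕ.^ r))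
    ≡⟨ solve 2 (λ h p → con ½ :* h :* (con (nat 2) :* p) := h :* p) refl (½ ^ℚ r) (nat (2 ℕ.^ r)) ⟩
  ½ ^ℚ r ℚ.* nat (2 ℕ.^ r)                        ≡⟨ ½^*2^ r ⟩
  1ℚ                                              ∎
  where open ≡-Reasoning

½^-nonNeg : ∀ r → 0ℚ ℚ.≤ ½ ^ℚ r
½^-nonNeg = ^-nonNeg 0≤½

½^≤1 : ∀ k → ½ ^ℚ k ℚ.≤ 1ℚ
½^≤1 k = ^-anti 0≤½ ½≤1 {0} {k} ℕ.z≤n

bernoulli : ∀ x m → 0ℚ ℚ.≤ 1ℚ ℚ.+ x → 1ℚ ℚ.+ nat m ℚ.* x ℚ.≤ (1ℚ ℚ.+ x) ^ℚ m
bernoulli x zero    0≤1+x = eq≤ (trans (cong (1ℚ ℚ.+_) (ℚ.*-zeroˡ x)) (ℚ.+-identityʳ 1ℚ))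
bernoulli x (suc m) 0≤1+x = begin
  1ℚ ℚ.+ nat (suc m) ℚ.* x
    ≤⟨ ≤-by (nat m ℚ.* (x ℚ.* x)) (trans
         (solve 2 (λ m x → (con 1ℚ :+ x) :* (con 1ℚ :+ m :* x) :=
              con 1ℚ :+ (con 1ℚ :+ m) :* x :+ m :* (x :* x)) refl (nat m) x)
         (cong (λ z → 1ℚ ℚ.+ z ℚ.* x ℚ.+ nat m ℚ.* (x ℚ.* x)) (sym (nat-suc m))))
         (*-nonNeg (nat-nonNeg m) (square-nonNegℚ x)) ⟩
  (1ℚ ℚ.+ x) ℚ.* (1ℚ ℚ.+ nat m ℚ.* x)
    ≤⟨ ℚ.*-monoˡ-≤-nonNeg (1ℚ ℚ.+ x) {{ℚ.nonNegative 0≤1+x}} (bernoulli x m 0≤1+x) ⟩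
  (1ℚ ℚ.+ x) ^ℚ suc m ∎
  where open ℚ.≤-Reasoning

-- (1 - 1/M)^M ≤ 1/2, since (1 - x)(1 + x) ≤ 1 and (1 + 1/M)^M ≥ 2.
decay≤½ : ∀ M x → 0ℚ ℚ.≤ x → x ℚ.≤ 1ℚ → nat M ℚ.* x ≡ 1ℚ → (1ℚ ℚ.- x) ^ℚ M ℚ.≤ ½
decay≤½ M x 0≤x x≤1 Mx≡1 = cancel-≤ ½ (1ℚ ℚ.+ 1ℚ) _ ½ 0≤½ refl (begin
  (1ℚ ℚ.+ 1ℚ) ℚ.* c
    ≤⟨ ℚ.*-monoʳ-≤-nonNeg c {{ℚ.nonNegative (^-nonNeg (p≤q⇒0≤q-p x≤1) M)}}
         (ℚ.≤-trans (eq≤ (cong (1ℚ ℚ.+_) (sym Mx≡1))) (bernoulli x M (+-nonNeg 0≤1 0≤x))) ⟩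
  (1ℚ ℚ.+ x) ^ℚ M ℚ.* c
    ≡⟨ ^-distrib-* (1ℚ ℚ.+ x) (1ℚ ℚ.- x) M ⟨
  ((1ℚ ℚ.+ x) ℚ.* (1ℚ ℚ.- x)) ^ℚ M
    ≤⟨ ^-anti (*-nonNeg (+-nonNeg 0≤1 0≤x) (p≤q⇒0≤q-p x≤1))
         (≤-by (x ℚ.* x) (solve 1 (λ x → con 1ℚ :=
              (con 1ℚ :+ x) :* (con 1ℚ :- x) :+ x :* x) refl x) (*-nonNeg 0≤x 0≤x))
         {0} {M} ℕ.z≤n ⟩
  1ℚ ∎)
  where
  open ℚ.≤-Reasoning
  c = (1ℚ ℚ.- x) ^ℚ M

power-decay : ∀ {c M} → 0ℚ ℚ.≤ c → c ^ℚ M ℚ.≤ ½ → ∀ j → c ^ℚ (j ℕ.* M) ℚ.≤ ½ ^ℚ j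
power-decay 0≤c c^M≤½ zero    = ℚ.≤-refl
power-decay {c} {M} 0≤c c^M≤½ (suc j) = ℚ.≤-trans (eq≤ (^-homo-* c M (j ℕ.* M)))
  (*-mono 0≤½ (^-nonNeg 0≤c (j ℕ.* M)) c^M≤½ (power-decay {c} {M} 0≤c c^M≤½ j))

n<2^n : ∀ n → suc n ℕ.≤ 2 ℕ.^ n
n<2^n zero    = ℕ.≤-refl
n<2^n (suc n) = ℕ.≤-trans (ℕ.s≤s (n<2^n n)) (ℕ.+-mono-≤ (ℕ.m^n>0 2 n) (ℕ.m≤m+n (2 ℕ.^ n) 0))

unit≥½^ : ∀ m e → suc m ℕ.≤ 2 ℕ.^ e → ½ ^ℚ e ℚ.≤ unit m
unit≥½^ m e m<2^e = begin
  ½ ^ℚ e                                        ≡⟨ ℚ.*-identityʳ (½ ^ℚ e) ⟨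
  ½ ^ℚ e ℚ.* 1ℚ                                 ≡⟨ cong (½ ^ℚ e ℚ.*_) (unit*nat-suc m) ⟨
  ½ ^ℚ e ℚ.* (unit m ℚ.* nat (suc m))           ≤⟨ ℚ.*-monoˡ-≤-nonNeg (½ ^ℚ e) {{ℚ.nonNegative (½^-nonNeg e)}}
                                                     (ℚ.*-monoˡ-≤-nonNeg (unit m) {{ℚ.nonNegative (ℚ.<⇒≤ (unit>0 m))}}
                                                       (nat-mono m<2^e)) ⟩
  ½ ^ℚ e ℚ.* (unit m ℚ.* nat (2 ℕ.^ e))
    ≡⟨ solve 3 (λ u h n → h :* (u :* n) := u :* (h :* n)) refl (unit m) (½ ^ℚ e) (nat (2 ℕ.^ e)) ⟩
  unit m ℚ.* (½ ^ℚ e ℚ.* nat (2 ℕ.^ e))         ≡⟨ cong (unit m ℚ.*_) (½^*2^ e) ⟩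
  unit m ℚ.* 1ℚ                                 ≡⟨ ℚ.*-identityʳ (unit m) ⟩
  unit m                                        ∎
  where open ℚ.≤-Reasoning

-- The least exponent of a power of 1/2 that is at most q; unless it is 0, the
-- preceding power is at least q.
least-exponent : ∀ q → 0ℚ ℚ.< q → ∃ λ k → ½ ^ℚ k ℚ.≤ q × (k ≡ 0 ⊎ q ℚ.≤ (1ℚ ℚ.+ 1ℚ) ℚ.* ½ ^ℚ k)
least-exponent q 0<q with unit≤ q 0<q
... | N , unit≤q = search N (ℚ.≤-trans (unit≥½^ N N (n<2^n N)) unit≤q)
  where
  search : ∀ N → ½ ^ℚ N ℚ.≤ q → ∃ λ k → ½ ^ℚ k ℚ.≤ q × (k ≡ 0 ⊎ q ℚ.≤ (1ℚ ℚ.+ 1ℚ) ℚ.* ½ ^ℚ k)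
  search zero    small = 0 , small , inj₁ refl
  search (suc N) small with ½ ^ℚ N ℚ.≤? q
  ... | yes smaller = search N smaller
  ... | no  larger  = suc N , small , inj₂ (ℚ.≤-trans (ℚ.<⇒≤ (ℚ.≰⇒> larger))
          (eq≤ (solve 1 (λ h → h := (con 1ℚ :+ con 1ℚ) :* (con ½ :* h)) refl (½ ^ℚ N))))

-- Order and equality of reals

infix 4 _≈_ _≼_

-- The relations ≃ and ≤ unfold to function types, from which their two sides
-- cannot be recovered; wrapping them in records makes both sides inferable.
record _≈_ (x y : ℝ) : Set where
  constructor ≃⇒≈
  field ≈⇒≃ : x ≃ y

record _≼_ (x y : ℝ) : Set where
  constructor ≤⇒≼
  field ≼⇒≤ : x ≤ y

open _≈_
open _≼_

-- P holds from some index on.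
Eventually : (ℕ → Set) → Set
Eventually P = ∃ λ N → ∀ n → N ℕ.≤ n → P n

always : ∀ {P} → (∀ n → P n) → Eventually P
always p = 0 , λ n _ → p n

eventually-map : ∀ {P Q : ℕ → Set} → (∀ n → P n → Q n) → Eventually P → Eventually Q
eventually-map f (N , p) = N , λ n N≤n → f n (p n N≤n)

eventually-map₂ : ∀ {P Q R : ℕ → Set} → (∀ n → P n → Q n → R n) →
  Eventually P → Eventually Q → Eventually R
eventually-map₂ f (M , p) (N , q) = M ℕ.⊔ N , λ n ≤n → f n (p n (⊔ˡ ≤n)) (q n (⊔ʳ {M} ≤n))

eventually-× : ∀ {P Q : ℕ → Set} → Eventually P → Eventually Q → Eventually (λ n → P n × Q n)
eventually-× = eventually-map₂ (λ _ → _,_)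

p≤p+e : ∀ {p e} → 0ℚ ℚ.≤ e → p ℚ.≤ p ℚ.+ e
p≤p+e {p} {e} 0≤e = ≤-by e refl 0≤e

pointwise : ∀ {x y} → (∀ n → seq x n ≡ seq y n) → x ≈ y
pointwise {x} {y} eq = ≃⇒≈ λ e 0<e → always λ n → ℚ.≤-trans
  (eq≤ (cong ℚ.∣_∣ (trans (cong (ℚ._- seq y n) (eq n)) (ℚ.+-inverseʳ (seq y n)))))
  (ℚ.<⇒≤ 0<e)

pointwise-≼ : ∀ {x y} → Eventually (λ n → seq x n ℚ.≤ seq y n) → x ≼ y
pointwise-≼ x≤y = ≤⇒≼ λ e 0<e →
  eventually-map (λ _ p → ℚ.≤-trans p (p≤p+e (ℚ.<⇒≤ 0<e))) x≤y

≈⇒≼ : ∀ {x y} → x ≈ y → x ≼ y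
≈⇒≼ {x} {y} (≃⇒≈ x≃y) = ≤⇒≼ λ e 0<e → eventually-map (λ n p → step (seq x n) (seq y n)
  (ℚ.≤-trans (p≤∣p∣ _) p)) (x≃y e 0<e)
  where
  step : ∀ p q {e} → p ℚ.- q ℚ.≤ e → p ℚ.≤ q ℚ.+ e
  step p q p-q≤e = ℚ.≤-trans (eq≤ (solve 2 (λ p q → p := q :+ (p :- q)) refl p q))
    (ℚ.+-monoʳ-≤ q p-q≤e)

≼-antisym : ∀ {x y} → x ≼ y → y ≼ x → x ≈ y
≼-antisym {x} {y} (≤⇒≼ x≤y) (≤⇒≼ y≤x) = ≃⇒≈ λ e 0<e → eventually-map₂ (λ n p q →
  ∣∣-lub (step (seq x n) (seq y n) p)
    (ℚ.≤-trans (eq≤ (solve 2 (λ p q → :- (p :- q) := q :- p) refl (seq x n) (seq y n)))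
      (step (seq y n) (seq x n) q)))
  (x≤y e 0<e) (y≤x e 0<e)
  where
  step : ∀ p q {e} → p ℚ.≤ q ℚ.+ e → p ℚ.- q ℚ.≤ e
  step p q {e} p≤q+e = ℚ.≤-trans (ℚ.+-monoˡ-≤ (ℚ.- q) p≤q+e)
    (eq≤ (solve 2 (λ q e → (q :+ e) :- q := e) refl q e))

≼-trans : ∀ {x y z} → x ≼ y → y ≼ z → x ≼ z
≼-trans {x} {y} {z} (≤⇒≼ x≤y) (≤⇒≼ y≤z) = ≤⇒≼ λ e 0<e → eventually-map₂ (λ n p q → begin
  seq x n                                  ≤⟨ p ⟩
  seq y n ℚ.+ ½ ℚ.* e                      ≤⟨ ℚ.+-monoˡ-≤ (½ ℚ.* e) q ⟩
  (seq z n ℚ.+ ½ ℚ.* e) ℚ.+ ½ ℚ.* e        ≡⟨ ℚ.+-assoc (seq z n) (½ ℚ.* e) (½ ℚ.* e) ⟩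
  seq z n ℚ.+ (½ ℚ.* e ℚ.+ ½ ℚ.* e)        ≡⟨ cong (seq z n ℚ.+_) (halves e) ⟩
  seq z n ℚ.+ e                            ∎)
  (x≤y (½ ℚ.* e) (half-pos 0<e)) (y≤z (½ ℚ.* e) (half-pos 0<e))
  where open ℚ.≤-Reasoning

≼-refl : ∀ {x} → x ≼ x
≼-refl {x} = pointwise-≼ (always λ n → ℚ.≤-refl)

+-mono-≼ : ∀ {x y u v} → x ≼ y → u ≼ v → x + u ≼ y + v
+-mono-≼ {x} {y} {u} {v} (≤⇒≼ x≤y) (≤⇒≼ u≤v) = ≤⇒≼ λ e 0<e → eventually-map₂ (λ n p q → begin
  seq x n ℚ.+ seq u n
    ≤⟨ ℚ.+-mono-≤ p q ⟩
  (seq y n ℚ.+ ½ ℚ.* e) ℚ.+ (seq v n ℚ.+ ½ ℚ.* e)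
    ≡⟨ solve 3 (λ a b c → (a :+ c) :+ (b :+ c) := (a :+ b) :+ (c :+ c)) refl
         (seq y n) (seq v n) (½ ℚ.* e) ⟩
  (seq y n ℚ.+ seq v n) ℚ.+ (½ ℚ.* e ℚ.+ ½ ℚ.* e)
    ≡⟨ cong ((seq y n ℚ.+ seq v n) ℚ.+_) (halves e) ⟩
  (seq y n ℚ.+ seq v n) ℚ.+ e ∎)
  (x≤y (½ ℚ.* e) (half-pos 0<e)) (u≤v (½ ℚ.* e) (half-pos 0<e))
  where open ℚ.≤-Reasoning

neg-anti-≼ : ∀ {x y} → x ≼ y → - y ≼ - x
neg-anti-≼ {x} {y} (≤⇒≼ x≤y) = ≤⇒≼ λ e 0<e → eventually-map (λ n p → begin
  ℚ.- seq y n                          ≡⟨ solve 2 (λ y e → :- y := :- (y :+ e) :+ e) refl (seq y n) e ⟩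
  ℚ.- (seq y n ℚ.+ e) ℚ.+ e            ≤⟨ ℚ.+-monoˡ-≤ e (ℚ.neg-antimono-≤ p) ⟩
  ℚ.- seq x n ℚ.+ e                    ∎) (x≤y e 0<e)
  where open ℚ.≤-Reasoning

-- If u and v are at least -d with d ≤ 1, then uv ≥ -d (|u| + |v| + 1), so d is
-- taken small compared with the bounds of the two sequences.
*-nonNeg-≼ : ∀ {x y} → 0ℝ ≼ x → 0ℝ ≼ y → 0ℝ ≼ x * y
*-nonNeg-≼ {x} {y} (≤⇒≼ 0≤x) (≤⇒≼ 0≤y) = ≤⇒≼ λ e 0<e → from-bounds (bounded x) (bounded y) e 0<e
  where
  open ℚ.≤-Reasoning
  estimate : ∀ p q d e {A B} → 0ℚ ℚ.≤ d → d ℚ.≤ 1ℚ → ((A ℚ.+ B) ℚ.+ 1ℚ) ℚ.* d ℚ.≤ e →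
    0ℚ ℚ.≤ p ℚ.+ d → 0ℚ ℚ.≤ q ℚ.+ d → p ℚ.≤ A → q ℚ.≤ B → 0ℚ ℚ.≤ p ℚ.* q ℚ.+ e
  estimate p q d e {A} {B} 0≤d d≤1 small 0≤p+d 0≤q+d p≤A q≤B = begin
    0ℚ
      ≤⟨ *-nonNeg 0≤p+d 0≤q+d ⟩
    (p ℚ.+ d) ℚ.* (q ℚ.+ d)
      ≡⟨ solve 3 (λ p q d → (p :+ d) :* (q :+ d) := p :* q :+ ((p :+ q) :+ d) :* d) refl p q d ⟩
    p ℚ.* q ℚ.+ ((p ℚ.+ q) ℚ.+ d) ℚ.* d
      ≤⟨ ℚ.+-monoʳ-≤ (p ℚ.* q) (ℚ.*-monoʳ-≤-nonNeg d {{ℚ.nonNegative 0≤d}}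
           (ℚ.+-mono-≤ (ℚ.+-mono-≤ p≤A q≤B) d≤1)) ⟩
    p ℚ.* q ℚ.+ ((A ℚ.+ B) ℚ.+ 1ℚ) ℚ.* d
      ≤⟨ ℚ.+-monoʳ-≤ (p ℚ.* q) small ⟩
    p ℚ.* q ℚ.+ e ∎
  from-bounds : Bounded (seq x) → Bounded (seq y) → 0ℝ ≤ x * y
  from-bounds (A , 0<A , bx) (B , 0<B , by) e 0<e = eventually-map₂ (λ n p q →
      estimate (seq x n) (seq y n) d e {A} {B} (ℚ.<⇒≤ 0<d) (ℚ.p⊓q≤q (inv C 0<C ℚ.* e) 1ℚ) small
        (proj₂ p) (proj₂ q) (ℚ.≤-trans (p≤∣p∣ _) (proj₁ p)) (ℚ.≤-trans (p≤∣p∣ _) (proj₁ q)))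
    (eventually-× bx (0≤x d 0<d)) (eventually-× by (0≤y d 0<d))
    where
    C = (A ℚ.+ B) ℚ.+ 1ℚ
    0<C : 0ℚ ℚ.< C
    0<C = ℚ.+-mono-< (ℚ.+-mono-< 0<A 0<B) 0<1
    d = (inv C 0<C ℚ.* e) ℚ.⊓ 1ℚ
    0<d : 0ℚ ℚ.< d
    0<d with ℚ.⊓-sel (inv C 0<C ℚ.* e) 1ℚ
    ... | inj₁ eq = subst (0ℚ ℚ.<_) (sym eq) (*-pos (inv-pos 0<C) 0<e)
    ... | inj₂ eq = subst (0ℚ ℚ.<_) (sym eq) 0<1
    small : C ℚ.* d ℚ.≤ e
    small = begin
      C ℚ.* d
        ≤⟨ ℚ.*-monoˡ-≤-nonNeg C {{ℚ.nonNegative (ℚ.<⇒≤ 0<C)}} (ℚ.p⊓q≤p (inv C 0<C ℚ.* e) 1ℚ) ⟩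
      C ℚ.* (inv C 0<C ℚ.* e)   ≡⟨ solve 3 (λ a b c → a :* (b :* c) := (b :* a) :* c) refl C (inv C 0<C) e ⟩
      (inv C 0<C ℚ.* C) ℚ.* e   ≡⟨ cong (ℚ._* e) (inv-*ˡ 0<C) ⟩
      1ℚ ℚ.* e                  ≡⟨ ℚ.*-identityˡ e ⟩
      e                         ∎

-- The negation of a strict inequality is an inequality: take terms of x and y
-- beyond which both sequences vary by at most d = e/8. If the term of y exceeds
-- that of x by at most 3d then y ≤ x + e, and otherwise x < y.
≮⇒≽ : ∀ {x y} → ¬ (x < y) → y ≼ x
≮⇒≽ {x} {y} x≮y = ≤⇒≼ compare
  where
  open ℚ.≤-Reasoning
  transfer : ∀ a b p q c d → ℚ.∣ p ℚ.- a ∣ ℚ.≤ d → ℚ.∣ b ℚ.- q ∣ ℚ.≤ d → a ℚ.≤ b ℚ.+ c →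
    p ℚ.≤ q ℚ.+ (c ℚ.+ (d ℚ.+ d))
  transfer a b p q c d pa bq a≤b+c = begin
    p
      ≡⟨ solve 2 (λ p a → p := a :+ (p :- a)) refl p a ⟩
    a ℚ.+ (p ℚ.- a)
      ≤⟨ ℚ.+-mono-≤ a≤b+c (ℚ.≤-trans (p≤∣p∣ (p ℚ.- a)) pa) ⟩
    (b ℚ.+ c) ℚ.+ d
      ≡⟨ solve 4 (λ b q c d → (b :+ c) :+ d := (q :+ (b :- q)) :+ (c :+ d)) refl b q c d ⟩
    (q ℚ.+ (b ℚ.- q)) ℚ.+ (c ℚ.+ d)
      ≤⟨ ℚ.+-monoˡ-≤ (c ℚ.+ d) (ℚ.+-monoʳ-≤ q (ℚ.≤-trans (p≤∣p∣ (b ℚ.- q)) bq)) ⟩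
    (q ℚ.+ d) ℚ.+ (c ℚ.+ d)
      ≡⟨ solve 3 (λ q c d → (q :+ d) :+ (c :+ d) := q :+ (c :+ (d :+ d))) refl q c d ⟩
    q ℚ.+ (c ℚ.+ (d ℚ.+ d)) ∎
  compare : y ≤ x
  compare e 0<e = result (cauchy x d 0<d) (cauchy y d 0<d)
    where
    d = ½ ℚ.* (½ ℚ.* (½ ℚ.* e))
    0<d : 0ℚ ℚ.< d
    0<d = half-pos (half-pos (half-pos 0<e))
    c = d ℚ.+ d ℚ.+ d
    5d≤e : c ℚ.+ (d ℚ.+ d) ℚ.≤ e
    5d≤e = ≤-by c (solve 1 (λ e → let d = con ½ :* (con ½ :* (con ½ :* e)) in
      e := ((d :+ d :+ d) :+ (d :+ d)) :+ (d :+ d :+ d)) refl e)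
      (ℚ.<⇒≤ (ℚ.+-mono-< (ℚ.+-mono-< 0<d 0<d) 0<d))
    subtract : ∀ a b → a ℚ.+ c ℚ.≤ b → a ℚ.≤ b ℚ.+ ℚ.- c
    subtract a b h = ℚ.≤-trans (eq≤ (solve 2 (λ a c → a := a :+ c :+ :- c) refl a c))
      (ℚ.+-monoˡ-≤ (ℚ.- c) h)
    gap : ∀ a b → a ℚ.≤ b ℚ.+ (ℚ.- c ℚ.+ (d ℚ.+ d)) → a ℚ.+ d ℚ.≤ b
    gap a b h = ℚ.≤-trans (ℚ.+-monoˡ-≤ d h) (eq≤ (solve 2 (λ b d →
      b :+ (:- (d :+ d :+ d) :+ (d :+ d)) :+ d := b) refl b d))
    Stable : (ℕ → ℚ) → Set
    Stable s = ∃ λ N → ∀ m n → N ℕ.≤ m → N ℕ.≤ n → ℚ.∣ s m ℚ.- s n ∣ ℚ.≤ d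
    result : Stable (seq x) → Stable (seq y) → Eventually (λ n → seq y n ℚ.≤ seq x n ℚ.+ e)
    result (M , p) (N , q) = decide (b ℚ.≤? a ℚ.+ c)
      where
      a = seq x (M ℕ.⊔ N)
      b = seq y (M ℕ.⊔ N)
      decide : Dec (b ℚ.≤ a ℚ.+ c) → Eventually (λ n → seq y n ℚ.≤ seq x n ℚ.+ e)
      decide (yes near) = M ℕ.⊔ N , λ n ≤n → ℚ.≤-trans
          (transfer b a (seq y n) (seq x n) c d (q n (M ℕ.⊔ N) (⊔ʳ {M} ≤n) (ℕ.m≤n⊔m M N))
                    (p (M ℕ.⊔ N) n (ℕ.m≤m⊔n M N) (⊔ˡ ≤n)) near)
          (ℚ.+-monoʳ-≤ (seq x n) 5d≤e)
      decide (no far) = contradiction (d , 0<d , M ℕ.⊔ N , λ n ≤n → gap (seq x n) (seq y n)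
          (transfer a b (seq x n) (seq y n) (ℚ.- c) d (p n (M ℕ.⊔ N) (⊔ˡ ≤n) (ℕ.m≤m⊔n M N))
                    (q (M ℕ.⊔ N) n (ℕ.m≤n⊔m M N) (⊔ʳ {M} ≤n))
                    (subtract a b (ℚ.<⇒≤ (ℚ.≰⇒> far))))) x≮y

≤⇒≯ : ∀ {x y} → x ≼ y → ¬ (y < x)
≤⇒≯ {x} {y} (≤⇒≼ x≤y) (e , 0<e , N , gap) =
  ℚ.<-irrefl refl (ℚ.<-≤-trans (half-lt e 0<e) (squeeze (x≤y (½ ℚ.* e) (half-pos 0<e))))
  where
  half-lt : ∀ e → 0ℚ ℚ.< e → ½ ℚ.* e ℚ.< e
  half-lt e 0<e = ℚ.<-≤-trans (ℚ.≤-<-trans (eq≤ (sym (ℚ.+-identityʳ (½ ℚ.* e))))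
    (ℚ.+-monoʳ-< (½ ℚ.* e) (half-pos 0<e))) (eq≤ (halves e))
  squeeze : Eventually (λ n → seq x n ℚ.≤ seq y n ℚ.+ ½ ℚ.* e) → e ℚ.≤ ½ ℚ.* e
  squeeze (M , close) = cancel (seq y (M ℕ.⊔ N)) e (½ ℚ.* e)
    (ℚ.≤-trans (gap (M ℕ.⊔ N) (ℕ.m≤n⊔m M N)) (close (M ℕ.⊔ N) (ℕ.m≤m⊔n M N)))
    where
    cancel : ∀ p a b → p ℚ.+ a ℚ.≤ p ℚ.+ b → a ℚ.≤ b
    cancel p a b h = ℚ.≤-trans (eq≤ (undo p a))
      (ℚ.≤-trans (ℚ.+-monoʳ-≤ (ℚ.- p) h) (eq≤ (sym (undo p b))))
      where
      undo : ∀ p a → a ≡ ℚ.- p ℚ.+ (p ℚ.+ a)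
      undo = solve 2 (λ p a → a := :- p :+ (p :+ a)) refl

-- Whether x is positive cannot be decided, but an inequality that follows from
-- each of the two alternatives holds, being the negation of a strict inequality.
by-sign : ∀ x {a b} → (0ℝ < x → a ≼ b) → (x ≼ 0ℝ → a ≼ b) → a ≼ b
by-sign x pos neg = ≮⇒≽ λ b<a → ≤⇒≯ (neg (≮⇒≽ λ 0<x → ≤⇒≯ (pos 0<x) b<a)) b<a

-- The reals as a commutative ring

≈-refl : ∀ {x} → x ≈ x
≈-refl = pointwise λ _ → refl

≈-sym : ∀ {x y} → x ≈ y → y ≈ x
≈-sym {x} {y} (≃⇒≈ x≃y) = ≃⇒≈ λ e 0<e →
  eventually-map (λ n p → ℚ.≤-trans (eq≤ (∣-∣-sym (seq y n) (seq x n))) p) (x≃y e 0<e)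

≈-trans : ∀ {x y z} → x ≈ y → y ≈ z → x ≈ z
≈-trans x≈y y≈z = ≼-antisym (≼-trans (≈⇒≼ x≈y) (≈⇒≼ y≈z))
  (≼-trans (≈⇒≼ (≈-sym y≈z)) (≈⇒≼ (≈-sym x≈y)))

+-cong : ∀ {x y u v} → x ≈ y → u ≈ v → x + u ≈ y + v
+-cong x≈y u≈v = ≼-antisym (+-mono-≼ (≈⇒≼ x≈y) (≈⇒≼ u≈v))
  (+-mono-≼ (≈⇒≼ (≈-sym x≈y)) (≈⇒≼ (≈-sym u≈v)))

neg-cong : ∀ {x y} → x ≈ y → - x ≈ - y
neg-cong x≈y = ≼-antisym (neg-anti-≼ (≈⇒≼ (≈-sym x≈y))) (neg-anti-≼ (≈⇒≼ x≈y))

*-cong : ∀ {x y u v} → x ≈ y → u ≈ v → x * u ≈ y * v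
*-cong {x} {y} {u} {v} (≃⇒≈ x≃y) (≃⇒≈ u≃v) = from-bounds (bounded x) (bounded v)
  where
  from-bounds : Bounded (seq x) → Bounded (seq v) → x * u ≈ y * v
  from-bounds (A , 0<A , bx) (B , 0<B , bv) = ≃⇒≈ λ e 0<e →
    let d   = inv C 0<C ℚ.* e
        0<d = *-pos (inv-pos 0<C) 0<e
    in eventually-map₂ (λ n p q → ℚ.≤-trans
         (product-estimate (seq x n) (seq u n) (seq y n) (seq v n) 0<A 0<B
           (proj₁ p) (proj₁ q) (proj₂ p) (proj₂ q))
         (eq≤ (cancel e)))
       (eventually-× bx (x≃y d 0<d)) (eventually-× bv (u≃v d 0<d))
    where
    C = A ℚ.+ B
    0<C : 0ℚ ℚ.< C
    0<C = ℚ.+-mono-< 0<A 0<B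
    cancel : ∀ e → C ℚ.* (inv C 0<C ℚ.* e) ≡ e
    cancel e = trans (solve 3 (λ a b c → a :* (b :* c) := (b :* a) :* c) refl C (inv C 0<C) e)
      (trans (cong (ℚ._* e) (inv-*ˡ 0<C)) (ℚ.*-identityˡ e))

+-*-isCommutativeRing : IsCommutativeRing _≈_ _+_ _*_ -_ 0ℝ 1ℝ
+-*-isCommutativeRing = record
  { isRing = record
    { +-isAbelianGroup = record
      { isGroup = record
        { isMonoid = record
          { isSemigroup = record
            { isMagma = record
              { isEquivalence = record { refl = ≈-refl ; sym = ≈-sym ; trans = ≈-trans }
              ; ∙-cong = +-cong }
            ; assoc = λ x y z → pointwise λ n → ℚ.+-assoc (seq x n) (seq y n) (seq z n) }
          ; identity = (λ x → pointwise λ n → ℚ.+-identityˡ (seq x n))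
                     , (λ x → pointwise λ n → ℚ.+-identityʳ (seq x n)) }
        ; inverse = (λ x → pointwise λ n → ℚ.+-inverseˡ (seq x n))
                  , (λ x → pointwise λ n → ℚ.+-inverseʳ (seq x n))
        ; ⁻¹-cong = neg-cong }
      ; comm = λ x y → pointwise λ n → ℚ.+-comm (seq x n) (seq y n) }
    ; *-cong = *-cong
    ; *-assoc = λ x y z → pointwise λ n → ℚ.*-assoc (seq x n) (seq y n) (seq z n)
    ; *-identity = (λ x → pointwise λ n → ℚ.*-identityˡ (seq x n))
                 , (λ x → pointwise λ n → ℚ.*-identityʳ (seq x n))
    ; distrib = (λ x y z → pointwise λ n → ℚ.*-distribˡ-+ (seq x n) (seq y n) (seq z n))
              , (λ x y z → pointwise λ n → ℚ.*-distribʳ-+ (seq x n) (seq y n) (seq z n)) }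
  ; *-comm = λ x y → pointwise λ n → ℚ.*-comm (seq x n) (seq y n) }

ℝ-commutativeRing : CommutativeRing 0ℓ 0ℓ
ℝ-commutativeRing = record { isCommutativeRing = +-*-isCommutativeRing }

ℝ-poset : Poset 0ℓ 0ℓ 0ℓ
ℝ-poset = record
  { _≤_ = _≼_
  ; isPartialOrder = record
    { isPreorder = record
      { isEquivalence = CommutativeRing.isEquivalence ℝ-commutativeRing
      ; reflexive = ≈⇒≼
      ; trans = ≼-trans }
    ; antisym = ≼-antisym } }

+-nonNeg-≼ : ∀ {x y} → 0ℝ ≼ x → 0ℝ ≼ y → 0ℝ ≼ x + y
+-nonNeg-≼ 0≤x 0≤y = ≼-trans (≈⇒≼ (pointwise λ _ → refl)) (+-mono-≼ 0≤x 0≤y)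

fromℚ-mono : ∀ {p q} → p ℚ.≤ q → fromℚ p ≼ fromℚ q
fromℚ-mono p≤q = pointwise-≼ (always λ _ → p≤q)

-- x ≼ y, given a nonnegative expression for the difference.
≼-by : ∀ {x y} d → y ≈ x + d → 0ℝ ≼ d → x ≼ y
≼-by {x} d eq 0≤d = ≼-trans (≈⇒≼ (pointwise λ n → sym (ℚ.+-identityʳ (seq x n))))
  (≼-trans (+-mono-≼ ≼-refl 0≤d) (≈⇒≼ (≈-sym eq)))

*-monoʳ-≼ : ∀ {x y} z → 0ℝ ≼ z → x ≼ y → z * x ≼ z * y
*-monoʳ-≼ {x} {y} z 0≤z x≤y = ≼-by (z * (y - x))
  (pointwise λ n → solve 3 (λ x y z → z :* y := z :* x :+ z :* (y :- x)) refl (seq x n) (seq y n) (seq z n))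
  (*-nonNeg-≼ 0≤z (≼-trans (≈⇒≼ (pointwise λ n → sym (ℚ.+-inverseʳ (seq x n)))) (+-mono-≼ x≤y ≼-refl)))

square-nonNeg : ∀ x → 0ℝ ≼ x * x
square-nonNeg x = pointwise-≼ (always λ n → square-nonNegℚ (seq x n))

∣∣-lub-≼ : ∀ {x y} → x ≼ y → - x ≼ y → ∣ x ∣ ≼ y
∣∣-lub-≼ (≤⇒≼ x≤y) (≤⇒≼ -x≤y) = ≤⇒≼ λ e 0<e →
  eventually-map₂ (λ n → ∣∣-lub) (x≤y e 0<e) (-x≤y e 0<e)

-- x ⁻¹ is defined with a positive rational lower bound for x, which the terms of
-- x respect from some index on.
inverse-eventually : ∀ x → Eventually (λ n → seq (value (x ⁻¹)) n ℚ.* seq (value x) n ≡ 1ℚ)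
inverse-eventually (mkℝ⁺ x (e , 0<e , e≤x)) = eventually-map
  (λ n p → inv-clamp-* 0<e (seq x n) (ℚ.≤-trans (eq≤ (sym (ℚ.+-identityˡ e))) p)) e≤x

inverse-≈ : ∀ x → value (x ⁻¹) * value x ≈ 1ℝ
inverse-≈ x = ≼-antisym
  (pointwise-≼ (eventually-map (λ _ → eq≤) (inverse-eventually x)))
  (pointwise-≼ (eventually-map (λ _ p → eq≤ (sym p)) (inverse-eventually x)))

open CommutativeRing ℝ-commutativeRing using (semiring)
open SemiringSum semiring using (sum-cong-≋; ∑-distrib-+; *-distribˡ-sum)
module ≼-Reasoning = PartialOrderReasoning ℝ-poset

-- Finite sums

sum-mono : ∀ {n} {f g : Fin n → ℝ} → (∀ i → f i ≼ g i) → sum f ≼ sum g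
sum-mono {zero}  f≤g = ≼-refl
sum-mono {suc n} f≤g = +-mono-≼ (f≤g zero) (sum-mono (f≤g ∘ suc))

sum-nonNeg : ∀ {n} {f : Fin n → ℝ} → (∀ i → 0ℝ ≼ f i) → 0ℝ ≼ sum f
sum-nonNeg {zero}  0≤f = ≼-refl
sum-nonNeg {suc n} 0≤f = +-nonNeg-≼ (0≤f zero) (sum-nonNeg (0≤f ∘ suc))

sum-const : ∀ n c → sum {n} (λ _ → c) ≈ fromℕ n * c
sum-const zero    c = pointwise λ k → sym (ℚ.*-zeroˡ (seq c k))
sum-const (suc n) c = ≈-trans (+-cong ≈-refl (sum-const n c)) (pointwise λ k →
  trans (solve 2 (λ a b → a :+ b :* a := (con 1ℚ :+ b) :* a) refl (seq c k) (nat n))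
    (cong (ℚ._* seq c k) (sym (nat-suc n))))

sum-neg : ∀ {n} (f : Fin n → ℝ) → sum (λ i → - f i) ≈ - sum f
sum-neg {zero}  f = pointwise λ _ → refl
sum-neg {suc n} f = ≈-trans (+-cong ≈-refl (sum-neg (f ∘ suc)))
  (pointwise λ k → sym (ℚ.neg-distrib-+ (seq (f zero) k) (seq (sum (f ∘ suc)) k)))

∣sum∣≼ : ∀ {n} (f : Fin n → ℝ) → ∣ sum f ∣ ≼ sum (λ i → ∣ f i ∣)
∣sum∣≼ f = ∣∣-lub-≼ (sum-mono λ i → pointwise-≼ (always λ k → p≤∣p∣ (seq (f i) k)))
  (≼-trans (≈⇒≼ (≈-sym (sum-neg f))) (sum-mono λ i → pointwise-≼ (always λ k → -p≤∣p∣ (seq (f i) k))))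

-- x if k = i, and zero otherwise.
indicator : ∀ {n} → Fin n → Fin n → ℝ → ℝ
indicator i k x = if does (k Fin.≟ i) then x else 0ℝ

sum-indicator : ∀ {n} (i : Fin n) (f : Fin n → ℝ) → sum (λ k → indicator i k (f k)) ≈ f i
sum-indicator {suc n} zero f = ≈-trans (+-cong ≈-refl (sum-zero n))
  (pointwise λ k → ℚ.+-identityʳ (seq (f zero) k))
  where
  sum-zero : ∀ n → sum {n} (λ _ → 0ℝ) ≈ 0ℝ
  sum-zero n = ≈-trans (sum-const n 0ℝ) (pointwise λ _ → ℚ.*-zeroʳ (nat n))
sum-indicator (suc i) f = ≈-trans (pointwise λ k → ℚ.+-identityˡ _) (sum-indicator i (f ∘ suc))

sum-split : ∀ m n (f : Fin (m ℕ.+ n) → ℝ) →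
  sum f ≈ sum (λ i → f (i ↑ˡ n)) + sum (λ i → f (m ↑ʳ i))
sum-split zero    n f = pointwise λ k → sym (ℚ.+-identityˡ _)
sum-split (suc m) n f = ≈-trans (+-cong ≈-refl (sum-split m n (f ∘ suc)))
  (pointwise λ k → sym (ℚ.+-assoc (seq (f zero) k)
    (seq (sum (λ i → f (suc i ↑ˡ n))) k) (seq (sum (λ i → f (suc m ↑ʳ i))) k)))

-- Means

-- The properties of an expectation used below.
record IsMean {X : Set} (E : (X → ℝ) → ℝ) : Set where
  field
    mono   : ∀ {f g} → (∀ x → f x ≼ g x) → E f ≼ E g
    +-homo : ∀ f g → E (λ x → f x + g x) ≈ E f + E g
    *-homo : ∀ c f → E (λ x → c * f x) ≈ c * E f
    one    : E (λ _ → 1ℝ) ≈ 1ℝ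

  cong-≈ : ∀ {f g} → (∀ x → f x ≈ g x) → E f ≈ E g
  cong-≈ f≈g = ≼-antisym (mono λ x → ≈⇒≼ (f≈g x)) (mono λ x → ≈⇒≼ (≈-sym (f≈g x)))

  constant : ∀ c → E (λ _ → c) ≈ c
  constant c = begin-equality
    E (λ _ → c)         ≈⟨ cong-≈ (λ _ → pointwise λ k → ℚ.*-identityʳ (seq c k)) ⟨
    E (λ _ → c * 1ℝ)    ≈⟨ *-homo c (λ _ → 1ℝ) ⟩
    c * E (λ _ → 1ℝ)    ≈⟨ *-cong ≈-refl one ⟩
    c * 1ℝ              ≈⟨ pointwise (λ k → ℚ.*-identityʳ (seq c k)) ⟩
    c                   ∎
    where open ≼-Reasoning

  affine : ∀ a b f → E (λ x → a + b * f x) ≈ a + b * E f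
  affine a b f = ≈-trans (+-homo (λ _ → a) (λ x → b * f x)) (+-cong (constant a) (*-homo b f))

open IsMean

-- The mean of f under μ.
expectation : ∀ {n} → Distribution n → (Fin n → ℝ) → ℝ
expectation μ f = sum λ i → prob μ i * f i

expectation-isMean : ∀ {n} (μ : Distribution n) → IsMean (expectation μ)
expectation-isMean μ = record
  { mono   = λ f≤g → sum-mono λ i → *-monoʳ-≼ (prob μ i) (≤⇒≼ (nonNeg μ i)) (f≤g i)
  ; +-homo = λ f g → ≈-trans
      (sum-cong-≋ λ i → pointwise λ k → ℚ.*-distribˡ-+ (seq (prob μ i) k) (seq (f i) k) (seq (g i) k))
      (∑-distrib-+ (λ i → prob μ i * f i) (λ i → prob μ i * g i))
  ; *-homo = λ c f → ≈-trans
      (sum-cong-≋ λ i → pointwise λ k → solve 3 (λ p c x → p :* (c :* x) := c :* (p :* x)) refl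
        (seq (prob μ i) k) (seq c k) (seq (f i) k))
      (≈-sym (*-distribˡ-sum c (λ i → prob μ i * f i)))
  ; one    = ≈-trans (sum-cong-≋ λ i → pointwise λ k → ℚ.*-identityʳ (seq (prob μ i) k))
      (≃⇒≈ (total μ)) }

coinAverage-isMean : ∀ r → IsMean (coinAverage r)
coinAverage-isMean zero = record
  { mono = λ f≤g → f≤g [] ; +-homo = λ f g → ≈-refl ; *-homo = λ c f → ≈-refl ; one = ≈-refl }
coinAverage-isMean (suc r) = record
  { mono   = λ f≤g → *-monoʳ-≼ (fromℚ ½) (fromℚ-mono 0≤½)
      (+-mono-≼ (mono IH λ ω → f≤g (true ∷ ω)) (mono IH λ ω → f≤g (false ∷ ω)))
  ; +-homo = λ f g → ≈-trans
      (*-cong ≈-refl (+-cong (+-homo IH (λ ω → f (true ∷ ω)) (λ ω → g (true ∷ ω)))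
                             (+-homo IH (λ ω → f (false ∷ ω)) (λ ω → g (false ∷ ω)))))
      (interchange (fromℚ ½) (coinAverage r (λ ω → f (true ∷ ω))) (coinAverage r (λ ω → g (true ∷ ω)))
                       (coinAverage r (λ ω → f (false ∷ ω))) (coinAverage r (λ ω → g (false ∷ ω))))
  ; *-homo = λ c f → ≈-trans
      (*-cong ≈-refl (+-cong (*-homo IH c (λ ω → f (true ∷ ω))) (*-homo IH c (λ ω → f (false ∷ ω)))))
      (factor (fromℚ ½) c (coinAverage r (λ ω → f (true ∷ ω))) (coinAverage r (λ ω → f (false ∷ ω))))
  ; one    = ≈-trans (*-cong ≈-refl (+-cong (one IH) (one IH))) (pointwise λ _ → refl) }
  where
  IH = coinAverage-isMean r
  interchange : ∀ h a b c d → h * ((a + b) + (c + d)) ≈ h * (a + c) + h * (b + d)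
  interchange h a b c d = pointwise λ k → solve 5 (λ h a b c d →
    h :* ((a :+ b) :+ (c :+ d)) := h :* (a :+ c) :+ h :* (b :+ d)) refl
    (seq h k) (seq a k) (seq b k) (seq c k) (seq d k)
  factor : ∀ h c a b → h * (c * a + c * b) ≈ c * (h * (a + b))
  factor h c a b = pointwise λ k → solve 4 (λ h c a b →
    h :* (c :* a :+ c :* b) := c :* (h :* (a :+ b))) refl (seq h k) (seq c k) (seq a k) (seq b k)

-- Two successive random choices.
bind-isMean : ∀ {X Y Z} {E : (X → ℝ) → ℝ} {F : X → (Y → ℝ) → ℝ} (h : X → Y → Z) →
  IsMean E → (∀ x → IsMean (F x)) → IsMean (λ g → E (λ x → F x (λ y → g (h x y))))
bind-isMean {F = F} h E-mean F-mean = record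
  { mono   = λ f≤g → mono E-mean λ x → mono (F-mean x) λ y → f≤g (h x y)
  ; +-homo = λ f g → ≈-trans
      (cong-≈ E-mean λ x → +-homo (F-mean x) (λ y → f (h x y)) (λ y → g (h x y)))
      (+-homo E-mean (λ x → F x (λ y → f (h x y))) (λ x → F x (λ y → g (h x y))))
  ; *-homo = λ c f → ≈-trans
      (cong-≈ E-mean λ x → *-homo (F-mean x) c (λ y → f (h x y)))
      (*-homo E-mean c (λ x → F x (λ y → f (h x y))))
  ; one    = ≈-trans (cong-≈ E-mean λ x → one (F-mean x)) (one E-mean) }

-- The average over coins commutes with every mean.
coinAverage-swap : ∀ r {X} {E : (X → ℝ) → ℝ} → IsMean E → (g : X → Vec Bool r → ℝ) →
  coinAverage r (λ ω → E (λ x → g x ω)) ≈ E (λ x → coinAverage r (g x))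
coinAverage-swap zero    E-mean g = ≈-refl
coinAverage-swap (suc r) {E = E} E-mean g = begin-equality
  fromℚ ½ * (coinAverage r (λ ω → E (λ x → g x (true ∷ ω))) + coinAverage r (λ ω → E (λ x → g x (false ∷ ω))))
    ≈⟨ *-cong ≈-refl (+-cong (coinAverage-swap r E-mean λ x ω → g x (true ∷ ω))
                             (coinAverage-swap r E-mean λ x ω → g x (false ∷ ω))) ⟩
  fromℚ ½ * (E (λ x → coinAverage r (λ ω → g x (true ∷ ω))) + E (λ x → coinAverage r (λ ω → g x (false ∷ ω))))
    ≈⟨ *-cong ≈-refl (+-homo E-mean (λ x → coinAverage r (λ ω → g x (true ∷ ω)))
                                    (λ x → coinAverage r (λ ω → g x (false ∷ ω)))) ⟨
  fromℚ ½ * E (λ x → coinAverage r (λ ω → g x (true ∷ ω)) + coinAverage r (λ ω → g x (false ∷ ω)))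
    ≈⟨ *-homo E-mean (fromℚ ½)
         (λ x → coinAverage r (λ ω → g x (true ∷ ω)) + coinAverage r (λ ω → g x (false ∷ ω))) ⟨
  E (λ x → coinAverage (suc r) (g x)) ∎
  where open ≼-Reasoning

-- The first r coins and the remaining m coins as separate arguments.
splitCoins : ∀ {A : Set} r {m} → (Vec Bool r → Vec Bool m → A) → Vec Bool (r ℕ.+ m) → A
splitCoins zero    f ω       = f [] ω
splitCoins (suc r) f (b ∷ ω) = splitCoins r (λ ω₁ → f (b ∷ ω₁)) ω

coinAverage-split : ∀ {A : Set} r {m} (f : Vec Bool r → Vec Bool m → A) (g : A → ℝ) →
  coinAverage (r ℕ.+ m) (λ ω → g (splitCoins r f ω)) ≡
  coinAverage r (λ ω₁ → coinAverage m (λ ω₂ → g (f ω₁ ω₂)))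
coinAverage-split zero    f g = refl
coinAverage-split (suc r) f g = cong₂ (λ a b → fromℚ ½ * (a + b))
  (coinAverage-split r (λ ω₁ → f (true ∷ ω₁)) g) (coinAverage-split r (λ ω₁ → f (false ∷ ω₁)) g)

-- The betting tester

-- The result of one round, in which a sample i is compared with an opponent j by
-- querying {i , j}: won if i is returned, void if i = j, and lost otherwise.
data Outcome : Set where
  won lost void : Outcome

score : Outcome → ℚ
score won  = 1ℚ
score lost = ℚ.- 1ℚ
score void = 0ℚ

outcome : ∀ {n} → Fin n → Fin n → Fin n → Outcome
outcome i j x = if does (i Fin.≟ j) then void else if does (x Fin.≟ i) then won else lost

pair : ∀ {n} → Fin n → Fin n → Subset n
pair i j = ⁅ i ⁆ ∪ ⁅ j ⁆

pair-nonempty : ∀ {n} (i j : Fin n) → Nonempty (pair i j)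
pair-nonempty i j = i , p⊆p∪q ⁅ j ⁆ (x∈⁅x⁆ i)

-- 2η², the rate at which the bound for the inverse wealth decreases.
twiceSquare : ℚ → ℚ
twiceSquare η = η ℚ.* η ℚ.+ η ℚ.* η

twiceSquare-nonNeg : ∀ {η} → 0ℚ ℚ.≤ η → 0ℚ ℚ.≤ twiceSquare η
twiceSquare-nonNeg 0≤η = +-nonNeg (*-nonNeg 0≤η 0≤η) (*-nonNeg 0≤η 0≤η)

twiceSquare≤1 : ∀ {η} → 0ℚ ℚ.≤ η → η ℚ.≤ ½ → twiceSquare η ℚ.≤ 1ℚ
twiceSquare≤1 {η} 0≤η η≤½ = ℚ.≤-trans (ℚ.+-mono-≤ η²≤½½ η²≤½½) ½≤1
  where
  η²≤½½ : η ℚ.* η ℚ.≤ ½ ℚ.* ½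
  η²≤½½ = *-mono {η} {½} {η} {½} 0≤½ 0≤η η≤½ η≤½

-- The factor by which the wealth changes when the fraction η of it is staked on
-- winning the round.
payoff : ℚ → Outcome → ℚ
payoff η o = 1ℚ ℚ.+ η ℚ.* score o

-- An upper bound for the inverse of the payoff when η ≤ 1/2, linear in the score.
inversePayoff : ℚ → Outcome → ℚ
inversePayoff η o = (1ℚ ℚ.- η ℚ.* score o) ℚ.+ twiceSquare η

module _ {η : ℚ} (0≤η : 0ℚ ℚ.≤ η) (η≤½ : η ℚ.≤ ½) where

  private
    η≤1 : η ℚ.≤ 1ℚ
    η≤1 = ℚ.≤-trans η≤½ ½≤1
    0≤1-2η : 0ℚ ℚ.≤ 1ℚ ℚ.- (η ℚ.+ η)
    0≤1-2η = p≤q⇒0≤q-p (ℚ.+-mono-≤ η≤½ η≤½)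

  payoff-nonNeg : ∀ o → 0ℚ ℚ.≤ payoff η o
  payoff-nonNeg won  = ≤-by (1ℚ ℚ.+ η) (solve 1 (λ η → con 1ℚ :+ η :* con 1ℚ :=
       con 0ℚ :+ (con 1ℚ :+ η)) refl η)
    (+-nonNeg 0≤1 0≤η)
  payoff-nonNeg lost = ≤-by (1ℚ ℚ.- η) (solve 1 (λ η → con 1ℚ :+ η :* (:- con 1ℚ) :=
       con 0ℚ :+ (con 1ℚ :- η)) refl η)
    (p≤q⇒0≤q-p η≤1)
  payoff-nonNeg void = ≤-by 1ℚ (solve 1 (λ η → con 1ℚ :+ η :* con 0ℚ := con 0ℚ :+ con 1ℚ) refl η) 0≤1

  inversePayoff-nonNeg : ∀ o → 0ℚ ℚ.≤ inversePayoff η o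
  inversePayoff-nonNeg o = +-nonNeg (unsquared o) (twiceSquare-nonNeg 0≤η)
    where
    unsquared : ∀ o → 0ℚ ℚ.≤ 1ℚ ℚ.- η ℚ.* score o
    unsquared won  = ≤-by (1ℚ ℚ.- η) (solve 1 (λ η → con 1ℚ :- η :* con 1ℚ := con 0ℚ :+ (con 1ℚ :- η)) refl η)
      (p≤q⇒0≤q-p η≤1)
    unsquared lost = ≤-by (1ℚ ℚ.+ η) (solve 1 (λ η → con 1ℚ :- η :* (:- con 1ℚ) :=
         con 0ℚ :+ (con 1ℚ :+ η)) refl η)
      (+-nonNeg 0≤1 0≤η)
    unsquared void = ≤-by 1ℚ (solve 1 (λ η → con 1ℚ :- η :* con 0ℚ := con 0ℚ :+ con 1ℚ) refl η) 0≤1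

  1≤payoff*inversePayoff : ∀ o → 1ℚ ℚ.≤ payoff η o ℚ.* inversePayoff η o
  1≤payoff*inversePayoff won = ≤-by (η² ℚ.* (1ℚ ℚ.+ (η ℚ.+ η))) (solve 1 (λ η →
    (con 1ℚ :+ η :* con 1ℚ) :* ((con 1ℚ :- η :* con 1ℚ) :+ (η :* η :+ η :* η)) :=
    con 1ℚ :+ η :* η :* (con 1ℚ :+ (η :+ η))) refl η)
    (*-nonNeg (*-nonNeg 0≤η 0≤η) (+-nonNeg 0≤1 (+-nonNeg 0≤η 0≤η)))
    where η² = η ℚ.* η
  1≤payoff*inversePayoff lost = ≤-by (η² ℚ.* (1ℚ ℚ.- (η ℚ.+ η))) (solve 1 (λ η →
    (con 1ℚ :+ η :* (:- con 1ℚ)) :* ((con 1ℚ :- η :* (:- con 1ℚ)) :+ (η :* η :+ η :* η)) :=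
    con 1ℚ :+ η :* η :* (con 1ℚ :- (η :+ η))) refl η)
    (*-nonNeg (*-nonNeg 0≤η 0≤η) 0≤1-2η)
    where η² = η ℚ.* η
  1≤payoff*inversePayoff void = ≤-by (η² ℚ.+ η²) (solve 1 (λ η →
    (con 1ℚ :+ η :* con 0ℚ) :* ((con 1ℚ :- η :* con 0ℚ) :+ (η :* η :+ η :* η)) :=
    con 1ℚ :+ (η :* η :+ η :* η)) refl η)
    (+-nonNeg (*-nonNeg 0≤η 0≤η) (*-nonNeg 0≤η 0≤η))
    where η² = η ℚ.* η

-- r coins determine, for every sample i, the opponent with which it is compared.
module Betting {n r : ℕ} (⊤≠∅ : Nonempty (⊤ {n})) (opponent : Vec Bool r → Fin n → Fin n) (η : ℚ) where

  -- One round, followed by the strategy chosen for its outcome.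
  round : ∀ {t} → Vec Bool r → (Outcome → Strategy n t) → Strategy n (2 ℕ.+ t)
  round ω next = query ⊤ ⊤≠∅ λ i →
    query (pair i (opponent ω i)) (pair-nonempty i (opponent ω i)) λ x →
    next (outcome i (opponent ω i) x)

  -- K rounds starting with wealth w; accept if the final wealth is less than 1.
  betting : ∀ K → ℚ → Vec Bool (K ℕ.* r) → Strategy n (K ℕ.* 2)
  betting zero    w _ = verdict (does (w ℚ.<? 1ℚ))
  betting (suc K) w = splitCoins r λ ω₁ ω₂ →
    round ω₁ λ o → betting K (w ℚ.* payoff η o) ω₂

  module _ {μ : Distribution n} (O : ConditionalOracle μ) where

    -- The mean over the two answers in a round with coins ω.
    roundGiven : Vec Bool r → (Outcome → ℝ) → ℝ
    roundGiven ω g = expectation (answer O ⊤ ⊤≠∅) λ i →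
      expectation (answer O (pair i (opponent ω i)) (pair-nonempty i (opponent ω i))) λ x →
      g (outcome i (opponent ω i) x)

    -- The mean over coins and answers.
    roundMean : (Outcome → ℝ) → ℝ
    roundMean g = coinAverage r λ ω → roundGiven ω g

    roundGiven-isMean : ∀ ω → IsMean (roundGiven ω)
    roundGiven-isMean ω = bind-isMean (λ i x → outcome i (opponent ω i) x)
      (expectation-isMean (answer O ⊤ ⊤≠∅))
      (λ i → expectation-isMean (answer O (pair i (opponent ω i)) (pair-nonempty i (opponent ω i))))

    roundMean-isMean : IsMean roundMean
    roundMean-isMean = bind-isMean (λ _ o → o) (coinAverage-isMean r) roundGiven-isMean

    meanScore : ℝ
    meanScore = roundMean λ o → fromℚ (score o)

    -- The probability of the verdict b after K rounds starting with wealth w.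
    bettingPr : ℕ → ℚ → Bool → ℝ
    bettingPr K w b = coinAverage (K ℕ.* r) λ ω → strategyPr O (betting K w ω) b

    bettingPr-suc : ∀ K w b →
      bettingPr (suc K) w b ≈ roundMean λ o → bettingPr K (w ℚ.* payoff η o) b
    bettingPr-suc K w b = begin-equality
      bettingPr (suc K) w b
        ≡⟨ coinAverage-split r (λ ω₁ ω₂ → round ω₁ λ o → betting K (w ℚ.* payoff η o) ω₂)
             (λ S → strategyPr O S b) ⟩
      coinAverage r (λ ω₁ → coinAverage (K ℕ.* r) λ ω₂ →
        roundGiven ω₁ λ o → strategyPr O (betting K (w ℚ.* payoff η o) ω₂) b)
        ≈⟨ cong-≈ (coinAverage-isMean r) (λ ω₁ → coinAverage-swap (K ℕ.* r) (roundGiven-isMean ω₁)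
             λ o ω₂ → strategyPr O (betting K (w ℚ.* payoff η o) ω₂) b) ⟩
      roundMean (λ o → bettingPr K (w ℚ.* payoff η o) b) ∎
      where open ≼-Reasoning

    module _ (0≤η : 0ℚ ℚ.≤ η) (η≤½ : η ℚ.≤ ½) where

      -- If the mean score is not positive then the wealth is a supermartingale, so
      -- by Markov's inequality it ends at 1 or more with probability at most its
      -- initial value.
      accept-fair : meanScore ≼ 0ℝ → ∀ K w → 0ℚ ℚ.≤ w → fromℚ (1ℚ ℚ.- w) ≼ bettingPr K w true
      accept-fair fair zero w 0≤w = final (w ℚ.<? 1ℚ)
        where
        final : (w<1? : Dec (w ℚ.< 1ℚ)) → fromℚ (1ℚ ℚ.- w) ≼ strategyPr O (verdict (does w<1?)) true
        final (yes w<1) = fromℚ-mono (≤-by w (solve 1 (λ w → con 1ℚ := (con 1ℚ :- w) :+ w) refl w) 0≤w)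
        final (no  w≮1) = fromℚ-mono (≤-by (w ℚ.- 1ℚ) (solve 1 (λ w → con 0ℚ :=
             (con 1ℚ :- w) :+ (w :- con 1ℚ)) refl w)
          (p≤q⇒0≤q-p (ℚ.≮⇒≥ w≮1)))
      accept-fair fair (suc K) w 0≤w = begin
        fromℚ (1ℚ ℚ.- w)
          ≤⟨ ≼-by (fromℚ (w ℚ.* η) * (- meanScore))
               ≈-refl
               (*-nonNeg-≼ (fromℚ-mono (*-nonNeg 0≤w 0≤η)) (≼-trans (≈⇒≼ (pointwise λ _ → refl))
                    (neg-anti-≼ fair))) ⟩
        fromℚ (1ℚ ℚ.- w) + fromℚ (w ℚ.* η) * (- meanScore)
          ≈⟨ pointwise (λ k → solve 3 (λ w η s →
               (con 1ℚ :- w) :+ w :* η :* (:- s) := (con 1ℚ :- w) :+ (:- (w :* η)) :* s) refl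
               w η (seq meanScore k)) ⟩
        fromℚ (1ℚ ℚ.- w) + fromℚ (ℚ.- (w ℚ.* η)) * meanScore
          ≈⟨ affine roundMean-isMean (fromℚ (1ℚ ℚ.- w)) (fromℚ (ℚ.- (w ℚ.* η))) (λ o → fromℚ (score o)) ⟨
        roundMean linear
          ≈⟨ cong-≈ roundMean-isMean {linear} {bound} (λ o → pointwise λ k → solve 3 (λ w η s →
               (con 1ℚ :- w) :+ (:- (w :* η)) :* s := con 1ℚ :- w :* (con 1ℚ :+ η :* s)) refl
               w η (score o)) ⟩
        roundMean bound
          ≤⟨ mono roundMean-isMean {bound} {λ o → bettingPr K (w ℚ.* payoff η o) true} (λ o →
               accept-fair fair K (w ℚ.* payoff η o) (*-nonNeg 0≤w (payoff-nonNeg 0≤η η≤½ o))) ⟩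
        roundMean (λ o → bettingPr K (w ℚ.* payoff η o) true)
          ≈⟨ bettingPr-suc K w true ⟨
        bettingPr (suc K) w true ∎
        where
        open ≼-Reasoning
        linear bound : Outcome → ℝ
        linear o = fromℚ (1ℚ ℚ.- w) + fromℚ (ℚ.- (w ℚ.* η)) * fromℚ (score o)
        bound o = fromℚ (1ℚ ℚ.- w ℚ.* payoff η o)

      -- In a game with mean score at least 4η an upper bound V for the inverse
      -- wealth shrinks in the mean by the factor 1 - 2η² each round; the tester
      -- accepts only if the final wealth is below 1, so that V exceeds 1.
      reject-biased : fromℚ (η ℚ.+ η ℚ.+ (η ℚ.+ η)) ≼ meanScore → ∀ K w V → 0ℚ ℚ.≤ V → 1ℚ ℚ.≤ w ℚ.* V →
        fromℚ (1ℚ ℚ.- (1ℚ ℚ.- twiceSquare η) ^ℚ K ℚ.* V) ≼ bettingPr K w false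
      reject-biased biased zero w V 0≤V 1≤wV = final (w ℚ.<? 1ℚ)
        where
        final : (w<1? : Dec (w ℚ.< 1ℚ)) → fromℚ (1ℚ ℚ.- 1ℚ ℚ.* V) ≼ strategyPr O (verdict (does w<1?)) false
        final (yes w<1) = fromℚ-mono (≤-by (1ℚ ℚ.* V ℚ.- 1ℚ)
          (solve 1 (λ V → con 0ℚ := (con 1ℚ :- con 1ℚ :* V) :+ (con 1ℚ :* V :- con 1ℚ)) refl V)
          (p≤q⇒0≤q-p (ℚ.≤-trans 1≤wV (ℚ.*-monoʳ-≤-nonNeg V {{ℚ.nonNegative 0≤V}} (ℚ.<⇒≤ w<1)))))
        final (no  w≮1) = fromℚ-mono (≤-by V (solve 1 (λ V → con 1ℚ :=
             (con 1ℚ :- con 1ℚ :* V) :+ V) refl V) 0≤V)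
      reject-biased biased (suc K) w V 0≤V 1≤wV = begin
        fromℚ (1ℚ ℚ.- (1ℚ ℚ.- twiceSquare η) ℚ.* c ℚ.* V)
          ≤⟨ ≼-by (fromℚ (c ℚ.* V ℚ.* η) * (meanScore - fromℚ (η ℚ.+ η ℚ.+ (η ℚ.+ η))))
               (pointwise (λ k → solve 4 (λ c V η s →
                 (con 1ℚ :- c :* V :* (con 1ℚ :+ (η :* η :+ η :* η))) :+ c :* V :* η :* s :=
                 (con 1ℚ :- (con 1ℚ :- (η :* η :+ η :* η)) :* c :* V) :+
                   c :* V :* η :* (s :- (η :+ η :+ (η :+ η)))) refl c V η (seq meanScore k)))
               (*-nonNeg-≼ (fromℚ-mono (*-nonNeg 0≤cV 0≤η))
                 (≼-trans (≈⇒≼ (pointwise λ k → sym (ℚ.+-inverseʳ (η ℚ.+ η ℚ.+ (η ℚ.+ η)))))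
                   (+-mono-≼ biased ≼-refl))) ⟩
        fromℚ (1ℚ ℚ.- c ℚ.* V ℚ.* (1ℚ ℚ.+ twiceSquare η)) + fromℚ (c ℚ.* V ℚ.* η) * meanScore
          ≈⟨ affine roundMean-isMean (fromℚ (1ℚ ℚ.- c ℚ.* V ℚ.* (1ℚ ℚ.+ twiceSquare η)))
               (fromℚ (c ℚ.* V ℚ.* η)) (λ o → fromℚ (score o)) ⟨
        roundMean linear
          ≈⟨ cong-≈ roundMean-isMean {linear} {bound} (λ o → pointwise λ k → solve 4 (λ c V η s →
               (con 1ℚ :- c :* V :* (con 1ℚ :+ (η :* η :+ η :* η))) :+ c :* V :* η :* s :=
               con 1ℚ :- c :* (V :* ((con 1ℚ :- η :* s) :+ (η :* η :+ η :* η)))) refl c V η (score o)) ⟩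
        roundMean bound
          ≤⟨ mono roundMean-isMean {bound} {λ o → bettingPr K (w ℚ.* payoff η o) false}
               (λ o → reject-biased biased K (w ℚ.* payoff η o) (V ℚ.* inversePayoff η o)
               (*-nonNeg 0≤V (inversePayoff-nonNeg 0≤η η≤½ o)) (invariant o)) ⟩
        roundMean (λ o → bettingPr K (w ℚ.* payoff η o) false)
          ≈⟨ bettingPr-suc K w false ⟨
        bettingPr (suc K) w false ∎
        where
        open ≼-Reasoning
        c = (1ℚ ℚ.- twiceSquare η) ^ℚ K
        linear bound : Outcome → ℝ
        linear o = fromℚ (1ℚ ℚ.- c ℚ.* V ℚ.* (1ℚ ℚ.+ twiceSquare η)) + fromℚ (c ℚ.* V ℚ.* η) * fromℚ (score o)
        bound o = fromℚ (1ℚ ℚ.- c ℚ.* (V ℚ.* inversePayoff η o))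
        0≤cV : 0ℚ ℚ.≤ c ℚ.* V
        0≤cV = *-nonNeg (^-nonNeg (p≤q⇒0≤q-p (twiceSquare≤1 0≤η η≤½)) K) 0≤V
        invariant : ∀ o → 1ℚ ℚ.≤ (w ℚ.* payoff η o) ℚ.* (V ℚ.* inversePayoff η o)
        invariant o = ℚ.≤-trans
          (*-mono (ℚ.≤-trans 0≤1 1≤wV) 0≤1 1≤wV (1≤payoff*inversePayoff 0≤η η≤½ o))
          (eq≤ (solve 4 (λ w V f g → w :* V :* (f :* g) := (w :* f) :* (V :* g)) refl
            w V (payoff η o) (inversePayoff η o)))

-- Conditional probabilities

by-sign-≈ : ∀ x {a b} → (0ℝ < x → a ≈ b) → (x ≼ 0ℝ → a ≈ b) → a ≈ b
by-sign-≈ x pos neg = ≼-antisym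
  (by-sign x (λ 0<x → ≈⇒≼ (pos 0<x)) (λ x≤0 → ≈⇒≼ (neg x≤0)))
  (by-sign x (λ 0<x → ≈⇒≼ (≈-sym (pos 0<x))) (λ x≤0 → ≈⇒≼ (≈-sym (neg x≤0))))

module _ {n} (μ : Distribution n) where

  prob≼mass : ∀ A i → i ∈ A → prob μ i ≼ mass μ A
  prob≼mass A i i∈A = ≼-trans (≈⇒≼ (≈-sym (sum-indicator i (prob μ)))) (sum-mono term)
    where
    term : ∀ k → indicator i k (prob μ k) ≼ (if does (k ∈? A) then prob μ k else 0ℝ)
    term k with k Fin.≟ i | k ∈? A
    ... | yes _    | yes _   = ≼-refl
    ... | yes refl | no  k∉A = contradiction i∈A k∉A
    ... | no  _    | yes _   = ≤⇒≼ (nonNeg μ k)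
    ... | no  _    | no  _   = ≼-refl

  mass-pair : ∀ i j → i ≢ j → mass μ (pair i j) ≈ prob μ i + prob μ j
  mass-pair i j i≢j = begin-equality
    mass μ (pair i j)
      ≈⟨ sum-cong-≋ term ⟩
    sum (λ k → indicator i k (prob μ k) + indicator j k (prob μ k))
      ≈⟨ ∑-distrib-+ (λ k → indicator i k (prob μ k)) (λ k → indicator j k (prob μ k)) ⟩
    sum (λ k → indicator i k (prob μ k)) + sum (λ k → indicator j k (prob μ k))
      ≈⟨ +-cong (sum-indicator i (prob μ)) (sum-indicator j (prob μ)) ⟩
    prob μ i + prob μ j ∎
    where
    open ≼-Reasoning
    term : ∀ k → (if does (k ∈? pair i j) then prob μ k else 0ℝ) ≈
      indicator i k (prob μ k) + indicator j k (prob μ k)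
    term k with k Fin.≟ i | k Fin.≟ j | k ∈? pair i j
    ... | yes refl | yes k≡j  | _       = contradiction k≡j i≢j
    ... | yes refl | no  _    | yes _   = pointwise λ m → sym (ℚ.+-identityʳ (seq (prob μ k) m))
    ... | yes refl | no  _    | no  k∉A = contradiction (p⊆p∪q ⁅ j ⁆ (x∈⁅x⁆ i)) k∉A
    ... | no  _    | yes refl | yes _   = pointwise λ m → sym (ℚ.+-identityˡ (seq (prob μ k) m))
    ... | no  _    | yes refl | no  k∉A = contradiction (q⊆p∪q ⁅ i ⁆ ⁅ j ⁆ (x∈⁅x⁆ j)) k∉A
    ... | no  k≢i  | no  k≢j  | no  _   = pointwise λ _ → refl
    ... | no  k≢i  | no  k≢j  | yes k∈A with x∈p∪q⁻ ⁅ i ⁆ ⁅ j ⁆ k∈A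
    ...   | inj₁ k∈i = contradiction (x∈⁅y⁆⇒x≡y i k∈i) k≢i
    ...   | inj₂ k∈j = contradiction (x∈⁅y⁆⇒x≡y j k∈j) k≢j

  mass-⊤ : mass μ ⊤ ≈ 1ℝ
  mass-⊤ = ≈-trans (sum-cong-≋ term) (≃⇒≈ (total μ))
    where
    term : ∀ k → (if does (k ∈? ⊤) then prob μ k else 0ℝ) ≈ prob μ k
    term k with k ∈? ⊤
    ... | yes _   = ≈-refl
    ... | no  k∉⊤ = contradiction ∈⊤ k∉⊤

  -- If A has mass zero then both sides vanish.
  answer*mass : ∀ (O : ConditionalOracle μ) A A≠∅ i → i ∈ A →
    prob (answer O A A≠∅) i * mass μ A ≈ prob μ i
  answer*mass O A A≠∅ i i∈A = by-sign-≈ (mass μ A) positive-mass null-mass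
    where
    open ≼-Reasoning
    a = prob (answer O A A≠∅) i
    positive-mass : 0ℝ < mass μ A → a * mass μ A ≈ prob μ i
    positive-mass 0<m = begin-equality
      a * mass μ A
        ≈⟨ *-cong (≃⇒≈ (normalised O A A≠∅ i i∈A 0<m)) ≈-refl ⟩
      prob μ i * value (mkℝ⁺ (mass μ A) 0<m ⁻¹) * mass μ A
        ≈⟨ pointwise (λ k → ℚ.*-assoc (seq (prob μ i) k)
             (seq (value (mkℝ⁺ (mass μ A) 0<m ⁻¹)) k) (seq (mass μ A) k)) ⟩
      prob μ i * (value (mkℝ⁺ (mass μ A) 0<m ⁻¹) * mass μ A)
        ≈⟨ *-cong ≈-refl (inverse-≈ (mkℝ⁺ (mass μ A) 0<m)) ⟩
      prob μ i * 1ℝ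
        ≈⟨ pointwise (λ k → ℚ.*-identityʳ (seq (prob μ i) k)) ⟩
      prob μ i ∎
    null-mass : mass μ A ≼ 0ℝ → a * mass μ A ≈ prob μ i
    null-mass m≤0 = begin-equality
      a * mass μ A
        ≈⟨ *-cong ≈-refl (≼-antisym m≤0 (≼-trans (≤⇒≼ (nonNeg μ i)) (prob≼mass A i i∈A))) ⟩
      a * 0ℝ
        ≈⟨ pointwise (λ k → ℚ.*-zeroʳ (seq a k)) ⟩
      0ℝ
        ≈⟨ ≼-antisym (≤⇒≼ (nonNeg μ i)) (≼-trans (prob≼mass A i i∈A) m≤0) ⟩
      prob μ i ∎

  module _ (O : ConditionalOracle μ) where

    answer-⊤ : ∀ ⊤≠∅ i → prob (answer O ⊤ ⊤≠∅) i ≈ prob μ i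
    answer-⊤ ⊤≠∅ i = begin-equality
      a              ≈⟨ pointwise (λ k → sym (ℚ.*-identityʳ (seq a k))) ⟩
      a * 1ℝ         ≈⟨ *-cong ≈-refl mass-⊤ ⟨
      a * mass μ ⊤   ≈⟨ answer*mass O ⊤ ⊤≠∅ i ∈⊤ ⟩
      prob μ i       ∎
      where
      open ≼-Reasoning
      a = prob (answer O ⊤ ⊤≠∅) i

    -- The mean score of a round in which i is compared with j.
    bias : Fin n → Fin n → ℝ
    bias i j = expectation (answer O (pair i j) (pair-nonempty i j)) λ x → fromℚ (score (outcome i j x))

    bias-void : ∀ i → bias i i ≈ 0ℝ
    bias-void i with i Fin.≟ i
    ... | yes _   = constant (expectation-isMean (answer O (pair i i) (pair-nonempty i i))) 0ℝ
    ... | no  i≢i = contradiction refl i≢i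

    bias-distinct : ∀ i j → i ≢ j →
      bias i j ≈ fromℚ (ℚ.- 1ℚ) + fromℚ (1ℚ ℚ.+ 1ℚ) * prob (answer O (pair i j) (pair-nonempty i j)) i
    bias-distinct i j i≢j = begin-equality
      bias i j
        ≈⟨ cong-≈ E-mean {λ x → fromℚ (score (outcome i j x))} score≈ ⟩
      E (λ x → fromℚ (ℚ.- 1ℚ) + fromℚ (1ℚ ℚ.+ 1ℚ) * indicator i x 1ℝ)
        ≈⟨ affine E-mean (fromℚ (ℚ.- 1ℚ)) (fromℚ (1ℚ ℚ.+ 1ℚ)) (λ x → indicator i x 1ℝ) ⟩
      fromℚ (ℚ.- 1ℚ) + fromℚ (1ℚ ℚ.+ 1ℚ) * E (λ x → indicator i x 1ℝ)
        ≈⟨ +-cong ≈-refl (*-cong ≈-refl (≈-trans (sum-cong-≋ term) (sum-indicator i (prob ν)))) ⟩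
      fromℚ (ℚ.- 1ℚ) + fromℚ (1ℚ ℚ.+ 1ℚ) * prob ν i ∎
      where
      open ≼-Reasoning
      ν = answer O (pair i j) (pair-nonempty i j)
      E = expectation ν
      E-mean = expectation-isMean ν
      score≈ : ∀ x → fromℚ (score (outcome i j x)) ≈ fromℚ (ℚ.- 1ℚ) + fromℚ (1ℚ ℚ.+ 1ℚ) * indicator i x 1ℝ
      score≈ x with i Fin.≟ j | x Fin.≟ i
      ... | yes i≡j | _     = contradiction i≡j i≢j
      ... | no  _   | yes _ = pointwise λ _ → refl
      ... | no  _   | no  _ = pointwise λ _ → refl
      term : ∀ x → prob ν x * indicator i x 1ℝ ≈ indicator i x (prob ν x)
      term x with x Fin.≟ i
      ... | yes _ = pointwise λ k → ℚ.*-identityʳ (seq (prob ν x) k)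
      ... | no  _ = pointwise λ k → ℚ.*-zeroʳ (seq (prob ν x) k)

    bias*mass : ∀ i j → (prob μ i + prob μ j) * bias i j ≈ prob μ i - prob μ j
    bias*mass i j = by-cases (i Fin.≟ j)
      where
      open ≼-Reasoning
      a = prob (answer O (pair i j) (pair-nonempty i j)) i
      by-cases : Dec (i ≡ j) → (prob μ i + prob μ j) * bias i j ≈ prob μ i - prob μ j
      by-cases (yes refl) = ≈-trans (*-cong ≈-refl (bias-void i)) (pointwise λ k →
        solve 1 (λ p → (p :+ p) :* con 0ℚ := p :- p) refl (seq (prob μ i) k))
      by-cases (no i≢j) = begin-equality
        (prob μ i + prob μ j) * bias i j
          ≈⟨ *-cong ≈-refl (bias-distinct i j i≢j) ⟩
        (prob μ i + prob μ j) * (fromℚ (ℚ.- 1ℚ) + fromℚ (1ℚ ℚ.+ 1ℚ) * a)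
          ≈⟨ pointwise (λ k → solve 3 (λ p q a →
               (p :+ q) :* (:- con 1ℚ :+ (con 1ℚ :+ con 1ℚ) :* a) :=
                    (con 1ℚ :+ con 1ℚ) :* (a :* (p :+ q)) :- (p :+ q)) refl
               (seq (prob μ i) k) (seq (prob μ j) k) (seq a k)) ⟩
        fromℚ (1ℚ ℚ.+ 1ℚ) * (a * (prob μ i + prob μ j)) - (prob μ i + prob μ j)
          ≈⟨ +-cong (*-cong ≈-refl (≈-trans (*-cong ≈-refl (≈-sym (mass-pair i j i≢j)))
               (answer*mass O (pair i j) (pair-nonempty i j) i (p⊆p∪q ⁅ j ⁆ (x∈⁅x⁆ i))))) ≈-refl ⟩
        fromℚ (1ℚ ℚ.+ 1ℚ) * prob μ i - (prob μ i + prob μ j)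
          ≈⟨ pointwise (λ k → solve 2 (λ p q → (con 1ℚ :+ con 1ℚ) :* p :- (p :+ q) := p :- q) refl
               (seq (prob μ i) k) (seq (prob μ j) k)) ⟩
        prob μ i - prob μ j ∎

    -- With p = μ(i), q = μ(j), m = p + q and D the bias, mD = p - q, so that
    -- pD = (p - q)/2 + mD²/2 and t |mD| ≤ mD²/2 + t²m/2.
    prob*bias : ∀ t → 0ℚ ℚ.≤ t → ∀ i j →
      (fromℚ (½ ℚ.- ½ ℚ.* (t ℚ.* t)) * prob μ i + fromℚ (ℚ.- (½ ℚ.+ ½ ℚ.* (t ℚ.* t))) * prob μ j) +
        fromℚ t * ∣ prob μ i - prob μ j ∣ ≼ prob μ i * bias i j
    prob*bias t 0≤t i j = begin
      (fromℚ (½ ℚ.- ½ ℚ.* (t ℚ.* t)) * p + fromℚ (ℚ.- (½ ℚ.+ ½ ℚ.* (t ℚ.* t))) * q) + fromℚ t * ∣ p - q ∣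
        ≤⟨ +-mono-≼ ≼-refl absolute ⟩
      (fromℚ (½ ℚ.- ½ ℚ.* (t ℚ.* t)) * p + fromℚ (ℚ.- (½ ℚ.+ ½ ℚ.* (t ℚ.* t))) * q) +
        (fromℚ ½ * ((p + q) * D * D) + fromℚ (½ ℚ.* (t ℚ.* t)) * (p + q))
        ≈⟨ pointwise (λ k → solve 4 (λ p q D t →
             ((con ½ :- con ½ :* (t :* t)) :* p :+ (:- (con ½ :+ con ½ :* (t :* t))) :* q) :+
             (con ½ :* ((p :+ q) :* D :* D) :+ con ½ :* (t :* t) :* (p :+ q)) :=
             con ½ :* (p :- q) :+ con ½ :* ((p :+ q) :* D :* D)) refl (seq p k) (seq q k) (seq D k) t) ⟩
      fromℚ ½ * (p - q) + fromℚ ½ * ((p + q) * D * D)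
        ≈⟨ +-cong (*-cong ≈-refl (bias*mass i j)) (*-cong ≈-refl (*-cong (≈-sym (bias*mass i j)) ≈-refl)) ⟨
      fromℚ ½ * ((p + q) * D) + fromℚ ½ * ((p - q) * D)
        ≈⟨ pointwise (λ k → solve 3 (λ p q D →
             con ½ :* ((p :+ q) :* D) :+ con ½ :* ((p :- q) :* D) := p :* D)
                  refl (seq p k) (seq q k) (seq D k)) ⟩
      p * D ∎
      where
      open ≼-Reasoning
      p = prob μ i
      q = prob μ j
      D = bias i j
      R = fromℚ ½ * ((p + q) * D * D) + fromℚ (½ ℚ.* (t ℚ.* t)) * (p + q)
      square : ∀ s → s ℚ.* s ≡ t ℚ.* t → fromℚ s * (p - q) ≼ R
      square s s²≡t² = begin
        fromℚ s * (p - q)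
          ≈⟨ *-cong ≈-refl (bias*mass i j) ⟨
        fromℚ s * ((p + q) * D)
          ≤⟨ ≼-by (fromℚ ½ * ((p + q) * ((D - fromℚ s) * (D - fromℚ s)))) (pointwise λ k →
               trans (cong (λ z → ½ ℚ.* ((seq p k ℚ.+ seq q k) ℚ.* seq D k ℚ.* seq D k) ℚ.+
                 ½ ℚ.* z ℚ.* (seq p k ℚ.+ seq q k)) (sym s²≡t²))
                 (solve 4 (λ p q D s →
                   con ½ :* ((p :+ q) :* D :* D) :+ con ½ :* (s :* s) :* (p :+ q) :=
                   s :* ((p :+ q) :* D) :+ con ½ :* ((p :+ q) :* ((D :- s) :* (D :- s)))) refl
                   (seq p k) (seq q k) (seq D k) s))
               (*-nonNeg-≼ (fromℚ-mono 0≤½) (*-nonNeg-≼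
                 (+-nonNeg-≼ (≤⇒≼ (nonNeg μ i)) (≤⇒≼ (nonNeg μ j)))
                 (square-nonNeg (D - fromℚ s)))) ⟩
        R ∎
      absolute : fromℚ t * ∣ p - q ∣ ≼ R
      absolute = begin
        fromℚ t * ∣ p - q ∣
          ≈⟨ pointwise (λ k → trans (cong (ℚ._* ℚ.∣ seq p k ℚ.- seq q k ∣) (sym (ℚ.0≤p⇒∣p∣≡p 0≤t)))
               (sym (ℚ.∣p*q∣≡∣p∣*∣q∣ t (seq p k ℚ.- seq q k)))) ⟩
        ∣ fromℚ t * (p - q) ∣
          ≤⟨ ∣∣-lub-≼ (square t refl) (≼-trans (≈⇒≼ (pointwise λ k →
               ℚ.neg-distribˡ-* t (seq p k ℚ.- seq q k)))
               (square (ℚ.- t) (solve 1 (λ t → (:- t) :* (:- t) := t :* t) refl t))) ⟩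
        R ∎

-- Drawing a uniform element with fair coins

-- A bijection from the sequences of r coins to the numbers below 2^r: the first coin
-- chooses the lower or the upper half.
decode : ∀ r → Vec Bool r → Fin (2 ℕ.^ r)
decode zero    []          = zero
decode (suc r) (true ∷ ω)  = decode r ω ↑ˡ (2 ℕ.^ r ℕ.+ 0)
decode (suc r) (false ∷ ω) = (2 ℕ.^ r) ↑ʳ (decode r ω ↑ˡ 0)

coinAverage-decode : ∀ r (g : Fin (2 ℕ.^ r) → ℝ) →
  coinAverage r (λ ω → g (decode r ω)) ≈ fromℚ (½ ^ℚ r) * sum g
coinAverage-decode zero    g = pointwise λ k →
  solve 1 (λ x → x := con 1ℚ :* (x :+ con 0ℚ)) refl (seq (g zero) k)
coinAverage-decode (suc r) g = begin-equality
  fromℚ ½ * (coinAverage r (λ ω → g₁ (decode r ω)) + coinAverage r (λ ω → g₂ (decode r ω)))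
    ≈⟨ *-cong ≈-refl (+-cong (coinAverage-decode r g₁) (coinAverage-decode r g₂)) ⟩
  fromℚ ½ * (fromℚ (½ ^ℚ r) * sum g₁ + fromℚ (½ ^ℚ r) * sum g₂)
    ≈⟨ pointwise (λ k → solve 3 (λ h a b →
         con ½ :* (h :* a :+ h :* b) := con ½ :* h :* (a :+ (b :+ con 0ℚ)))
              refl (½ ^ℚ r) (seq (sum g₁) k) (seq (sum g₂) k)) ⟩
  fromℚ (½ ^ℚ suc r) * (sum g₁ + (sum g₂ + 0ℝ))
    ≈⟨ *-cong ≈-refl (+-cong ≈-refl (sum-split (2 ℕ.^ r) 0 (λ s → g ((2 ℕ.^ r) ↑ʳ s)))) ⟨
  fromℚ (½ ^ℚ suc r) * (sum g₁ + sum (λ s → g ((2 ℕ.^ r) ↑ʳ s)))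
    ≈⟨ *-cong ≈-refl (sum-split (2 ℕ.^ r) (2 ℕ.^ r ℕ.+ 0) g) ⟨
  fromℚ (½ ^ℚ suc r) * sum g ∎
  where
  open ≼-Reasoning
  g₁ g₂ : Fin (2 ℕ.^ r) → ℝ
  g₁ s = g (s ↑ˡ (2 ℕ.^ r ℕ.+ 0))
  g₂ s = g ((2 ℕ.^ r) ↑ʳ (s ↑ˡ 0))

-- One of n elements, each with probability 2^-r, or nothing.
draw : ∀ {r n m} → 2 ℕ.^ r ≡ n ℕ.+ m → Vec Bool r → Maybe (Fin n)
draw {r} {n} size ω = [ just , const nothing ]′ (splitAt n (subst Fin size (decode r ω)))

coinAverage-draw : ∀ {r n m} (size : 2 ℕ.^ r ≡ n ℕ.+ m) (g : Maybe (Fin n) → ℝ) → 0ℝ ≼ g nothing →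
  fromℚ (½ ^ℚ r) * sum (λ j → g (just j)) ≼ coinAverage r (λ ω → g (draw {r} size ω))
coinAverage-draw {r} {n} {m} size g 0≤g = begin
  fromℚ (½ ^ℚ r) * sum (λ j → g (just j))
    ≤⟨ *-monoʳ-≼ (fromℚ (½ ^ℚ r)) (fromℚ-mono (½^-nonNeg r)) (begin
         sum (λ j → g (just j))
           ≤⟨ ≼-by (sum {m} λ _ → g nothing) ≈-refl (sum-nonNeg {m} λ _ → 0≤g) ⟩
         sum (λ j → g (just j)) + sum {m} (λ _ → g nothing)
           ≈⟨ +-cong (sum-cong-≋ λ j → reflexive (cong (g ∘ [ just , const nothing ]′)
                (Fin.splitAt-↑ˡ n j m)))
                     (sum-cong-≋ λ s → reflexive (cong (g ∘ [ just , const nothing ]′)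
                          (Fin.splitAt-↑ʳ n m s))) ⟨
         sum (λ j → h (j ↑ˡ m)) + sum (λ s → h (n ↑ʳ s))
           ≈⟨ sum-split n m h ⟨
         sum h ∎) ⟩
  fromℚ (½ ^ℚ r) * sum h
    ≈⟨ resize size h ⟨
  coinAverage r (λ ω → g (draw {r} size ω)) ∎
  where
  open ≼-Reasoning
  open CommutativeRing ℝ-commutativeRing using (reflexive)
  h : Fin (n ℕ.+ m) → ℝ
  h s = g ([ just , const nothing ]′ (splitAt n s))
  resize : ∀ {N} (size : 2 ℕ.^ r ≡ N) (h : Fin N → ℝ) →
    coinAverage r (λ ω → h (subst Fin size (decode r ω))) ≈ fromℚ (½ ^ℚ r) * sum h
  resize refl h = coinAverage-decode r h

-- A power of two 2^r between n and 2n, and the excess m of 2^r over n.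
power-of-two : ∀ n .{{_ : NonZero n}} → ∃₂ λ r m → 2 ℕ.^ r ≡ n ℕ.+ m × 2 ℕ.^ r ℕ.≤ 2 ℕ.* n
power-of-two (suc n) with search n
  where
  search : ∀ n → ∃ λ r → suc n ℕ.≤ 2 ℕ.^ r × 2 ℕ.^ r ℕ.≤ 2 ℕ.* suc n
  search zero    = 0 , ℕ.≤-refl , ℕ.s≤s ℕ.z≤n
  search (suc n) with search n
  ... | r , n<2^r , 2^r≤2n with suc (suc n) ℕ.≤? 2 ℕ.^ r
  ...   | yes n+1<2^r = r , n+1<2^r , ℕ.≤-trans 2^r≤2n (ℕ.*-monoʳ-≤ 2 (ℕ.n≤1+n (suc n)))
  ...   | no  n+1≮2^r = suc r
          , ℕ.≤-trans (ℕ.s≤s n<2^r) (ℕ.+-mono-≤ (ℕ.m^n>0 2 r) (ℕ.m≤m+n (2 ℕ.^ r) 0))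
          , ℕ.*-monoʳ-≤ 2 (ℕ.<⇒≤ (ℕ.≰⇒> n+1≮2^r))
... | r , n<2^r , 2^r≤2n = r , 2 ℕ.^ r ℕ.∸ suc n , sym (ℕ.m+[n∸m]≡n n<2^r) , 2^r≤2n

-- The mean score

nat*1/n : ∀ n .{{_ : NonZero n}} → nat n ℚ.* (ℤ.+ 1 ℚ./ n) ≡ 1ℚ
nat*1/n (suc n) = trans (ℚ.*-comm (nat (suc n)) (unit n)) (unit*nat-suc n)

uniform : ∀ n .{{_ : NonZero n}} → Distribution n
uniform n = record
  { prob   = λ _ → fromℚ (ℤ.+ 1 ℚ./ n)
  ; nonNeg = λ _ → ≼⇒≤ (fromℚ-mono (ℚ.nonNegative⁻¹ (ℤ.+ 1 ℚ./ n) {{ℚ.normalize-nonNeg 1 n}}))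
  ; total  = ≈⇒≃ {y = 1ℝ} (≈-trans (sum-const n (fromℚ (ℤ.+ 1 ℚ./ n))) (pointwise λ _ → nat*1/n n)) }

module _ {n} (μ : Distribution n) where

  sum-affine : ∀ a b → sum (λ i → a + b * prob μ i) ≈ fromℕ n * a + b
  sum-affine a b = begin-equality
    sum (λ i → a + b * prob μ i)                  ≈⟨ ∑-distrib-+ (λ _ → a) (λ i → b * prob μ i) ⟩
    sum {n} (λ _ → a) + sum (λ i → b * prob μ i)
      ≈⟨ +-cong (sum-const n a) (≈-sym (*-distribˡ-sum b (prob μ))) ⟩
    fromℕ n * a + b * sum (prob μ)                ≈⟨ +-cong ≈-refl (*-cong ≈-refl (≃⇒≈ (total μ))) ⟩
    fromℕ n * a + b * 1ℝ
      ≈⟨ pointwise (λ k → cong (nat n ℚ.* seq a k ℚ.+_) (ℚ.*-identityʳ (seq b k))) ⟩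
    fromℕ n * a + b                               ∎
    where open ≼-Reasoning

  -- The differences μ(i) - μ(j) sum to 1 - nμ(j).
  sum-deviation : .{{_ : NonZero n}} → ∀ j →
    fromℕ n * ∣ prob μ j - fromℚ (ℤ.+ 1 ℚ./ n) ∣ ≼ sum (λ i → ∣ prob μ i - prob μ j ∣)
  sum-deviation j = begin
    fromℕ n * ∣ q - u ∣
      ≈⟨ pointwise (λ k → scale (seq q k)) ⟩
    ∣ 1ℝ + fromℕ n * (- q) ∣
      ≤⟨ ∣∣-lub-≼
           (≼-trans (≈⇒≼ (≈-sym total-difference))
             (≼-trans (pointwise-≼ (always λ k → p≤∣p∣ _)) (∣sum∣≼ f)))
           (≼-trans (neg-anti-≼ (≈⇒≼ total-difference))
             (≼-trans (pointwise-≼ (always λ k → -p≤∣p∣ _)) (∣sum∣≼ f))) ⟩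
    sum (λ i → ∣ prob μ i - q ∣) ∎
    where
    open ≼-Reasoning
    q = prob μ j
    u = fromℚ (ℤ.+ 1 ℚ./ n)
    f : Fin n → ℝ
    f i = prob μ i - q
    total-difference : sum f ≈ 1ℝ + fromℕ n * (- q)
    total-difference = ≈-trans (∑-distrib-+ (prob μ) (λ _ → - q)) (+-cong (≃⇒≈ (total μ)) (sum-const n (- q)))
    scale : ∀ p → nat n ℚ.* ℚ.∣ p ℚ.- (ℤ.+ 1 ℚ./ n) ∣ ≡ ℚ.∣ 1ℚ ℚ.+ nat n ℚ.* (ℚ.- p) ∣
    scale p = ≡.begin
      nat n ℚ.* ℚ.∣ p ℚ.- v ∣
        ≡.≡⟨ cong (ℚ._* ℚ.∣ p ℚ.- v ∣) (sym (ℚ.0≤p⇒∣p∣≡p (nat-nonNeg n))) ⟩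
      ℚ.∣ nat n ∣ ℚ.* ℚ.∣ p ℚ.- v ∣          ≡.≡⟨ sym (ℚ.∣p*q∣≡∣p∣*∣q∣ (nat n) (p ℚ.- v)) ⟩
      ℚ.∣ nat n ℚ.* (p ℚ.- v) ∣              ≡.≡⟨ sym (ℚ.∣-p∣≡∣p∣ (nat n ℚ.* (p ℚ.- v))) ⟩
      ℚ.∣ ℚ.- (nat n ℚ.* (p ℚ.- v)) ∣
        ≡.≡⟨ cong ℚ.∣_∣ (solve 3 (λ n p v → :- (n :* (p :- v)) := n :* v :+ n :* (:- p)) refl (nat n) p v) ⟩
      ℚ.∣ nat n ℚ.* v ℚ.+ nat n ℚ.* (ℚ.- p) ∣ ≡.≡⟨ cong (λ z → ℚ.∣ z ℚ.+ nat n ℚ.* (ℚ.- p) ∣) (nat*1/n n) ⟩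
      ℚ.∣ 1ℚ ℚ.+ nat n ℚ.* (ℚ.- p) ∣         ≡.∎
      where
      module ≡ = ≡-Reasoning
      v = ℤ.+ 1 ℚ./ n

  module _ (O : ConditionalOracle μ) .{{_ : NonZero n}} where

    -- If μ has distance at least t from the uniform distribution, then the scores
    -- of all pairs, with weight μ(i) for the sample i, sum to at least nt².
    sum-bias : ∀ t → 0ℚ ℚ.≤ t → fromℚ t ≼ distance μ (uniform n) →
      fromℕ n * fromℚ (t ℚ.* t) ≼ sum (λ j → sum λ i → prob μ i * bias μ O i j)
    sum-bias t 0≤t far = begin
      fromℕ n * fromℚ (t ℚ.* t)
        ≤⟨ ≼-by (fromℚ t * fromℕ n * ((S + S) - (fromℚ t + fromℚ t)))
             (pointwise λ k → solve 3 (λ n t S →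
               (n :* (con ½ :- con ½ :* (t :* t)) :+ n :* (:- (con ½ :+ con ½ :* (t :* t)))) :+
                 t :* n :* (S :+ S) :=
               n :* (t :* t) :+ t :* n :* ((S :+ S) :- (t :+ t))) refl (nat n) t (seq S k))
             (*-nonNeg-≼ (*-nonNeg-≼ (fromℚ-mono 0≤t) (fromℚ-mono (nat-nonNeg n)))
               (≼-trans (≈⇒≼ (pointwise λ k → sym (ℚ.+-inverseʳ (t ℚ.+ t))))
                 (+-mono-≼ (+-mono-≼ far far) ≼-refl))) ⟩
      (fromℕ n * fromℚ a + fromℕ n * fromℚ b) + fromℚ t * fromℕ n * (S + S)
        ≈⟨ +-cong (sum-affine (fromℚ a) (fromℕ n * fromℚ b)) doubled ⟨
      sum (λ j → fromℚ a + fromℕ n * fromℚ b * prob μ j) +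
        sum (λ j → fromℚ t * (fromℕ n * ∣ prob μ j - u ∣))
        ≈⟨ ∑-distrib-+ (λ j → fromℚ a + fromℕ n * fromℚ b * prob μ j)
             (λ j → fromℚ t * (fromℕ n * ∣ prob μ j - u ∣)) ⟨
      sum (λ j → (fromℚ a + fromℕ n * fromℚ b * prob μ j) + fromℚ t * (fromℕ n * ∣ prob μ j - u ∣))
        ≤⟨ sum-mono inner ⟩
      sum (λ j → sum λ i → prob μ i * bias μ O i j) ∎
      where
      open ≼-Reasoning
      u = fromℚ (ℤ.+ 1 ℚ./ n)
      S = distance μ (uniform n)
      -- The coefficients of μ(i) and μ(j) in the lower bound for μ(i) times the
      -- bias; their sum is -t².
      a = ½ ℚ.- ½ ℚ.* (t ℚ.* t)
      b = ℚ.- (½ ℚ.+ ½ ℚ.* (t ℚ.* t))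
      doubled : sum (λ j → fromℚ t * (fromℕ n * ∣ prob μ j - u ∣)) ≈ fromℚ t * fromℕ n * (S + S)
      doubled = begin-equality
        sum (λ j → fromℚ t * (fromℕ n * ∣ prob μ j - u ∣))
          ≈⟨ sum-cong-≋ (λ j → pointwise λ k → sym (ℚ.*-assoc t (nat n) (seq ∣ prob μ j - u ∣ k))) ⟩
        sum (λ j → fromℚ t * fromℕ n * ∣ prob μ j - u ∣)
          ≈⟨ *-distribˡ-sum (fromℚ t * fromℕ n) (λ j → ∣ prob μ j - u ∣) ⟨
        fromℚ t * fromℕ n * sum (λ j → ∣ prob μ j - u ∣)
          ≈⟨ *-cong ≈-refl (pointwise λ k → solve 1 (λ x → x := con ½ :* x :+ con ½ :* x) refl
               (seq (sum (λ j → ∣ prob μ j - u ∣)) k)) ⟩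
        fromℚ t * fromℕ n * (S + S) ∎
      inner : ∀ j → (fromℚ a + fromℕ n * fromℚ b * prob μ j) + fromℚ t * (fromℕ n * ∣ prob μ j - u ∣) ≼
        sum (λ i → prob μ i * bias μ O i j)
      inner j = begin
        (fromℚ a + fromℕ n * fromℚ b * prob μ j) + fromℚ t * (fromℕ n * ∣ prob μ j - u ∣)
          ≈⟨ +-cong (pointwise λ k → solve 4 (λ a n b q → a :+ n :* b :* q :=
               n :* (b :* q) :+ a) refl a (nat n) b (seq (prob μ j) k)) ≈-refl ⟩
        (fromℕ n * (fromℚ b * prob μ j) + fromℚ a) + fromℚ t * (fromℕ n * ∣ prob μ j - u ∣)
          ≤⟨ +-mono-≼ (≈⇒≼ (≈-sym (sum-affine (fromℚ b * prob μ j) (fromℚ a))))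
               (*-monoʳ-≼ (fromℚ t) (fromℚ-mono 0≤t) (sum-deviation j)) ⟩
        sum (λ i → fromℚ b * prob μ j + fromℚ a * prob μ i) + fromℚ t * sum (λ i → ∣ prob μ i - prob μ j ∣)
          ≈⟨ +-cong (sum-cong-≋ λ i → pointwise λ k →
                 ℚ.+-comm (b ℚ.* seq (prob μ j) k) (a ℚ.* seq (prob μ i) k))
               (*-distribˡ-sum (fromℚ t) (λ i → ∣ prob μ i - prob μ j ∣)) ⟩
        sum (λ i → fromℚ a * prob μ i + fromℚ b * prob μ j) + sum (λ i → fromℚ t * ∣ prob μ i - prob μ j ∣)
          ≈⟨ ∑-distrib-+ (λ i → fromℚ a * prob μ i + fromℚ b * prob μ j)
               (λ i → fromℚ t * ∣ prob μ i - prob μ j ∣) ⟨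
        sum (λ i → (fromℚ a * prob μ i + fromℚ b * prob μ j) + fromℚ t * ∣ prob μ i - prob μ j ∣)
          ≤⟨ sum-mono (λ i → prob*bias μ O t 0≤t i j) ⟩
        sum (λ i → prob μ i * bias μ O i j) ∎

    bias-uniform : Uniform n μ → ∀ i j → bias μ O i j ≈ 0ℝ
    bias-uniform unif i j = begin-equality
      D
        ≈⟨ pointwise (λ k → trans (sym (ℚ.*-identityˡ (seq D k))) (trans
             (cong (ℚ._* seq D k) (sym (nat*1/n n)))
             (solve 3 (λ n v D → n :* v :* D := con ½ :* n :* ((v :+ v) :* D))
                  refl (nat n) (ℤ.+ 1 ℚ./ n) (seq D k)))) ⟩
      fromℚ (½ ℚ.* nat n) * ((u + u) * D)
        ≈⟨ *-cong ≈-refl (*-cong (+-cong (≃⇒≈ (unif i)) (≃⇒≈ (unif j))) ≈-refl) ⟨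
      fromℚ (½ ℚ.* nat n) * ((prob μ i + prob μ j) * D)
        ≈⟨ *-cong ≈-refl (bias*mass μ O i j) ⟩
      fromℚ (½ ℚ.* nat n) * (prob μ i - prob μ j)
        ≈⟨ *-cong ≈-refl (+-cong (≃⇒≈ (unif i)) (neg-cong (≃⇒≈ (unif j)))) ⟩
      fromℚ (½ ℚ.* nat n) * (u - u)
        ≈⟨ pointwise (λ k → solve 2 (λ n v → con ½ :* n :* (v :- v) := con 0ℚ) refl (nat n) (ℤ.+ 1 ℚ./ n)) ⟩
      0ℝ ∎
      where
      open ≼-Reasoning
      D = bias μ O i j
      u = fromℚ (ℤ.+ 1 ℚ./ n)

-- The element drawn, or the sample i itself if nothing is drawn.
drawOpponent : ∀ {r n m} → 2 ℕ.^ r ≡ n ℕ.+ m → Vec Bool r → Fin n → Fin n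
drawOpponent {r} size ω i = fromMaybe i (draw {r} size ω)

module _ {n r m : ℕ} .{{_ : NonZero n}} (⊤≠∅ : Nonempty (⊤ {n})) (size : 2 ℕ.^ r ≡ n ℕ.+ m) (η : ℚ)
         {μ : Distribution n} (O : ConditionalOracle μ) where

  private
    opponent : Vec Bool r → Fin n → Fin n
    opponent = drawOpponent {r} size

  open Betting ⊤≠∅ opponent η using (meanScore)

  meanScore-uniform : Uniform n μ → meanScore O ≼ 0ℝ
  meanScore-uniform unif = ≈⇒≼ (≈-trans
    (cong-≈ (coinAverage-isMean r) λ ω → ≈-trans
      (cong-≈ (expectation-isMean (answer O ⊤ ⊤≠∅)) λ i → bias-uniform μ O unif i (opponent ω i))
      (constant (expectation-isMean (answer O ⊤ ⊤≠∅)) 0ℝ))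
    (constant (coinAverage-isMean r) 0ℝ))

  meanScore-far : ∀ t → 0ℚ ℚ.≤ t → fromℚ t ≼ distance μ (uniform n) → 2 ℕ.^ r ℕ.≤ 2 ℕ.* n →
    fromℚ (½ ℚ.* (t ℚ.* t)) ≼ meanScore O
  meanScore-far t 0≤t far 2^r≤2n = begin
    fromℚ (½ ℚ.* (t ℚ.* t))
      ≤⟨ fromℚ-mono (ℚ.*-monoʳ-≤-nonNeg (t ℚ.* t) {{ℚ.nonNegative (*-nonNeg 0≤t 0≤t)}} half≤) ⟩
    fromℚ (½ ^ℚ r ℚ.* nat n ℚ.* (t ℚ.* t))
      ≈⟨ pointwise (λ _ → ℚ.*-assoc (½ ^ℚ r) (nat n) (t ℚ.* t)) ⟩
    fromℚ (½ ^ℚ r) * (fromℕ n * fromℚ (t ℚ.* t))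
      ≤⟨ *-monoʳ-≼ (fromℚ (½ ^ℚ r)) (fromℚ-mono (½^-nonNeg r)) (sum-bias μ O t 0≤t far) ⟩
    fromℚ (½ ^ℚ r) * sum (λ j → g (just j))
      ≤⟨ coinAverage-draw {r} size g (≈⇒≼ (≈-sym (≈-trans
           (sum-cong-≋ λ i → ≈-trans (*-cong ≈-refl (bias-void μ O i))
             (pointwise λ k → ℚ.*-zeroʳ (seq (prob μ i) k)))
           (≈-trans (sum-const n 0ℝ) (pointwise λ _ → ℚ.*-zeroʳ (nat n)))))) ⟩
    coinAverage r (λ ω → g (draw {r} size ω))
      ≈⟨ cong-≈ (coinAverage-isMean r) (λ ω → sum-cong-≋ λ i → *-cong (answer-⊤ μ O ⊤≠∅ i) ≈-refl) ⟨
    meanScore O ∎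
    where
    open ≼-Reasoning
    g : Maybe (Fin n) → ℝ
    g x = sum λ i → prob μ i * bias μ O i (fromMaybe i x)
    half≤ : ½ ℚ.≤ ½ ^ℚ r ℚ.* nat n
    half≤ = ℚ.≤-trans (eq≤ (trans (cong (½ ℚ.*_) (sym (½^*2^ r))) refl))
      (ℚ.≤-trans (ℚ.*-monoˡ-≤-nonNeg ½ (ℚ.*-monoˡ-≤-nonNeg (½ ^ℚ r) {{ℚ.nonNegative (½^-nonNeg r)}}
          (ℚ.≤-trans (nat-mono 2^r≤2n) (eq≤ (nat-* 2 n)))))
        (eq≤ (solve 2 (λ h n → con ½ :* (h :* (con (nat 2) :* n)) := h :* n) refl (½ ^ℚ r) (nat n))))

-- Approximation of a positive real by a power of 1/2

-- A power of 1/2 below x and, if x is less than 1, within a factor 8 of x.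
dyadic : ∀ x → ∃ λ k → Eventually (λ n → ½ ^ℚ k ℚ.≤ seq (value x) n) ×
  (value x < 1ℝ → Eventually (λ n → seq (value x) n ℚ.≤ nat 8 ℚ.* ½ ^ℚ k))
dyadic (mkℝ⁺ x (e , 0<e , N , e≤x)) = from-stable (cauchy x (½ ℚ.* e) (half-pos 0<e))
  where
  Goal = ∃ λ k → Eventually (λ n → ½ ^ℚ k ℚ.≤ seq x n) ×
    (x < 1ℝ → Eventually (λ n → seq x n ℚ.≤ nat 8 ℚ.* ½ ^ℚ k))
  from-stable : (∃ λ M → ∀ m n → M ℕ.≤ m → M ℕ.≤ n → ℚ.∣ seq x m ℚ.- seq x n ∣ ℚ.≤ ½ ℚ.* e) → Goal
  from-stable (M , stable) = from-exponent (least-exponent q 0<q)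
    where
    p = seq x (M ℕ.⊔ N)
    q = ½ ℚ.* p
    e≤p : e ℚ.≤ p
    e≤p = ℚ.≤-trans (eq≤ (sym (ℚ.+-identityˡ e))) (e≤x (M ℕ.⊔ N) (ℕ.m≤n⊔m M N))
    0<q : 0ℚ ℚ.< q
    0<q = half-pos (ℚ.<-≤-trans 0<e e≤p)
    near : ∀ a b → ℚ.∣ a ℚ.- b ∣ ℚ.≤ ½ ℚ.* e → a ℚ.≤ b ℚ.+ q
    near a b h = ℚ.≤-trans (eq≤ (solve 2 (λ a b → a := b :+ (a :- b)) refl a b))
      (ℚ.+-monoʳ-≤ b (ℚ.≤-trans (p≤∣p∣ (a ℚ.- b)) (ℚ.≤-trans h
        (ℚ.*-monoˡ-≤-nonNeg ½ e≤p))))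
    lower : ∀ n → M ℕ.≤ n → q ℚ.≤ seq x n
    lower n M≤n = ℚ.≤-trans (eq≤ (solve 1 (λ p → con ½ :* p := p :- con ½ :* p) refl p))
      (ℚ.≤-trans (ℚ.+-monoˡ-≤ (ℚ.- q) (near p (seq x n) (stable (M ℕ.⊔ N) n (ℕ.m≤m⊔n M N) M≤n)))
        (eq≤ (solve 2 (λ a q → (a :+ q) :- q := a) refl (seq x n) q)))
    upper : ∀ n → M ℕ.≤ n → seq x n ℚ.≤ nat 3 ℚ.* q
    upper n M≤n = ℚ.≤-trans (near (seq x n) p (stable n (M ℕ.⊔ N) M≤n (ℕ.m≤m⊔n M N)))
      (eq≤ (solve 1 (λ p → p :+ con ½ :* p := con (nat 3) :* (con ½ :* p)) refl p))
    from-exponent : (∃ λ k → ½ ^ℚ k ℚ.≤ q × (k ≡ 0 ⊎ q ℚ.≤ (1ℚ ℚ.+ 1ℚ) ℚ.* ½ ^ℚ k)) → Goal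
    from-exponent (k , ½^k≤q , inj₂ q≤) = k
      , (M , λ n M≤n → ℚ.≤-trans ½^k≤q (lower n M≤n))
      , λ _ → M , λ n M≤n → ℚ.≤-trans (upper n M≤n) (ℚ.≤-trans (ℚ.*-monoˡ-≤-nonNeg (nat 3) q≤)
          (≤-by (nat 2 ℚ.* ½ ^ℚ k)
            (solve 1 (λ h → con (nat 8) :* h :=
                 con (nat 3) :* ((con 1ℚ :+ con 1ℚ) :* h) :+ con (nat 2) :* h) refl (½ ^ℚ k))
            (*-nonNeg (nat-nonNeg 2) (½^-nonNeg k))))
    from-exponent (.0 , 1≤q , inj₁ refl) = 0
      , (M , λ n M≤n → ℚ.≤-trans 1≤q (lower n M≤n))
      , λ (d , 0<d , K , x<1) → K , λ n K≤n → ℚ.≤-trans (p≤p+e (ℚ.<⇒≤ 0<d)) (ℚ.≤-trans (x<1 n K≤n)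
          (≤-by (nat 7) refl (nat-nonNeg 7)))

-- The logarithm of a power of two

module _ {z} (0≤z : 0ℚ ℚ.≤ z) (z≤1 : z ℚ.≤ 1ℚ) where

  artanhTerm : ℕ → ℚ
  artanhTerm s = z ^ℚ suc (2 ℕ.* s) ℚ.* unit (2 ℕ.* s)

  artanhSum-block : ∀ c m d → (∀ s → s ℕ.< d ℕ.+ m → c ℚ.≤ artanhTerm s) →
    artanhSum m z ℚ.+ nat d ℚ.* c ℚ.≤ artanhSum (d ℕ.+ m) z
  artanhSum-block c m zero    _ = eq≤ (trans (cong (artanhSum m z ℚ.+_) (ℚ.*-zeroˡ c))
    (ℚ.+-identityʳ (artanhSum m z)))
  artanhSum-block c m (suc d) h = begin
    artanhSum m z ℚ.+ nat (suc d) ℚ.* c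
      ≡⟨ cong (λ x → artanhSum m z ℚ.+ x ℚ.* c) (nat-suc d) ⟩
    artanhSum m z ℚ.+ (1ℚ ℚ.+ nat d) ℚ.* c
      ≡⟨ solve 3 (λ a d c → a :+ (con 1ℚ :+ d) :* c := (a :+ d :* c) :+ c) refl (artanhSum m z) (nat d) c ⟩
    (artanhSum m z ℚ.+ nat d ℚ.* c) ℚ.+ c
      ≤⟨ ℚ.+-mono-≤ (artanhSum-block c m d λ s s<d+m → h s (ℕ.m≤n⇒m≤1+n s<d+m)) (h (d ℕ.+ m) ℕ.≤-refl) ⟩
    artanhSum (suc d ℕ.+ m) z ∎
    where open ℚ.≤-Reasoning

  artanhSum-mono : ∀ {m n} → m ℕ.≤ n → artanhSum m z ℚ.≤ artanhSum n z
  artanhSum-mono {m} {n} m≤n = subst (λ k → artanhSum m z ℚ.≤ artanhSum k z) (ℕ.m∸n+n≡m m≤n)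
    (ℚ.≤-trans (eq≤ (sym (trans (cong (artanhSum m z ℚ.+_) (ℚ.*-zeroʳ (nat (n ℕ.∸ m))))
        (ℚ.+-identityʳ (artanhSum m z)))))
      (artanhSum-block 0ℚ m (n ℕ.∸ m) λ s _ →
        *-nonNeg (^-nonNeg 0≤z (suc (2 ℕ.* s))) (ℚ.<⇒≤ (unit>0 (2 ℕ.* s)))))

  -- While 2^(i+2) (1 - z) ≤ 1/2 the terms with 2^i ≤ s < 2^(i+1), being at least
  -- 2^-(i+4), sum to at least 1/16.
  artanhSum-dyadic : ∀ j → 1ℚ ℚ.- ½ ^ℚ (2 ℕ.+ j) ℚ.≤ z → ∀ i → i ℕ.≤ j →
    nat i ℚ.* ½ ^ℚ 4 ℚ.≤ artanhSum (2 ℕ.^ i) z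
  artanhSum-dyadic j near zero    i≤j = ℚ.≤-trans (eq≤ (ℚ.*-zeroˡ (½ ^ℚ 4))) (artanhSum-mono {0} {1} ℕ.z≤n)
  artanhSum-dyadic j near (suc i) i<j = begin
    nat (suc i) ℚ.* ½ ^ℚ 4
      ≡⟨ cong (ℚ._* ½ ^ℚ 4) (nat-suc i) ⟩
    (1ℚ ℚ.+ nat i) ℚ.* ½ ^ℚ 4
      ≡⟨ solve 2 (λ n h → (con 1ℚ :+ n) :* h := n :* h :+ h) refl (nat i) (½ ^ℚ 4) ⟩
    nat i ℚ.* ½ ^ℚ 4 ℚ.+ ½ ^ℚ 4
      ≤⟨ ℚ.+-mono-≤ (artanhSum-dyadic j near i (ℕ.<⇒≤ i<j)) (eq≤ block-total) ⟩
    artanhSum (2 ℕ.^ i) z ℚ.+ nat (2 ℕ.^ i) ℚ.* ½ ^ℚ (4 ℕ.+ i)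
      ≤⟨ artanhSum-block (½ ^ℚ (4 ℕ.+ i)) (2 ℕ.^ i) (2 ℕ.^ i) term ⟩
    artanhSum (2 ℕ.^ i ℕ.+ 2 ℕ.^ i) z
      ≡⟨ cong (λ k → artanhSum (2 ℕ.^ i ℕ.+ k) z) (ℕ.+-identityʳ (2 ℕ.^ i)) ⟨
    artanhSum (2 ℕ.^ suc i) z ∎
    where
    open ℚ.≤-Reasoning
    block-total : ½ ^ℚ 4 ≡ nat (2 ℕ.^ i) ℚ.* ½ ^ℚ (4 ℕ.+ i)
    block-total = sym (trans (cong (nat (2 ℕ.^ i) ℚ.*_) (^-homo-* ½ 4 i))
      (trans (solve 3 (λ n h k → n :* (h :* k) := h :* (k :* n)) refl (nat (2 ℕ.^ i)) (½ ^ℚ 4) (½ ^ℚ i))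
        (trans (cong (½ ^ℚ 4 ℚ.*_) (½^*2^ i)) (ℚ.*-identityʳ (½ ^ℚ 4)))))
    exponent≤ : ∀ s → s ℕ.< 2 ℕ.^ i ℕ.+ 2 ℕ.^ i → suc (2 ℕ.* s) ℕ.≤ 2 ℕ.^ (2 ℕ.+ i)
    exponent≤ s s<2^i+2^i = ℕ.≤-trans (ℕ.≤-trans (ℕ.n≤1+n (suc (2 ℕ.* s)))
        (ℕ.≤-reflexive (sym (ℕ.*-suc 2 s))))
      (ℕ.*-monoʳ-≤ 2 (ℕ.≤-trans s<2^i+2^i
        (ℕ.≤-reflexive (cong (2 ℕ.^ i ℕ.+_) (sym (ℕ.+-identityʳ (2 ℕ.^ i)))))))
    power≥½ : ½ ℚ.≤ z ^ℚ (2 ℕ.^ (2 ℕ.+ i))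
    power≥½ = begin
      ½
        ≡⟨⟩
      1ℚ ℚ.+ ℚ.- ½
        ≤⟨ ℚ.+-monoʳ-≤ 1ℚ (ℚ.neg-antimono-≤ small) ⟩
      1ℚ ℚ.+ ℚ.- (nat (2 ℕ.^ (2 ℕ.+ i)) ℚ.* ½ ^ℚ (2 ℕ.+ j))
        ≤⟨ ℚ.+-monoʳ-≤ 1ℚ (ℚ.≤-trans (eq≤ (ℚ.neg-distribʳ-* (nat (2 ℕ.^ (2 ℕ.+ i))) (½ ^ℚ (2 ℕ.+ j))))
             (ℚ.*-monoˡ-≤-nonNeg (nat (2 ℕ.^ (2 ℕ.+ i))) {{ℚ.nonNegative (nat-nonNeg (2 ℕ.^ (2 ℕ.+ i)))}}
               (ℚ.≤-trans (eq≤ (solve 1 (λ h → :- h := (con 1ℚ :- h) :- con 1ℚ) refl (½ ^ℚ (2 ℕ.+ j))))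
                 (ℚ.+-monoˡ-≤ (ℚ.- 1ℚ) near)))) ⟩
      1ℚ ℚ.+ nat (2 ℕ.^ (2 ℕ.+ i)) ℚ.* (z ℚ.- 1ℚ)
        ≤⟨ bernoulli (z ℚ.- 1ℚ) (2 ℕ.^ (2 ℕ.+ i)) (ℚ.≤-trans 0≤z (eq≤ z≡)) ⟩
      (1ℚ ℚ.+ (z ℚ.- 1ℚ)) ^ℚ (2 ℕ.^ (2 ℕ.+ i))
        ≡⟨ cong (_^ℚ (2 ℕ.^ (2 ℕ.+ i))) z≡ ⟨
      z ^ℚ (2 ℕ.^ (2 ℕ.+ i)) ∎
      where
      z≡ : z ≡ 1ℚ ℚ.+ (z ℚ.- 1ℚ)
      z≡ = solve 1 (λ z → z := con 1ℚ :+ (z :- con 1ℚ)) refl z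
      small : nat (2 ℕ.^ (2 ℕ.+ i)) ℚ.* ½ ^ℚ (2 ℕ.+ j) ℚ.≤ ½
      small = ℚ.≤-trans (ℚ.*-monoˡ-≤-nonNeg (nat (2 ℕ.^ (2 ℕ.+ i)))
           {{ℚ.nonNegative (nat-nonNeg (2 ℕ.^ (2 ℕ.+ i)))}}
          (^-anti 0≤½ ½≤1 (ℕ.s≤s (ℕ.s≤s i<j))))
        (eq≤ (trans (solve 2 (λ n h → n :* (con ½ :* h) := con ½ :* (h :* n))
             refl (nat (2 ℕ.^ (2 ℕ.+ i))) (½ ^ℚ (2 ℕ.+ i)))
          (cong (½ ℚ.*_) (½^*2^ (2 ℕ.+ i)))))
    term : ∀ s → s ℕ.< 2 ℕ.^ i ℕ.+ 2 ℕ.^ i → ½ ^ℚ (4 ℕ.+ i) ℚ.≤ artanhTerm s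
    term s s< = ℚ.≤-trans
      (ℚ.*-monoˡ-≤-nonNeg ½ (^-anti 0≤½ ½≤1 (ℕ.n≤1+n (2 ℕ.+ i))))
      (*-mono (^-nonNeg 0≤z (suc (2 ℕ.* s))) (½^-nonNeg (2 ℕ.+ i))
        (ℚ.≤-trans power≥½ (^-anti 0≤z z≤1 (exponent≤ s s<)))
        (unit≥½^ (2 ℕ.* s) (2 ℕ.+ i) (exponent≤ s s<)))

-- The rational (x - 1)/(x + 1) as it occurs in the logarithm.
mobiusℚ : ℚ → ℚ
mobiusℚ x = (x ℚ.- 1ℚ) ℚ.* inv-clamp 0<1 (x ℚ.+ 1ℚ)

module _ {x} (1≤x : 1ℚ ℚ.≤ x) where

  private
    y = inv-clamp 0<1 (x ℚ.+ 1ℚ)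
    1≤x+1 : 1ℚ ℚ.≤ x ℚ.+ 1ℚ
    1≤x+1 = ℚ.≤-trans 1≤x (p≤p+e 0≤1)
    y[x+1]≡1 : y ℚ.* (x ℚ.+ 1ℚ) ≡ 1ℚ
    y[x+1]≡1 = inv-clamp-* 0<1 (x ℚ.+ 1ℚ) 1≤x+1
    0≤y : 0ℚ ℚ.≤ y
    0≤y = ℚ.<⇒≤ (inv-pos (clamp>0 (x ℚ.+ 1ℚ) 0<1))

  mobiusℚ-complement : mobiusℚ x ≡ 1ℚ ℚ.- (y ℚ.+ y)
  mobiusℚ-complement = trans
    (solve 2 (λ x y → (x :- con 1ℚ) :* y := y :* (x :+ con 1ℚ) :- (y :+ y)) refl x y)
    (cong (ℚ._- (y ℚ.+ y)) y[x+1]≡1)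

  mobiusℚ-nonNeg : 0ℚ ℚ.≤ mobiusℚ x
  mobiusℚ-nonNeg = *-nonNeg (p≤q⇒0≤q-p 1≤x) 0≤y

  mobiusℚ≤1 : mobiusℚ x ℚ.≤ 1ℚ
  mobiusℚ≤1 = ℚ.≤-trans (eq≤ mobiusℚ-complement)
    (≤-by (y ℚ.+ y) (solve 1 (λ y → con 1ℚ := (con 1ℚ :- (y :+ y)) :+ (y :+ y)) refl y) (+-nonNeg 0≤y 0≤y))

  mobiusℚ-near-1 : ∀ e → nat (2 ℕ.^ e) ℚ.≤ x → 1ℚ ℚ.- (½ ^ℚ e ℚ.+ ½ ^ℚ e) ℚ.≤ mobiusℚ x
  mobiusℚ-near-1 e 2^e≤x = ℚ.≤-trans
    (ℚ.+-monoʳ-≤ 1ℚ (ℚ.neg-antimono-≤ (ℚ.+-mono-≤ y≤ y≤))) (eq≤ (sym mobiusℚ-complement))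
    where
    y≤ : y ℚ.≤ ½ ^ℚ e
    y≤ = cancel-≤ (½ ^ℚ e) (nat (2 ℕ.^ e)) y (½ ^ℚ e) (½^-nonNeg e) (½^*2^ e) (begin
      nat (2 ℕ.^ e) ℚ.* y    ≤⟨ ℚ.*-monoʳ-≤-nonNeg y {{ℚ.nonNegative 0≤y}} (ℚ.≤-trans 2^e≤x (p≤p+e 0≤1)) ⟩
      (x ℚ.+ 1ℚ) ℚ.* y       ≡⟨ trans (ℚ.*-comm (x ℚ.+ 1ℚ) y) y[x+1]≡1 ⟩
      1ℚ                     ≡⟨ trans (ℚ.*-comm (nat (2 ℕ.^ e)) (½ ^ℚ e)) (½^*2^ e) ⟨
      nat (2 ℕ.^ e) ℚ.* ½ ^ℚ e ∎)
      where open ℚ.≤-Reasoning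

  -- The n-th term of the logarithm of a real whose n-th term is x.
  logTerm : ℕ → ℚ
  logTerm n = nat 2 ℚ.* artanhSum n (mobiusℚ x)

  logTerm-nonNeg : ∀ n → 0ℚ ℚ.≤ logTerm n
  logTerm-nonNeg n = *-nonNeg (nat-nonNeg 2) (artanhSum-mono mobiusℚ-nonNeg mobiusℚ≤1 {0} {n} ℕ.z≤n)

  -- For index n at least 2^k the term of log x is close enough to its limit to
  -- bound the binary logarithm, up to constants: with k = 6 + j there is
  -- x ≥ 2^(3+j), and j blocks of the series contribute 1/16 each.
  exponent≤log : ∀ k n → nat (2 ℕ.^ k) ℚ.≤ nat 8 ℚ.* x → 2 ℕ.^ k ℕ.≤ n →
    nat k ℚ.≤ nat 6 ℚ.+ nat 8 ℚ.* logTerm n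
  exponent≤log k n 2^k≤8x 2^k≤n with ℕ.≤-total k 6
  ... | inj₁ k≤6 = ℚ.≤-trans (nat-mono k≤6) (p≤p+e (*-nonNeg (nat-nonNeg 8) (logTerm-nonNeg n)))
  ... | inj₂ 6≤k = subst (λ k → nat k ℚ.≤ nat 6 ℚ.+ nat 8 ℚ.* logTerm n) (ℕ.m+[n∸m]≡n 6≤k)
      (ℚ.≤-trans (eq≤ (nat-+ 6 j)) (ℚ.+-monoʳ-≤ (nat 6) j≤))
    where
    open ℚ.≤-Reasoning
    j = k ℕ.∸ 6
    2^j≤n : 2 ℕ.^ j ℕ.≤ n
    2^j≤n = ℕ.≤-trans (ℕ.^-monoʳ-≤ 2 (ℕ.m∸n≤m k 6)) 2^k≤n
    2^[3+j]≤x : nat (2 ℕ.^ (3 ℕ.+ j)) ℚ.≤ x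
    2^[3+j]≤x = cancel-≤ (½ ^ℚ 3) (nat 8) _ x (½^-nonNeg 3) refl (begin
      nat 8 ℚ.* nat (2 ℕ.^ (3 ℕ.+ j))  ≡⟨ nat-* 8 (2 ℕ.^ (3 ℕ.+ j)) ⟨
      nat (8 ℕ.* 2 ℕ.^ (3 ℕ.+ j))      ≡⟨ cong nat (ℕ.^-distribˡ-+-* 2 3 (3 ℕ.+ j)) ⟨
      nat (2 ℕ.^ (6 ℕ.+ j))            ≡⟨ cong (λ k → nat (2 ℕ.^ k)) (ℕ.m+[n∸m]≡n 6≤k) ⟩
      nat (2 ℕ.^ k)                    ≤⟨ 2^k≤8x ⟩
      nat 8 ℚ.* x                      ∎)
    near : 1ℚ ℚ.- ½ ^ℚ (2 ℕ.+ j) ℚ.≤ mobiusℚ x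
    near = ℚ.≤-trans (eq≤ (cong (ℚ._-_ 1ℚ) (solve 1 (λ h → h := con ½ :* h :+ con ½ :* h)
         refl (½ ^ℚ (2 ℕ.+ j)))))
      (mobiusℚ-near-1 (3 ℕ.+ j) 2^[3+j]≤x)
    j≤ : nat j ℚ.≤ nat 8 ℚ.* logTerm n
    j≤ = cancel-≤ (nat 16) (½ ^ℚ 4) (nat j) _ (nat-nonNeg 16) refl (begin
      ½ ^ℚ 4 ℚ.* nat j           ≡⟨ ℚ.*-comm (½ ^ℚ 4) (nat j) ⟩
      nat j ℚ.* ½ ^ℚ 4           ≤⟨ artanhSum-dyadic mobiusℚ-nonNeg mobiusℚ≤1 j near j ℕ.≤-refl ⟩
      artanhSum (2 ℕ.^ j) (mobiusℚ x) ≤⟨ artanhSum-mono mobiusℚ-nonNeg mobiusℚ≤1 2^j≤n ⟩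
      artanhSum n (mobiusℚ x)
        ≡⟨ solve 1 (λ a → a := con (½ ^ℚ 4) :* (con (nat 8) :* (con (nat 2) :* a)))
             refl (artanhSum n (mobiusℚ x)) ⟩
      ½ ^ℚ 4 ℚ.* (nat 8 ℚ.* logTerm n) ∎)

-- The tester

-- The exponent k of the power 2^-k that takes the place of x.
exponent : ℝ⁺ → ℕ
exponent x = proj₁ (dyadic x)

-- The stake t²/8 for t = 2^-l, for which a distance of at least t from the uniform
-- distribution yields a mean score of at least t²/2, four times the stake.
stake : ℕ → ℚ
stake l = ½ ^ℚ 3 ℚ.* (½ ^ℚ l ℚ.* ½ ^ℚ l)

-- The inverse of twice the squared stake: in that many rounds of a biased game the
-- bound for the mean inverse wealth is halved.
halving : ℕ → ℕ
halving l = 32 ℕ.* (2 ℕ.^ l ℕ.* 2 ℕ.^ l ℕ.* (2 ℕ.^ l ℕ.* 2 ℕ.^ l))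

-- Starting from the wealth 2^-k, the bound for the mean inverse wealth has to fall
-- from 2^k to 2^-k, that is, to be halved 2k times.
rounds : (l k : ℕ) → ℕ
rounds l k = (k ℕ.+ k) ℕ.* halving l

stake-nonNeg : ∀ l → 0ℚ ℚ.≤ stake l
stake-nonNeg l = *-nonNeg (½^-nonNeg 3) (*-nonNeg (½^-nonNeg l) (½^-nonNeg l))

stake≤½ : ∀ l → stake l ℚ.≤ ½
stake≤½ l = begin
  ½ ^ℚ 3 ℚ.* (t ℚ.* t)
    ≤⟨ ℚ.*-monoˡ-≤-nonNeg (½ ^ℚ 3) (*-mono {t} {1ℚ} {t} {1ℚ} 0≤1 (½^-nonNeg l) (½^≤1 l) (½^≤1 l)) ⟩
  ½ ^ℚ 3 ℚ.* (1ℚ ℚ.* 1ℚ)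
    ≤⟨ ≤-by (½ ^ℚ 2 ℚ.+ ½ ^ℚ 3) refl (+-nonNeg (½^-nonNeg 2) (½^-nonNeg 3)) ⟩
  ½ ∎
  where
  open ℚ.≤-Reasoning
  t = ½ ^ℚ l

nat-halving : ∀ l → let L = nat (2 ℕ.^ l) in nat (halving l) ≡ nat 32 ℚ.* (L ℚ.* L ℚ.* (L ℚ.* L))
nat-halving l = begin
  nat (32 ℕ.* (K ℕ.* K ℕ.* (K ℕ.* K)))            ≡⟨ nat-* 32 (K ℕ.* K ℕ.* (K ℕ.* K)) ⟩
  nat 32 ℚ.* nat (K ℕ.* K ℕ.* (K ℕ.* K))          ≡⟨ cong (nat 32 ℚ.*_) (nat-* (K ℕ.* K) (K ℕ.* K)) ⟩
  nat 32 ℚ.* (nat (K ℕ.* K) ℚ.* nat (K ℕ.* K))    ≡⟨ cong (λ z → nat 32 ℚ.* (z ℚ.* z)) (nat-* K K) ⟩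
  nat 32 ℚ.* (nat K ℚ.* nat K ℚ.* (nat K ℚ.* nat K)) ∎
  where
  open ≡-Reasoning
  K = 2 ℕ.^ l

halving*stake : ∀ l → nat (halving l) ℚ.* twiceSquare (stake l) ≡ 1ℚ
halving*stake l = begin
  nat (halving l) ℚ.* twiceSquare (stake l)
    ≡⟨ cong (ℚ._* twiceSquare (stake l)) (nat-halving l) ⟩
  nat 32 ℚ.* (L ℚ.* L ℚ.* (L ℚ.* L)) ℚ.* twiceSquare (stake l)
    ≡⟨ solve 2 (λ L t → let η = con (½ ^ℚ 3) :* (t :* t) in
         con (nat 32) :* (L :* L :* (L :* L)) :* (η :* η :+ η :* η) :=
         (t :* L) :* (t :* L) :* ((t :* L) :* (t :* L))) refl L t ⟩
  (t ℚ.* L) ℚ.* (t ℚ.* L) ℚ.* ((t ℚ.* L) ℚ.* (t ℚ.* L))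
    ≡⟨ cong (λ z → z ℚ.* z ℚ.* (z ℚ.* z)) (½^*2^ l) ⟩
  1ℚ ∎
  where
  open ≡-Reasoning
  L = nat (2 ℕ.^ l)
  t = ½ ^ℚ l

⊤-nonempty : ∀ n .{{_ : NonZero n}} → Nonempty (⊤ {n})
⊤-nonempty (suc n) = zero , ∈⊤

module _ (l k n : ℕ) .{{_ : NonZero n}} where

  private
    r = proj₁ (power-of-two n)

    size : 2 ℕ.^ r ≡ n ℕ.+ proj₁ (proj₂ (power-of-two n))
    size = proj₁ (proj₂ (proj₂ (power-of-two n)))

    2^r≤2n : 2 ℕ.^ r ℕ.≤ 2 ℕ.* n
    2^r≤2n = proj₂ (proj₂ (proj₂ (power-of-two n)))

  open Betting (⊤-nonempty n) (drawOpponent {r} size) (stake l)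

  -- The tester for distance 2^-l and error probability 2^-k.
  bettingTester : Algorithm n (rounds l k ℕ.* 2)
  bettingTester = record
    { coins    = rounds l k ℕ.* r
    ; strategy = betting (rounds l k) (½ ^ℚ k) }

  module _ {μ : Distribution n} (O : ConditionalOracle μ) where

    bettingTester-accepts : Uniform n μ → fromℚ (1ℚ ℚ.- ½ ^ℚ k) ≼ Pr O bettingTester true
    bettingTester-accepts unif = accept-fair O (stake-nonNeg l) (stake≤½ l)
      (meanScore-uniform {n} {r} (⊤-nonempty n) size (stake l) O unif) (rounds l k) (½ ^ℚ k) (½^-nonNeg k)

    bettingTester-rejects : fromℚ (½ ^ℚ l) ≼ distance μ (uniform n) →
      fromℚ (1ℚ ℚ.- ½ ^ℚ k) ≼ Pr O bettingTester false
    bettingTester-rejects far = ≼-trans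
      (fromℚ-mono (ℚ.+-monoʳ-≤ 1ℚ (ℚ.neg-antimono-≤ decayed)))
      (reject-biased O (stake-nonNeg l) (stake≤½ l) biased (rounds l k) (½ ^ℚ k) (nat (2 ℕ.^ k))
        (nat-nonNeg (2 ℕ.^ k)) (eq≤ (sym (½^*2^ k))))
      where
      open ℚ.≤-Reasoning
      x = twiceSquare (stake l)
      x≤1 : x ℚ.≤ 1ℚ
      x≤1 = twiceSquare≤1 (stake-nonNeg l) (stake≤½ l)
      biased : fromℚ (stake l ℚ.+ stake l ℚ.+ (stake l ℚ.+ stake l)) ≼ meanScore O
      biased = ≼-trans (≈⇒≼ (pointwise λ _ → solve 1 (λ t → let η = con (½ ^ℚ 3) :* (t :* t) in
          η :+ η :+ (η :+ η) := con ½ :* (t :* t)) refl (½ ^ℚ l)))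
        (meanScore-far {n} {r} (⊤-nonempty n) size (stake l) O (½ ^ℚ l) (½^-nonNeg l) far 2^r≤2n)
      decayed : (1ℚ ℚ.- x) ^ℚ rounds l k ℚ.* nat (2 ℕ.^ k) ℚ.≤ ½ ^ℚ k
      decayed = begin
        (1ℚ ℚ.- x) ^ℚ rounds l k ℚ.* nat (2 ℕ.^ k)
          ≤⟨ ℚ.*-monoʳ-≤-nonNeg (nat (2 ℕ.^ k)) {{ℚ.nonNegative (nat-nonNeg (2 ℕ.^ k))}}
               (power-decay {1ℚ ℚ.- x} {halving l} (p≤q⇒0≤q-p x≤1)
                 (decay≤½ (halving l) x (twiceSquare-nonNeg (stake-nonNeg l)) x≤1 (halving*stake l))
                      (k ℕ.+ k)) ⟩
        ½ ^ℚ (k ℕ.+ k) ℚ.* nat (2 ℕ.^ k)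
          ≡⟨ cong (ℚ._* nat (2 ℕ.^ k)) (^-homo-* ½ k k) ⟩
        ½ ^ℚ k ℚ.* ½ ^ℚ k ℚ.* nat (2 ℕ.^ k)
          ≡⟨ ℚ.*-assoc (½ ^ℚ k) (½ ^ℚ k) (nat (2 ℕ.^ k)) ⟩
        ½ ^ℚ k ℚ.* (½ ^ℚ k ℚ.* nat (2 ℕ.^ k))
          ≡⟨ cong (½ ^ℚ k ℚ.*_) (½^*2^ k) ⟩
        ½ ^ℚ k ℚ.* 1ℚ
          ≡⟨ ℚ.*-identityʳ (½ ^ℚ k) ⟩
        ½ ^ℚ k ∎

dyadic≼ : ∀ x → fromℚ (½ ^ℚ exponent x) ≼ value x
dyadic≼ x = pointwise-≼ (proj₁ (proj₂ (dyadic x)))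

1-x≼ : ∀ x → 1ℝ - value x ≼ fromℚ (1ℚ ℚ.- ½ ^ℚ exponent x)
1-x≼ x = ≼-trans (+-mono-≼ (≼-refl {1ℝ}) (neg-anti-≼ (dyadic≼ x))) (≈⇒≼ (pointwise λ _ → refl))

-- The number of samples does not depend on n.
uniformityTester : AdaptiveTester Uniform
uniformityTester = record
  { samples   = λ ε δ n → rounds (exponent ε) (exponent δ) ℕ.* 2
  ; algorithm = λ ε δ n → bettingTester (exponent ε) (exponent δ) n
  ; accepts   = λ ε δ n μ O unif → ≼⇒≤ (≼-trans (1-x≼ δ)
      (bettingTester-accepts (exponent ε) (exponent δ) n O unif))
  ; rejects   = λ ε δ n μ O far → ≼⇒≤ (≼-trans (1-x≼ δ) (bettingTester-rejects (exponent ε) (exponent δ) n O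
      (≼-trans (dyadic≼ ε) (≤⇒≼ (far (uniform n) λ i → ≈⇒≃ (≈-refl {fromℚ (ℤ.+ 1 ℚ./ n)}))))))
  }

-- The sample complexity

-- Eventually the terms of the inverse of x < 1 are at least 1 and 2^k / 8, where
-- 2^-k is the power of two chosen for x.
inverse-lower : ∀ x → value x < 1ℝ → Eventually (λ n →
  1ℚ ℚ.≤ seq (value (x ⁻¹)) n × nat (2 ℕ.^ exponent x) ℚ.≤ nat 8 ℚ.* seq (value (x ⁻¹)) n)
inverse-lower x x<1@(d , 0<d , below-1) = eventually-map₂
  (λ n p q → bounds (seq (value (x ⁻¹)) n) (seq (value x) n) p q)
  (eventually-× (inverse-eventually x) (positive-terms {value (x ⁻¹)} (positive (x ⁻¹))))
  (eventually-× (eventually-map (λ n → ℚ.≤-trans (p≤p+e (ℚ.<⇒≤ 0<d))) below-1) (proj₂ (proj₂ (dyadic x)) x<1))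
  where
  open ℚ.≤-Reasoning
  k = exponent x
  positive-terms : ∀ {y} → 0ℝ < y → Eventually (λ n → 0ℚ ℚ.≤ seq y n)
  positive-terms (e , 0<e , e≤y) = eventually-map (λ n → ℚ.≤-trans (+-nonNeg ℚ.≤-refl (ℚ.<⇒≤ 0<e))) e≤y
  bounds : ∀ a p → a ℚ.* p ≡ 1ℚ × 0ℚ ℚ.≤ a → p ℚ.≤ 1ℚ × p ℚ.≤ nat 8 ℚ.* ½ ^ℚ k →
    1ℚ ℚ.≤ a × nat (2 ℕ.^ k) ℚ.≤ nat 8 ℚ.* a
  bounds a p (ap≡1 , 0≤a) (p≤1 , p≤8h) =
    (begin
      1ℚ           ≡⟨ ap≡1 ⟨
      a ℚ.* p      ≤⟨ ℚ.*-monoˡ-≤-nonNeg a {{ℚ.nonNegative 0≤a}} p≤1 ⟩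
      a ℚ.* 1ℚ     ≡⟨ ℚ.*-identityʳ a ⟩
      a            ∎) ,
    cancel-≤ (nat (2 ℕ.^ k)) (½ ^ℚ k) _ _ (nat-nonNeg (2 ℕ.^ k))
      (trans (ℚ.*-comm (nat (2 ℕ.^ k)) (½ ^ℚ k)) (½^*2^ k)) (begin
      ½ ^ℚ k ℚ.* nat (2 ℕ.^ k)     ≡⟨ trans (½^*2^ k) (sym ap≡1) ⟩
      a ℚ.* p                      ≤⟨ ℚ.*-monoˡ-≤-nonNeg a {{ℚ.nonNegative 0≤a}} p≤8h ⟩
      a ℚ.* (nat 8 ℚ.* ½ ^ℚ k)
        ≡⟨ solve 3 (λ a c h → a :* (c :* h) := h :* (c :* a)) refl a (nat 8) (½ ^ℚ k) ⟩
      ½ ^ℚ k ℚ.* (nat 8 ℚ.* a)     ∎)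

-- For the tester making 128 · 2^(4l) k queries: 8⁴ stems from the factor 8 by which
-- 2^-l may fall short of ε.
sampleConstant : ℚ
sampleConstant = nat 128 ℚ.* (nat 8 ℚ.* nat 8 ℚ.* (nat 8 ℚ.* nat 8))

-- 2^19 ε⁻⁴ (6 + 8 log δ⁻¹)
sampleBound : Polynomial 2
sampleBound =
  (fromℚ (sampleConstant ℚ.* nat 6) , 4 ∷ 0 ∷ []) ∷
  (fromℚ (sampleConstant ℚ.* nat 8) , 4 ∷ 1 ∷ []) ∷ []

samples≤ : ∀ l k a y → 0ℚ ℚ.≤ a → nat (2 ℕ.^ l) ℚ.≤ nat 8 ℚ.* a → nat k ℚ.≤ nat 6 ℚ.+ nat 8 ℚ.* y →
  nat (rounds l k ℕ.* 2) ℚ.≤ sampleConstant ℚ.* (a ℚ.* a ℚ.* (a ℚ.* a)) ℚ.* (nat 6 ℚ.+ nat 8 ℚ.* y)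
samples≤ l k a y 0≤a L≤8a k≤ = begin
  nat (rounds l k ℕ.* 2)
    ≡⟨ nat-* (rounds l k) 2 ⟩
  nat ((k ℕ.+ k) ℕ.* halving l) ℚ.* nat 2
    ≡⟨ cong (ℚ._* nat 2) (nat-* (k ℕ.+ k) (halving l)) ⟩
  nat (k ℕ.+ k) ℚ.* nat (halving l) ℚ.* nat 2
    ≡⟨ cong₂ (λ u v → u ℚ.* v ℚ.* nat 2) (nat-+ k k) (nat-halving l) ⟩
  (nat k ℚ.+ nat k) ℚ.* (nat 32 ℚ.* (L ℚ.* L ℚ.* (L ℚ.* L))) ℚ.* nat 2
    ≡⟨ solve 2 (λ k L → (k :+ k) :* (con (nat 32) :* (L :* L :* (L :* L))) :* con (nat 2) :=
         con (nat 128) :* (L :* L :* (L :* L)) :* k) refl (nat k) L ⟩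
  nat 128 ℚ.* (L ℚ.* L ℚ.* (L ℚ.* L)) ℚ.* nat k
    ≤⟨ *-mono (*-nonNeg (nat-nonNeg 128) (*-nonNeg 0≤b² 0≤b²)) (nat-nonNeg k)
         (ℚ.*-monoˡ-≤-nonNeg (nat 128) (*-mono 0≤b² 0≤L² L²≤b² L²≤b²)) k≤ ⟩
  nat 128 ℚ.* (b ℚ.* b ℚ.* (b ℚ.* b)) ℚ.* (nat 6 ℚ.+ nat 8 ℚ.* y)
    ≡⟨ solve 4 (λ c e a y → c :* (e :* a :* (e :* a) :* (e :* a :* (e :* a))) :* y :=
         c :* (e :* e :* (e :* e)) :* (a :* a :* (a :* a)) :* y)
              refl (nat 128) (nat 8) a (nat 6 ℚ.+ nat 8 ℚ.* y) ⟩
  sampleConstant ℚ.* (a ℚ.* a ℚ.* (a ℚ.* a)) ℚ.* (nat 6 ℚ.+ nat 8 ℚ.* y) ∎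
  where
  open ℚ.≤-Reasoning
  L = nat (2 ℕ.^ l)
  b = nat 8 ℚ.* a
  0≤L = nat-nonNeg (2 ℕ.^ l)
  0≤b = *-nonNeg (nat-nonNeg 8) 0≤a
  0≤L² = *-nonNeg 0≤L 0≤L
  0≤b² = *-nonNeg 0≤b 0≤b
  L²≤b² : L ℚ.* L ℚ.≤ b ℚ.* b
  L²≤b² = *-mono 0≤b 0≤L L≤8a L≤8a

theorem3p1p1 : Σ[ T ∈ AdaptiveTester Uniform ] Σ[ p ∈ Polynomial 2 ]
    ((ε δ : ℝ⁺) → value ε < 1ℝ → value δ < 1ℝ → (n : ℕ) .{{_ : NonZero n}} →
    fromℕ (samples T ε δ n) ≤ evaluate p (value (ε ⁻¹) ∷ log (δ ⁻¹) ∷ []))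
theorem3p1p1 = uniformityTester , sampleBound , λ ε δ ε<1 δ<1 n → ≼⇒≤ (pointwise-≼
  {fromℕ (samples uniformityTester ε δ n)}
  {evaluate sampleBound (value (ε ⁻¹) ∷ log (δ ⁻¹) ∷ [])}
  (eventually-map₂ (λ m (1≤a , L≤8a) ((1≤x , 2^k≤8x) , 2^k≤m) → ℚ.≤-trans
      (samples≤ (exponent ε) (exponent δ) (seq (value (ε ⁻¹)) m) (seq (log (δ ⁻¹)) m)
        (ℚ.≤-trans 0≤1 1≤a) L≤8a (exponent≤log 1≤x (exponent δ) m 2^k≤8x 2^k≤m))
      (eq≤ (expand sampleConstant (nat 6) (nat 8) (seq (value (ε ⁻¹)) m) (seq (log (δ ⁻¹)) m))))
    (inverse-lower ε ε<1)
    (eventually-× (inverse-lower δ δ<1) (2 ℕ.^ exponent δ , λ _ 2^k≤m → 2^k≤m))))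
  where
  -- The right-hand side is the form in which the terms of the sequence defining
  -- the value of the polynomial arise.
  expand : ∀ c e f a y → c ℚ.* (a ℚ.* a ℚ.* (a ℚ.* a)) ℚ.* (e ℚ.+ f ℚ.* y) ≡
    c ℚ.* e ℚ.* (a ^ℚ 4 ℚ.* (1ℚ ℚ.* 1ℚ)) ℚ.+
      (c ℚ.* f ℚ.* (a ^ℚ 4 ℚ.* (y ℚ.* 1ℚ ℚ.* 1ℚ)) ℚ.+ 0ℚ)
  expand = solve 5 (λ c e f a y → c :* (a :* a :* (a :* a)) :* (e :+ f :* y) :=
    c :* e :* (a :* (a :* (a :* (a :* con 1ℚ))) :* (con 1ℚ :* con 1ℚ)) :+
      (c :* f :* (a :* (a :* (a :* (a :* con 1ℚ))) :* (y :* con 1ℚ :* con 1ℚ)) :+ con 0ℚ)) refl
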